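{- Let $\Sigma=\{0,1\}$. For each $t,c,a\in\{\mathrm{Y},\mathrm{N},\ast\}$, there exists a $(\mathrm{Y},t,c,a)$-OWF if and only if $\mathrm{P}\neq\mathrm{NP}$.
   Context: All functions considered are partial functions $\sigma:\Sigma^*\times\Sigma^*\to\Sigma^*$ (possibly undefined on some pairs), with $\Sigma=\{0,1\}$. $\langle\cdot,\cdot\rangle$ is a standard pairing function: a total, polynomial-time computable bijection $\Sigma^*\times\Sigma^*\to\Sigma^*$ with polynomial-time computable inverses, nondecreasing in each argument when the other is fixed. FP is the class of (total or partial) polynomial-time computable functions. - $\sigma$ is honest if there is a polynomial $p$ such that every $z\in\mathrm{image}(\sigma)$ has some $(x,y)\in\mathrm{domain}(\sigma)$ with $\sigma(x,y)=z$ and $|x|+|y|\le p(|z|)$. - $\sigma$ is noninvertible if there is no $f\in\mathrm{FP}$ with $\sigma(f(z))=z$ for all $z\in\mathrm{image}(\sigma)$. - $\sigma$ is a one-way function if it is polynomial-time computable, honest and noninvertible. - $\sigma$ is total if it is defined on every pair, and nontotal otherwise. - Let $\Gamma=\Sigma^*\cup\{\bot\}$ and $\hat\sigma:\Gamma\times\Gamma\to\Gamma$, where $\hat\sigma(x,y)=\sigma(x,y)$ if $x\ne\bot$, $y\ne\bot$ and $(x,y)\in\mathrm{domain}(\sigma)$, and $\hat\sigma(x,y)=\bot$ otherwise. $\sigma$ is associative if $\hat\sigma(\hat\sigma(x,y),z)=\hat\sigma(x,\hat\sigma(y,z))$ for all $x,y,z\in\Sigma^*$. It is commutative if $\hat\sigma(x,y)=\hat\sigma(y,x)$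 for all $x,y\in\Sigma^*$. - $\sigma$ is s-honest if there is a polynomial $p$ such that (a) whenever $\sigma(x,y)=z$ for some $y$, there is $\hat y$ with $\sigma(x,\hat y)=z$ and $|\hat y|\le p(|x|+|z|)$; and (b) whenever $\sigma(x,y)=z$ for some $x$, there is $\hat x$ with $\sigma(\hat x,y)=z$ and $|\hat x|\le p(|y|+|z|)$. - $\sigma$ is invertible with respect to the first argument if there is $g_1\in\mathrm{FP}$ such that for all $z\in\mathrm{image}(\sigma)$ and all $(x,y)\in\mathrm{domain}(\sigma)$ with $\sigma(x,y)=z$, we have $\sigma(x,g_1(\langle x,z\rangle))=z$. It is invertible with respect to the second argument if there is $g_2\in\mathrm{FP}$ such that for all such $z,x,y$, we have $\sigma(g_2(\langle y,z\rangle),y)=z$. - $\sigma$ is strongly noninvertible if it is invertible with respect to neither argument. - $\sigma$ is strong if it is polynomial-time computable, s-honest and strongly noninvertible. - For $s,t,c,a\in\{\mathrm{Y},\mathrm{N},\ast\}$, $\sigma$ is an $(s,t,c,a)$-OWF if $\sigma$ is a one-way function and all of the following hold: if $s=\mathrm{Y}$ then $\sigma$ is strong, and if $s=\mathrm{N}$ then it is not strong; if $t=\mathrm{Y}$ it is total, and if $t=\mathrm{N}$ it is nontotal; if $c=\mathrm{Y}$ it is commutative, and if $c=\mathrm{N}$ it is not commutative; if $a=\mathrm{Y}$ it is associative, and if $a=\mathrm{N}$ it is not associative. The value $\ast$ imposes no condition. -}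

module Defs where

open import Data.Bool using (Bool; true; false)
open import Data.Nat using (ℕ; zero; suc; _+_; _^_; _≤_; _<_)
open import Data.Fin using (Fin)
open import Data.List using (List; []; _∷_; map; length; _++_)
open import Data.List.Relation.Unary.Any using (Any)
open import Data.Maybe using (Maybe; just; nothing)
open import Data.Product using (Σ; _×_; _,_)
open import Data.Sum using (_⊎_)
open import Data.Unit using (⊤)
open import Data.Empty using (⊥)
open import Relation.Nullary using (¬_)
open import Relation.Binary.PropositionalEquality using (_≡_)
open import Function.Bundles using (_⇔_)

Str : Set
Str = List Bool

-- polynomial bounds: every polynomial is dominated by some n^k + k
poly : ℕ → ℕ → ℕ
poly k n = n ^ k + k

data Sym : Set where
  s0 s1 blank : Sym

data Move : Set where
  mL mR mS : Move

data Act (n : ℕ) : Set where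
  halt : Bool → Act n                 -- halt and accept (true) / reject (false)
  go   : Fin n → Sym → Move → Act n

record Config (n : ℕ) : Set where
  constructor cfg
  field
    st  : Fin n
    lft : List Sym      -- cells left of the head, nearest first
    hd  : Sym
    rgt : List Sym      -- cells right of the head, nearest first
open Config public

toSym : Bool → Sym
toSym false = s0
toSym true  = s1

initCfg : {n : ℕ} → Fin n → Str → Config n
initCfg q []       = cfg q [] blank []
initCfg q (b ∷ bs) = cfg q [] (toSym b) (map toSym bs)

applyAct : {n : ℕ} → Fin n → Sym → Move → Config n → Config n
applyAct q s mS (cfg _ l _ r)        = cfg q l s r
applyAct q s mL (cfg _ [] _ r)       = cfg q [] blank (s ∷ r)
applyAct q s mL (cfg _ (x ∷ l) _ r)  = cfg q l x (s ∷ r)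
applyAct q s mR (cfg _ l _ [])       = cfg q (s ∷ l) blank []
applyAct q s mR (cfg _ l _ (x ∷ r))  = cfg q (s ∷ l) x r

readBits : List Sym → Str
readBits []          = []
readBits (s0 ∷ xs)   = false ∷ readBits xs
readBits (s1 ∷ xs)   = true ∷ readBits xs
readBits (blank ∷ _) = []

output : {n : ℕ} → Config n → Str
output c = readBits (hd c ∷ rgt c)

record TM : Set where
  field
    nQ    : ℕ
    start : Fin nQ
    δ     : Fin nQ → Sym → Act nQ

-- drun t c: nothing = did not halt within t steps;
-- just (just w) = accepted with output w; just nothing = rejected (undefined)
drun : {n : ℕ} → (Fin n → Sym → Act n) → ℕ → Config n → Maybe (Maybe Str)
drun δ zero c = nothing
drun δ (suc t) c with δ (st c) (hd c)
... | halt true  = just (just (output c))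
... | halt false = just nothing
... | go q s m   = drun δ t (applyAct q s m c)

exec : TM → ℕ → Str → Maybe (Maybe Str)
exec M t x = drun (TM.δ M) t (initCfg (TM.start M) x)

-- FP: (partial) functions computed in polynomial time; the machine halts on
-- every input within the time bound, outputting f(x) if defined, rejecting otherwise.
FP : (Str → Maybe Str) → Set
FP f = Σ TM λ M → Σ ℕ λ k → ∀ x → exec M (poly k (length x)) x ≡ just (f x)

IsDefined : Maybe Str → Set
IsDefined (just _) = ⊤
IsDefined nothing  = ⊥

InP : (Str → Set) → Set
InP L = Σ TM λ M → Σ ℕ λ k → ∀ x →
  Σ (Maybe Str) λ r → (exec M (poly k (length x)) x ≡ just r) × (L x ⇔ IsDefined r)

record NTM : Set where
  field
    nQ    : ℕ
    start : Fin nQ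
    δ     : Fin nQ → Sym → List (Act nQ)

mutual
  nacc : {n : ℕ} → (Fin n → Sym → List (Act n)) → ℕ → Config n → Set
  nacc δ zero c    = ⊥
  nacc δ (suc t) c = Any (accAct δ t c) (δ (st c) (hd c))

  accAct : {n : ℕ} → (Fin n → Sym → List (Act n)) → ℕ → Config n → Act n → Set
  accAct δ t c (halt true)  = ⊤
  accAct δ t c (halt false) = ⊥
  accAct δ t c (go q s m)   = nacc δ t (applyAct q s m c)

NAccepts : NTM → ℕ → Str → Set
NAccepts M t x = nacc (NTM.δ M) t (initCfg (NTM.start M) x)

InNP : (Str → Set) → Set
InNP L = Σ NTM λ M → Σ ℕ λ k → ∀ x → L x ⇔ NAccepts M (poly k (length x)) x

P≢NP : Set₁
P≢NP = ¬ (∀ (L : Str → Set) → InNP L → InP L)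

lex≤ : Str → Str → Set
lex≤ [] _ = ⊤
lex≤ (_ ∷ _) [] = ⊥
lex≤ (a ∷ as) (b ∷ bs) = ((a ≡ false) × (b ≡ true)) ⊎ ((a ≡ b) × lex≤ as bs)

_≤ql_ : Str → Str → Set
x ≤ql y = (length x < length y) ⊎ ((length x ≡ length y) × lex≤ x y)

-- simple self-delimiting encoding of two strings (used only to state that
-- the pairing function itself is polynomial-time computable)
double : Str → Str
double []       = []
double (b ∷ bs) = b ∷ b ∷ double bs

enc2 : Str → Str → Str
enc2 x y = double x ++ (false ∷ true ∷ y)

record Pairing : Set where
  field
    pair    : Str → Str → Str
    π₁ π₂   : Str → Str
    π₁-pair : ∀ x y → π₁ (pair x y) ≡ x
    π₂-pair : ∀ x y → π₂ (pair x y) ≡ y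
    pair-π  : ∀ z → pair (π₁ z) (π₂ z) ≡ z
    pair-FP : Σ TM λ M → Σ ℕ λ k → ∀ x y →
                exec M (poly k (length x + length y)) (enc2 x y) ≡ just (just (pair x y))
    π₁-FP   : FP (λ z → just (π₁ z))
    π₂-FP   : FP (λ z → just (π₂ z))
    mono₁   : ∀ x x' y → x ≤ql x' → pair x y ≤ql pair x' y
    mono₂   : ∀ x y y' → y ≤ql y' → pair x y ≤ql pair x y'

Fn2 : Set
Fn2 = Str → Str → Maybe Str

module _ (pr : Pairing) where
  open Pairing pr

  PolyTime : Fn2 → Set
  PolyTime σ = FP (λ w → σ (π₁ w) (π₂ w))

  Honest : Fn2 → Set
  Honest σ = Σ ℕ λ k → ∀ x y z → σ x y ≡ just z →
    Σ Str λ x' → Σ Str λ y' → (σ x' y' ≡ just z) × (length x' + length y' ≤ poly k (length z))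

  -- an inverter outputs a string f(z), read as the pair ⟨x,y⟩
  Noninvertible : Fn2 → Set
  Noninvertible σ = ¬ (Σ (Str → Maybe Str) λ f → FP f × (∀ x y z → σ x y ≡ just z →
    Σ Str λ w → (f z ≡ just w) × (σ (π₁ w) (π₂ w) ≡ just z)))

  OneWay : Fn2 → Set
  OneWay σ = PolyTime σ × Honest σ × Noninvertible σ

  SHonest : Fn2 → Set
  SHonest σ = Σ ℕ λ k →
    (∀ x y z → σ x y ≡ just z → Σ Str λ y' → (σ x y' ≡ just z) × (length y' ≤ poly k (length x + length z)))
    × (∀ x y z → σ x y ≡ just z → Σ Str λ x' → (σ x' y ≡ just z) × (length x' ≤ poly k (length y + length z)))

  InvFirst : Fn2 → Set
  InvFirst σ = Σ (Str → Maybe Str) λ g → FP g × (∀ x y z → σ x y ≡ just z →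
    Σ Str λ w → (g (pair x z) ≡ just w) × (σ x w ≡ just z))

  InvSecond : Fn2 → Set
  InvSecond σ = Σ (Str → Maybe Str) λ g → FP g × (∀ x y z → σ x y ≡ just z →
    Σ Str λ w → (g (pair y z) ≡ just w) × (σ w y ≡ just z))

  StronglyNoninvertible : Fn2 → Set
  StronglyNoninvertible σ = ¬ InvFirst σ × ¬ InvSecond σ

  Strong : Fn2 → Set
  Strong σ = PolyTime σ × SHonest σ × StronglyNoninvertible σ

Total : Fn2 → Set
Total σ = ∀ x y → Σ Str λ z → σ x y ≡ just z

hat : Fn2 → Maybe Str → Maybe Str → Maybe Str
hat σ (just x) (just y) = σ x y
hat σ _ _ = nothing

Associative : Fn2 → Set
Associative σ = ∀ x y z → hat σ (σ x y) (just z) ≡ hat σ (just x) (σ y z)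

Commutative : Fn2 → Set
Commutative σ = ∀ x y → σ x y ≡ σ y x

data Opt : Set where
  Y N ⋆ : Opt

cond : Opt → Set → Set
cond Y A = A
cond N A = ¬ A
cond ⋆ A = ⊤

OWF : Pairing → Opt → Opt → Opt → Opt → Fn2 → Set
OWF pr s t c a σ = OneWay pr σ × cond s (Strong pr σ) × cond t (Total σ)
                   × cond c (Commutative σ) × cond a (Associative σ)

{-# OPTIONS --safe #-}
-- Let x range over the instances of a universal NP problem (does the nondeterministic machine given by a rule
-- table accept from a coded tape within a number of steps given in unary?) and w over their witnesses. The
-- product of 10x and 11w, in either order, is 00x if w is a witness for x. All other products are the empty
-- string or undefined, depending on whether a total function is wanted, except those of two one-bit strings,
-- where a Boolean operation decides on commutativity and associativity. Inverting the product, or inverting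
-- it when one factor 10x is known, means finding witnesses, and that puts NP into P. Conversely, if P = NP,
-- then a preimage under an honest function is found bit by bit, since it is an NP question whether a given
-- string is a suffix of a preimage. Polynomial-time bounds come from programs on finitely many bit stacks,
-- which are compiled into Turing machines with the stacks side by side on the tape, separated by blanks.
module Submission where

-- `P≢NP` is the negation of a universal statement, so no particular language outside P can be
-- extracted from it. One product that is hard for a universal problem avoids this: an inverter
-- would decide every language in NP, which is just what is refuted. In the other direction, the
-- collapse is assumed and applied to the language that the bitwise search asks about.
--
-- The format of witnesses is made for honesty. A witness selects rules of the table one after
-- another, may advance its pointer only a bounded number of times per tick of the clock, and has to
-- end with the accepting rule. Hence every witness is polynomially short in its query, and so are
-- the factors of each product `00x`. Products equal to the default value may have arbitrarily long
-- factors, but the empty string is then a short substitute for either of them.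
--
-- An answer of a supposed inverter is never trusted: it is multiplied out again, and whatever turns
-- out to be a preimage of `00x` certifies a witness for `x`.

open import Defs
open import Data.Bool using (Bool; true; false; if_then_else_; _∧_; _∨_; not)
open import Data.Empty using (⊥; ⊥-elim)
open import Data.Fin as Fin using (Fin; zero; suc; toℕ; fromℕ<)
import Data.Fin.Properties as Fin
open import Data.List as List
  using (List; []; _∷_; _++_; _ʳ++_; _∷ʳ_; _∷ʳ′_; allFin; concatMap; drop; initLast; length; map; null; replicate; reverse)
open import Data.List.Membership.Propositional using (_∈_; find; lose)
open import Data.List.Membership.Propositional.Properties using (∈-∃++; ∈-allFin; ∈-concatMap⁺; ∈-concatMap⁻; ∈-map⁺; ∈-map⁻)
import Data.List.Properties as List
open import Data.List.Relation.Unary.Any as Any using (Any; here; there)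
open import Data.Maybe as Maybe using (Maybe; just; nothing; maybe; is-just; fromMaybe; _>>=_)
open import Data.Maybe.Properties using (just-injective)
open import Data.Nat
open import Data.Nat.Properties
open import Data.Nat.Tactic.RingSolver using (solve-∀)
open import Data.Product using (Σ; _×_; _,_; proj₁; proj₂)
open import Data.Sum as Sum using (_⊎_; inj₁; inj₂)
open import Data.Unit using (⊤; tt)
open import Data.Vec as Vec using (Vec; []; _∷_)
open import Function using (_∘_; _$_; id)
open import Function.Bundles using (_⇔_; mk⇔; Equivalence)
open import Relation.Binary.PropositionalEquality
open import Relation.Nullary using (Dec; yes; no; ¬_)

-- Polynomial bounds

-- With a base of at least 2, constants, sums and products are absorbed by a larger exponent,
-- without the exceptions that `n ^ k` has at 0 and 1. Only at the end does `poly-dominates` convert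
-- to `poly`.
PolyBounded : (ℕ → ℕ) → Set
PolyBounded f = Σ ℕ λ c → ∀ n → f n ≤ (2 + n) ^ c

n≤[2+m]^n : ∀ m n → n ≤ (2 + m) ^ n
n≤[2+m]^n m zero = z≤n
n≤[2+m]^n m (suc n) = begin
  suc n             ≤⟨ +-mono-≤ (m^n>0 (2 + m) n) (n≤[2+m]^n m n) ⟩
  X + X             ≤⟨ +-monoʳ-≤ X (m≤m+n X (m * X)) ⟩
  X + (X + m * X)   ∎
  where open ≤-Reasoning
        X = (2 + m) ^ n

abstract
  pb-const : ∀ k → PolyBounded (λ _ → k)
  pb-const k = k , λ n → n≤[2+m]^n n k

  pb-id : PolyBounded (λ n → n)
  pb-id = 1 , λ n → ≤-trans (m≤n+m n 2) (≤-reflexive (sym (*-identityʳ (2 + n))))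

  pb-+ : ∀ {f g} → PolyBounded f → PolyBounded g → PolyBounded (λ n → f n + g n)
  pb-+ {f} {g} (a , F) (b , G) = suc (a + b) , λ n →
    let X = (2 + n) ^ (a + b) in begin
    f n + g n                      ≤⟨ +-mono-≤ (F n) (G n) ⟩
    (2 + n) ^ a + (2 + n) ^ b      ≤⟨ +-mono-≤ (^-monoʳ-≤ (2 + n) (m≤m+n a b)) (^-monoʳ-≤ (2 + n) (m≤n+m b a)) ⟩
    X + X                          ≤⟨ +-monoʳ-≤ X (m≤m+n X (n * X)) ⟩
    X + (X + n * X)                ∎
    where open ≤-Reasoning

  pb-* : ∀ {f g} → PolyBounded f → PolyBounded g → PolyBounded (λ n → f n * g n)
  pb-* (a , F) (b , G) = a + b , λ n →
    ≤-trans (*-mono-≤ (F n) (G n)) (≤-reflexive (sym (^-distribˡ-+-* (2 + n) a b)))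

  pb-mono : ∀ {f g} → (∀ n → f n ≤ g n) → PolyBounded g → PolyBounded f
  pb-mono h (c , G) = c , λ n → ≤-trans (h n) (G n)

  pb-^ : ∀ {f} → PolyBounded f → ∀ c → PolyBounded (λ n → (2 + f n) ^ c)
  pb-^ {f} F c with pb-+ (pb-const 2) F
  ... | d , G = d * c , λ n → ≤-trans (^-monoˡ-≤ c (G n)) (≤-reflexive (^-*-assoc (2 + n) d c))

  pb-poly : ∀ k {f} → PolyBounded f → PolyBounded (λ n → poly k (f n))
  pb-poly k F = pb-mono (λ n → +-monoˡ-≤ k (^-monoˡ-≤ k (m≤n+m _ 2))) (pb-+ (pb-^ F k) (pb-const k))

pb-linear : ∀ c → PolyBounded (λ n → suc n * c)
pb-linear c = pb-* (pb-+ (pb-const 1) pb-id) (pb-const c)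

poly-mono : ∀ k {m n} → m ≤ n → poly k m ≤ poly k n
poly-mono k m≤n = +-monoˡ-≤ k (^-monoˡ-≤ k m≤n)

private
  -- For `n` at least 2, `2 + n ≤ n * n`, so the exponent `c + c` suffices. At 0 and 1 the left-hand
  -- side is at most `3 ^ c`, and the additive constant of `poly` takes care of that.
  power-dominated : ∀ c n → (2 + n) ^ c ≤ poly (c + c + 3 ^ c) n
  power-dominated c = bound
    where
    k : ℕ
    k = c + c + 3 ^ c
    3^c≤ : ∀ m → 3 ^ c ≤ m + k
    3^c≤ m = ≤-trans (m≤n+m (3 ^ c) (c + c)) (m≤n+m k m)
    square : ∀ m → 4 + m + (m * m + (m + m) + m) ≡ (2 + m) * (2 + m)
    square = solve-∀
    bound : ∀ n → (2 + n) ^ c ≤ poly k n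
    bound 0 = ≤-trans (^-monoˡ-≤ c (s≤s (s≤s z≤n))) (3^c≤ (0 ^ k))
    bound 1 = 3^c≤ (1 ^ k)
    bound n@(suc (suc m)) = begin
      (2 + n) ^ c            ≤⟨ ^-monoˡ-≤ c (≤-trans (m≤m+n (2 + n) (m * m + (m + m) + m)) (≤-reflexive (square m))) ⟩
      (n * n) ^ c            ≡⟨ cong (_^ c) (sym (cong (n *_) (*-identityʳ n))) ⟩
      (n ^ 2) ^ c            ≡⟨ ^-*-assoc n 2 c ⟩
      n ^ (c + (c + 0))      ≡⟨ cong (λ z → n ^ (c + z)) (+-identityʳ c) ⟩
      n ^ (c + c)            ≤⟨ ^-monoʳ-≤ n (m≤m+n (c + c) (3 ^ c)) ⟩
      n ^ k                  ≤⟨ m≤m+n (n ^ k) k ⟩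
      poly k n               ∎
      where open ≤-Reasoning

abstract
  poly-dominates : ∀ {f} → PolyBounded f → Σ ℕ λ k → ∀ n → f n ≤ poly k n
  poly-dominates (c , F) = c + c + 3 ^ c , λ n → ≤-trans (F n) (power-dominated c n)

-- Programs over a set of operations

record Enum (A : Set) : Set where
  field
    size    : ℕ
    enc     : A → Fin size
    dec     : Fin size → Maybe A
    dec-enc : ∀ a → dec (enc a) ≡ just a
open Enum

enum-Fin : ∀ {n} → Enum (Fin n)
enum-Fin {n} = record { size = n ; enc = id ; dec = just ; dec-enc = λ _ → refl }

enum-⊥ : Enum ⊥
enum-⊥ = record { size = 0 ; enc = λ () ; dec = λ () ; dec-enc = λ () }

enum-⊤ : Enum ⊤
enum-⊤ = record { size = 1 ; enc = λ _ → zero ; dec = λ _ → just tt ; dec-enc = λ _ → refl }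

enum-⊎ : ∀ {A B} → Enum A → Enum B → Enum (A ⊎ B)
enum-⊎ {A} {B} α β = record
  { size    = size α + size β
  ; enc     = Fin.join (size α) (size β) ∘ Sum.map (enc α) (enc β)
  ; dec     = dec′ ∘ Fin.splitAt (size α)
  ; dec-enc = λ x → trans (cong dec′ (Fin.splitAt-join (size α) (size β) (Sum.map (enc α) (enc β) x))) (right x) }
  where
  dec′ : Fin (size α) ⊎ Fin (size β) → Maybe (A ⊎ B)
  dec′ (inj₁ i) = Maybe.map inj₁ (dec α i)
  dec′ (inj₂ j) = Maybe.map inj₂ (dec β j)
  right : ∀ x → dec′ (Sum.map (enc α) (enc β) x) ≡ just x
  right (inj₁ a) = cong (Maybe.map inj₁) (dec-enc α a)
  right (inj₂ b) = cong (Maybe.map inj₂) (dec-enc β b)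

enum-retract : ∀ {A B : Set} (f : A → B) (g : B → A) → (∀ a → g (f a) ≡ a) → Enum B → Enum A
enum-retract f g gf β = record
  { size = size β ; enc = enc β ∘ f ; dec = Maybe.map g ∘ dec β
  ; dec-enc = λ a → trans (cong (Maybe.map g) (dec-enc β (f a))) (cong just (gf a)) }

enum-Maybe : ∀ {A} → Enum A → Enum (Maybe A)
enum-Maybe α = enum-retract (maybe inj₂ (inj₁ tt)) Sum.[ (λ _ → nothing) , just ]
  (λ { nothing → refl ; (just _) → refl }) (enum-⊎ enum-⊤ α)

enum-Bool : Enum Bool
enum-Bool = enum-retract (λ b → if b then just tt else nothing) is-just
  (λ { true → refl ; false → refl }) (enum-Maybe enum-⊤)

enum-Sym : Enum Sym
enum-Sym = enum-retract to from (λ { s0 → refl ; s1 → refl ; blank → refl }) (enum-Maybe enum-Bool)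
  where
  to : Sym → Maybe Bool
  to s0    = just false
  to s1    = just true
  to blank = nothing
  from : Maybe Bool → Sym
  from (just b) = toSym b
  from nothing  = blank

maxFin : ∀ {n} → (Fin n → ℕ) → ℕ
maxFin {zero}  f = 0
maxFin {suc n} f = f zero ⊔ maxFin (f ∘ suc)

≤-maxFin : ∀ {n} (f : Fin n → ℕ) i → f i ≤ maxFin f
≤-maxFin f zero    = m≤m⊔n (f zero) _
≤-maxFin f (suc i) = ≤-trans (≤-maxFin (f ∘ suc) i) (m≤n⊔m (f zero) _)

module _ {A : Set} {B : A → Set} (α : Enum A) (β : ∀ a → Enum (B a)) where
  private
    width : ℕ
    width = maxFin (maybe (size ∘ β) 0 ∘ dec α)

    fits : ∀ a → size (β a) ≤ width
    fits a = subst (λ m → maybe (size ∘ β) 0 m ≤ width) (dec-enc α a)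
                   (≤-maxFin (maybe (size ∘ β) 0 ∘ dec α) (enc α a))

    decB : ∀ a (j : Fin width) → Dec (toℕ j < size (β a)) → Maybe (Σ A B)
    decB a j (yes lt) = Maybe.map (a ,_) (dec (β a) (fromℕ< lt))
    decB a j (no _)   = nothing

    decΣ : Fin (size α) × Fin width → Maybe (Σ A B)
    decΣ (i , j) = dec α i >>= λ a → decB a j (toℕ j <? size (β a))

    encΣ : Σ A B → Fin (size α) × Fin width
    encΣ (a , b) = enc α a , Fin.inject≤ (enc (β a) b) (fits a)

    decB-enc : ∀ a b d → decB a (Fin.inject≤ (enc (β a) b) (fits a)) d ≡ just (a , b)
    decB-enc a b (yes lt) = trans
      (cong (Maybe.map (a ,_) ∘ dec (β a))
        (Fin.toℕ-injective (trans (Fin.toℕ-fromℕ< lt) (Fin.toℕ-inject≤ (enc (β a) b) (fits a)))))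
      (cong (Maybe.map (a ,_)) (dec-enc (β a) b))
    decB-enc a b (no ge) = ⊥-elim (ge (subst (_< size (β a))
      (sym (Fin.toℕ-inject≤ (enc (β a) b) (fits a))) (Fin.toℕ<n (enc (β a) b))))

    decΣ-enc : ∀ x → decΣ (encΣ x) ≡ just x
    decΣ-enc (a , b) = trans (cong (_>>= λ a′ → decB a′ j (toℕ j <? size (β a′))) (dec-enc α a))
      (decB-enc a b (toℕ j <? size (β a)))
      where j = proj₂ (encΣ (a , b))

  -- Fibres of different sizes are padded to the largest one, which turns a pair into an element of
  -- a product of two ranges; a second component beyond its own fibre decodes to `nothing`.
  enum-Σ : Enum (Σ A B)
  enum-Σ = record
    { size    = size α * width
    ; enc     = λ x → Fin.combine (proj₁ (encΣ x)) (proj₂ (encΣ x))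
    ; dec     = λ k → decΣ (Fin.remQuot width k)
    ; dec-enc = λ x → trans (cong decΣ (Fin.remQuot-combine (proj₁ (encΣ x)) (proj₂ (encΣ x)))) (decΣ-enc x) }

-- Loops carry data of finite types only, so that a program has finitely many control states.
data Prog (Op : Set) (Res : Op → Set) (E : Set) : Set₁ where
  ret  : E → Prog Op Res E
  op   : (o : Op) → (Res o → Prog Op Res E) → Prog Op Res E
  loop : {A B : Set} → Enum A → Enum B → (A → Prog Op Res (A ⊎ B)) → A → (B → Prog Op Res E) → Prog Op Res E

infixl 1 _>>_
infixl 1 _then_

_then_ : ∀ {Op Res E F} → Prog Op Res E → (E → Prog Op Res F) → Prog Op Res F
ret e          then f = f e
op o k         then f = op o (λ r → k r then f)
loop α β g a c then f = loop α β g a (λ b → c b then f)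

_>>_ : ∀ {Op Res F} → Prog Op Res ⊤ → Prog Op Res F → Prog Op Res F
p >> q = p then λ _ → q

module Semantics {Op : Set} {Res : Op → Set} {X : Set} (sem : (o : Op) → X → Res o × X) where

  -- Run p x n e y: started in x, the program p returns e in state y after at most n steps.
  data Run {E : Set} : Prog Op Res E → X → ℕ → E → X → Set₁ where
    r-ret  : ∀ {e x n} → Run (ret e) x n e x
    r-op   : ∀ {o k x n e y} → Run (k (proj₁ (sem o x))) (proj₂ (sem o x)) n e y →
             Run (op o k) x (suc n) e y
    r-go   : ∀ {A B} {α : Enum A} {β : Enum B} {f a c x m a′ y n e z} →
             Run (f a) x m (inj₁ a′) y → Run (loop α β f a′ c) y n e z →
             Run (loop α β f a c) x (suc (m + n)) e z
    r-stop : ∀ {A B} {α : Enum A} {β : Enum B} {f a c x m b y n e z} →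
             Run (f a) x m (inj₂ b) y → Run (c b) y n e z →
             Run (loop α β f a c) x (suc (m + n)) e z

  weaken : ∀ {E} {p : Prog Op Res E} {x n m e y} → n ≤ m → Run p x n e y → Run p x m e y
  weaken n≤m r-ret = r-ret
  weaken (s≤s n≤m) (r-op r) = r-op (weaken n≤m r)
  -- The surplus is credited to the rest of the loop; the iteration keeps its own bound.
  weaken {m = suc m} (s≤s n≤m) (r-go {m = a} {n = b} r q) =
    subst (λ t → Run _ _ (suc t) _ _) (m+[n∸m]≡n (≤-trans (m≤m+n a b) n≤m))
      (r-go r (weaken (m+n≤o⇒m≤o∸n b (≤-trans (≤-reflexive (+-comm b a)) n≤m)) q))
  weaken {m = suc m} (s≤s n≤m) (r-stop {m = a} {n = b} r q) =
    subst (λ t → Run _ _ (suc t) _ _) (m+[n∸m]≡n (≤-trans (m≤m+n a b) n≤m))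
      (r-stop r (weaken (m+n≤o⇒m≤o∸n b (≤-trans (≤-reflexive (+-comm b a)) n≤m)) q))

  r-then : ∀ {E F} {p : Prog Op Res E} {f : E → Prog Op Res F} {x n e y m e′ z} →
           Run p x n e y → Run (f e) y m e′ z → Run (p then f) x (n + m) e′ z
  r-then {n = n} {m = m} r-ret q = weaken (m≤n+m m n) q
  r-then (r-op r) q = r-op (r-then r q)
  r-then {f = f} {m = k} (r-go {m = a} {n = b} r s) q =
    weaken (s≤s (≤-reflexive (sym (+-assoc a b k)))) (r-go r (r-then {f = f} s q))
  r-then {f = f} {m = k} (r-stop {m = a} {n = b} r s) q =
    weaken (s≤s (≤-reflexive (sym (+-assoc a b k)))) (r-stop r (r-then {f = f} s q))

-- Implementing operations by programs

handle : ∀ {Op Res Op′ Res′} → ((o : Op) → Prog Op′ Res′ (Res o)) → ∀ {E} → Prog Op Res E → Prog Op′ Res′ E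
handle h (ret e)          = ret e
handle h (op o k)         = h o then λ r → handle h (k r)
handle h (loop α β f a c) = loop α β (λ a → handle h (f a)) a (λ b → handle h (c b))

module Simulation
  {Op : Set} {Res : Op → Set} {X : Set} (sem : (o : Op) → X → Res o × X)
  {Op′ : Set} {Res′ : Op′ → Set} {X′ : Set} (sem′ : (o : Op′) → X′ → Res′ o × X′)
  (h : (o : Op) → Prog Op′ Res′ (Res o))
  (_∼_ : X → X′ → Set) (size : X → ℕ) (c : ℕ)
  (grows : ∀ o x → size (proj₂ (sem o x)) ≤ suc (size x))
  (sound : ∀ o {x x′} → x ∼ x′ → Σ X′ λ y′ →
     Semantics.Run sem′ (h o) x′ (c * suc (size x)) (proj₁ (sem o x)) y′ × (proj₂ (sem o x) ∼ y′))
  where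
  open Semantics sem
  open Semantics sem′ using () renaming (Run to Run′)
  private
    module S′ = Semantics sem′

    loop-time : ∀ m n C → suc (m * suc C + n * suc C) ≤ suc (m + n) * suc C
    loop-time m n C = s≤s (≤-trans (≤-reflexive (sym (*-distribʳ-+ (suc C) m n))) (m≤n+m _ C))

    first-fits : ∀ {s cap} m {n} → s + suc (m + n) ≤ cap → s + m ≤ cap
    first-fits {s} m {n} = ≤-trans (+-monoʳ-≤ s (≤-trans (m≤m+n m n) (n≤1+n _)))

    rest-fits : ∀ {s s′} m {n} → s′ ≤ s + m → s′ + n ≤ s + suc (m + n)
    rest-fits {s} m {n} le = ≤-trans (+-monoˡ-≤ n le) (≤-trans (≤-reflexive (+-assoc s m n)) (+-monoʳ-≤ s (n≤1+n _)))

  -- An operation enlarges the store by at most one, so its size stays at most `cap` during the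
  -- whole run and all simulated operations share the bound `c * suc cap`. The extra `suc` pays for
  -- the steps taken by loops themselves.
  simulate : ∀ cap {E} {p : Prog Op Res E} {x n e y x′} → Run p x n e y → x ∼ x′ → size x + n ≤ cap →
             Σ X′ λ y′ → Run′ (handle h p) x′ (n * suc (c * suc cap)) e y′ × (y ∼ y′) × (size y ≤ size x + n)
  simulate cap r-ret x∼x′ b = _ , S′.r-ret , x∼x′ , m≤m+n _ _
  simulate cap {x = x} {n = suc n} (r-op {o = o} r) x∼x′ b with sound o x∼x′
  ... | z′ , run , z∼z′ with simulate cap r z∼z′ (≤-trans (+-monoˡ-≤ n (grows o x))
    (≤-trans (≤-reflexive (sym (+-suc (size x) n))) b))
  ... | y′ , run′ , y∼y′ , sz = y′
      , S′.r-then (S′.weaken (≤-trans (*-monoʳ-≤ c (s≤s (m+n≤o⇒m≤o (size x) b))) (n≤1+n _)) run) run′ , y∼y′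
      , ≤-trans sz (≤-trans (+-monoˡ-≤ n (grows o x)) (≤-reflexive (sym (+-suc (size x) n))))
  simulate cap {x = x} (r-go {m = m} {n = n} r s) x∼x′ b with simulate cap r x∼x′ (first-fits {size x} m b)
  ... | z′ , run , z∼z′ , sz with simulate cap s z∼z′ (≤-trans (rest-fits m sz) b)
  ... | y′ , run′ , y∼y′ , sz′ = y′ , S′.weaken (loop-time m n (c * suc cap)) (S′.r-go run run′) , y∼y′ ,
    ≤-trans sz′ (rest-fits m sz)
  simulate cap {x = x} (r-stop {m = m} {n = n} r s) x∼x′ b with simulate cap r x∼x′ (first-fits {size x} m b)
  ... | z′ , run , z∼z′ , sz with simulate cap s z∼z′ (≤-trans (rest-fits m sz) b)
  ... | y′ , run′ , y∼y′ , sz′ = y′ , S′.weaken (loop-time m n (c * suc cap)) (S′.r-stop run run′) , y∼y′ ,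
    ≤-trans sz′ (rest-fits m sz)

-- Tape programs and their compilation into Turing machines

module TapeMachines where

  open Enum

  -- The cells left of the head, nearest first, the cell under the head, and the cells to the right.
  Tape : Set
  Tape = List Sym × Sym × List Sym

  top : List Sym → Sym
  top []      = blank
  top (s ∷ _) = s

  rest : List Sym → List Sym
  rest []       = []
  rest (_ ∷ ss) = ss

  shift : Sym × Move → Tape → Tape
  shift (s , mL) (l , _ , r) = rest l , top l , s ∷ r
  shift (s , mR) (l , _ , r) = s ∷ l , top r , rest r
  shift (s , mS) (l , _ , r) = l , s , r

  scanned : Tape → Sym
  scanned (_ , s , _) = s

  TapeOp : Set
  TapeOp = Sym → Sym × Move

  tapeSem : TapeOp → Tape → Sym × Tape
  tapeSem o t = scanned t , shift (o (scanned t)) t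

  TapeProg : Set → Set₁
  TapeProg = Prog TapeOp (λ _ → Sym)

  -- A loop has an idle state at the head of each iteration, so that a body without operations takes time as well.
  State : ∀ {E} → TapeProg E → Set
  State (ret e)                  = ⊥
  State (op o k)                 = Maybe (Σ Sym λ s → State (k s))
  State (loop {A} {B} α β f a c) = Σ A (λ a → Maybe (State (f a))) ⊎ Σ B (λ b → State (c b))

  enum-State : ∀ {E} (p : TapeProg E) → Enum (State p)
  enum-State (ret e)          = enum-⊥
  enum-State (op o k)         = enum-Maybe (enum-Σ enum-Sym (λ s → enum-State (k s)))
  enum-State (loop α β f a c) = enum-⊎ (enum-Σ α (λ a → enum-Maybe (enum-State (f a))))
    (enum-Σ β (λ b → enum-State (c b)))

  entry : ∀ {E} (p : TapeProg E) → State p ⊎ E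
  entry (ret e)          = inj₂ e
  entry (op o k)         = inj₁ nothing
  entry (loop α β f a c) = inj₁ (inj₁ (a , nothing))

  Step : Set → Set → Set
  Step Q E = Q → Sym → (Sym × Move) × (Q ⊎ E)

  module _ {Q Q′ E E′ : Set} (inQ : Q → Q′) (exit : E → Q′ ⊎ E′) where
    lift : Q ⊎ E → Q′ ⊎ E′
    lift (inj₁ q) = inj₁ (inQ q)
    lift (inj₂ e) = exit e

    liftStep : (Sym × Move) × (Q ⊎ E) → (Sym × Move) × (Q′ ⊎ E′)
    liftStep (a , x) = a , lift x

  module LoopStep {A B E : Set} {Q : A → Set} {Q′ : B → Set}
    (en : ∀ a → Q a ⊎ (A ⊎ B)) (body : ∀ a → Step (Q a) (A ⊎ B))
    (en′ : ∀ b → Q′ b ⊎ E) (cont : ∀ b → Step (Q′ b) E) where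
    S : Set
    S = Σ A (λ a → Maybe (Q a)) ⊎ Σ B Q′

    fromCont : ∀ b → Q′ b ⊎ E → S ⊎ E
    fromCont b = lift (λ q → inj₂ (b , q)) inj₂

    afterBody : A ⊎ B → S ⊎ E
    afterBody (inj₁ a) = inj₁ (inj₁ (a , nothing))
    afterBody (inj₂ b) = fromCont b (en′ b)

    fromBody : ∀ a → Q a ⊎ (A ⊎ B) → S ⊎ E
    fromBody a = lift (λ q → inj₁ (a , just q)) afterBody

    stepLoop : Step S E
    stepLoop (inj₁ (a , nothing)) s = (s , mS) , fromBody a (en a)
    stepLoop (inj₁ (a , just q))  s = liftStep (λ q → inj₁ (a , just q)) afterBody (body a q s)
    stepLoop (inj₂ (b , q))       s = liftStep (λ q → inj₂ (b , q)) inj₂ (cont b q s)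

  module OpStep {E : Set} {Q : Sym → Set} (o : TapeOp) (en : ∀ s → Q s ⊎ E) (cont : ∀ s → Step (Q s) E) where
    fromCont : ∀ s → Q s ⊎ E → Maybe (Σ Sym Q) ⊎ E
    fromCont s = lift (λ q → just (s , q)) inj₂

    stepOp : Step (Maybe (Σ Sym Q)) E
    stepOp nothing        s = o s , fromCont s (en s)
    stepOp (just (s₀ , q)) s = liftStep (λ q → just (s₀ , q)) inj₂ (cont s₀ q s)

  step : ∀ {E} (p : TapeProg E) → Step (State p) E
  step (ret e)          = λ ()
  step (op o k)         = OpStep.stepOp o (λ s → entry (k s)) (λ s → step (k s))
  step (loop α β f a c) = LoopStep.stepLoop (λ a → entry (f a)) (λ a → step (f a)) (λ b → entry (c b))
    (λ b → step (c b))

  -- The counterpart of `Run` once the structure of a program has been flattened into a transition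
  -- function.
  data Flat {Q E : Set} (δ : Step Q E) : Q ⊎ E → Tape → ℕ → E → Tape → Set where
    done : ∀ {e t n} → Flat δ (inj₂ e) t n e t
    more : ∀ {q t n e t′} → Flat δ (proj₂ (δ q (scanned t))) (shift (proj₁ (δ q (scanned t))) t) n e t′ →
           Flat δ (inj₁ q) t (suc n) e t′

  flat-weaken : ∀ {Q E} {δ : Step Q E} {x t n m e t′} → n ≤ m → Flat δ x t n e t′ → Flat δ x t m e t′
  flat-weaken _         done     = done
  flat-weaken (s≤s n≤m) (more r) = more (flat-weaken n≤m r)

  -- Sequential composition: a component behaves inside the larger system as it does alone until it
  -- exits, and `exit` says where control goes then. Loop bodies and continuations are both attached
  -- in this way.
  flat-embed : ∀ {Q Q′ E E′} {δ : Step Q E} {δ′ : Step Q′ E′} (inQ : Q → Q′) (exit : E → Q′ ⊎ E′) →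
    (∀ q s → δ′ (inQ q) s ≡ liftStep inQ exit (δ q s)) →
    ∀ {x t n e t′ m e′ t″} → Flat δ x t n e t′ → Flat δ′ (exit e) t′ m e′ t″ →
    Flat δ′ (lift inQ exit x) t (n + m) e′ t″
  flat-embed inQ exit eq {n = n} {m = m} done r = flat-weaken (m≤n+m m n) r
  flat-embed {δ′ = δ′} inQ exit eq {t = t} {m = m} {e′ = e′} {t″ = t″} (more {q} {n = n} s) r =
    more (subst (λ z → Flat δ′ (proj₂ z) (shift (proj₁ z) t) (n + m) e′ t″) (sym (eq q (scanned t)))
      (flat-embed inQ exit eq s r))

  open Semantics tapeSem

  flat-sound : ∀ {E} {p : TapeProg E} {t n e t′} → Run p t n e t′ → Flat (step p) (entry p) t n e t′
  flat-sound r-ret = done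
  flat-sound {p = op o k} {t = t} {suc n} {e} {t′} (r-op r) = more (subst (λ m → Flat _ _ _ m e t′) (+-identityʳ n)
    (flat-embed {δ′ = OpStep.stepOp o _ _} (λ q → just (scanned t , q)) inj₂ (λ q s → refl) (flat-sound r)
      (done {n = 0})))
  flat-sound (r-go r s) = more (flat-embed {δ′ = LoopStep.stepLoop _ _ _ _} (λ q → inj₁ (_ , just q)) _
    (λ q s → refl) (flat-sound r) (flat-sound s))
  flat-sound {p = loop α β f a c} (r-stop {m = m} {b = b} {n = n} r s) = more
    (flat-embed {δ′ = LoopStep.stepLoop _ _ _ _} (λ q → inj₁ (_ , just q)) _ (λ q s → refl) (flat-sound r)
      (subst (λ n → Flat _ _ _ n _ _) (+-identityʳ n)
        (flat-embed {δ′ = LoopStep.stepLoop _ _ _ _} (λ q → inj₂ (b , q)) inj₂ (λ q s → refl) (flat-sound s)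
          (done {n = 0}))))

  config : ∀ {n} → Fin n → Tape → Config n
  config q (l , s , r) = cfg q l s r

  module _ {n : ℕ} where
    applyAct-shift : ∀ (q q′ : Fin n) s m t → applyAct q s m (config q′ t) ≡ config q (shift (s , m) t)
    applyAct-shift q q′ s mL ([] , _ , r)    = refl
    applyAct-shift q q′ s mL (x ∷ l , _ , r) = refl
    applyAct-shift q q′ s mR (l , _ , [])    = refl
    applyAct-shift q q′ s mR (l , _ , x ∷ r) = refl
    applyAct-shift q q′ s mS t               = refl

  module Machine (p : TapeProg Bool) where
    private
      ε : Enum (State p ⊎ Bool)
      ε = enum-⊎ (enum-State p) enum-Bool

      act : Sym → Maybe (State p ⊎ Bool) → Act (size ε)
      act s nothing         = halt false
      act s (just (inj₂ b)) = halt b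
      act s (just (inj₁ q)) = let ((s′ , m) , x) = step p q s in go (enc ε x) s′ m

      machine′ : TM
      machine′ = record { nQ = size ε ; start = enc ε (entry p) ; δ = λ q s → act s (dec ε q) }

    result : Bool → Tape → Maybe Str
    result true  (_ , s , r) = just (readBits (s ∷ r))
    result false _           = nothing

    private
      open TM machine′ using (δ)

      drun-flat : ∀ {x t n b t′} → Flat (step p) x t n b t′ → drun δ (suc n) (config (enc ε x) t) ≡ just (result b t′)
      drun-flat (done {true}) rewrite dec-enc ε (inj₂ true) = refl
      drun-flat (done {false}) rewrite dec-enc ε (inj₂ false) = refl
      drun-flat {t = t} (more {q} {n = n} r) rewrite dec-enc ε (inj₁ q) =
        trans (cong (drun δ (suc n)) (applyAct-shift _ (enc ε (inj₁ q)) _ _ t)) (drun-flat r)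

      exec-machine′ : ∀ {x n b t} → Run p ([] , top (map toSym x) , rest (map toSym x)) n b t →
                      exec machine′ (suc n) x ≡ just (result b t)
      exec-machine′ {[]}    r = drun-flat (flat-sound r)
      exec-machine′ {_ ∷ _} r = drun-flat (flat-sound r)

    abstract
      machine : TM
      machine = machine′

      exec-machine : ∀ {x n b t} → Run p ([] , top (map toSym x) , rest (map toSym x)) n b t →
                     exec machine (suc n) x ≡ just (result b t)
      exec-machine = exec-machine′

open TapeMachines

-- Bit stacks side by side on the tape

module StackStorage where

  open Semantics tapeSem

  -- Both describe the boundary between `l` and `r`. The head is on its right in `before`, at the
  -- first cell of `r`, and on its left in `after`, at the nearest cell of `l`.
  before after : List Sym → List Sym → Tape
  before l r = l , top r , rest r
  after  l r = rest l , top l , r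

  isBlank : {A B : Set} → A → (Sym → B) → Sym → B ⊎ A
  isBlank a f s0    = inj₁ (f s0)
  isBlank a f s1    = inj₁ (f s1)
  isBlank a f blank = inj₂ a

  -- In the lemmas below the tape holds the stacks S₁ ␣ S₂ ␣ … ␣ Sₖ ␣, bottoms to the right.
  cells : Str → List Sym → List Sym
  cells []      r = r
  cells (b ∷ s) r = toSym b ∷ cells s r

  cellsˡ : List Sym → Str → List Sym
  cellsˡ l []      = l
  cellsˡ l (b ∷ s) = cellsˡ (toSym b ∷ l) s

  stacks : ∀ {k} → Vec Str k → List Sym → List Sym
  stacks []      r = r
  stacks (s ∷ S) r = cells s (blank ∷ stacks S r)

  stacksˡ : ∀ {k} → List Sym → Vec Str k → List Sym
  stacksˡ l []      = l
  stacksˡ l (s ∷ S) = stacksˡ (blank ∷ cellsˡ l s) S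

  extent : ∀ {k} → Vec Str k → ℕ
  extent []      = 0
  extent (s ∷ S) = suc (length s) + extent S

  skip : TapeProg ⊤
  skip = loop enum-⊤ enum-⊤ (λ _ → op (λ s → s , mR) (λ s → ret (isBlank tt (λ _ → tt) s))) tt ret

  -- The separator is required only in the form `top r ≡ blank`, which also covers the end of the
  -- written tape; setting up the empty stacks relies on that.
  run-skip : ∀ s {l r} → top r ≡ blank →
    Run skip (before l (cells s r)) (suc (length s) * 2) tt (before (blank ∷ cellsˡ l s) (rest r))
  run-skip [] eq rewrite eq  = r-stop {m = 1} (r-op r-ret) r-ret
  run-skip (false ∷ s) eq    = r-go {m = 1} (r-op r-ret) (run-skip s eq)
  run-skip (true ∷ s) eq     = r-go {m = 1} (r-op r-ret) (run-skip s eq)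

  skips : ℕ → TapeProg ⊤
  skips zero    = ret tt
  skips (suc k) = skip >> skips k

  run-skips : ∀ {k} (S : Vec Str k) {l r} →
    Run (skips k) (before l (stacks S r)) (extent S * 2) tt (before (stacksˡ l S) r)
  run-skips []      = r-ret
  run-skips (s ∷ S) = weaken (≤-reflexive (sym (*-distribʳ-+ 2 (suc (length s)) (extent S))))
    (r-then (run-skip s refl) (run-skips S))

  -- Carries the displaced symbol along: c is written in front of the stack, and its separator is dropped.
  insert : Sym → TapeProg ⊤
  insert c = loop enum-Sym enum-⊤ (λ c → op (λ s → c , mR) (λ s → ret (isBlank tt id s))) c ret

  run-insert : ∀ s {c l r} →
    Run (insert c) (before l (cells s (blank ∷ r))) (suc (length s) * 2) tt (before (cellsˡ (c ∷ l) s) r)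
  run-insert []          = r-stop {m = 1} (r-op r-ret) r-ret
  run-insert (false ∷ s) = r-go {m = 1} (r-op r-ret) (run-insert s)
  run-insert (true ∷ s)  = r-go {m = 1} (r-op r-ret) (run-insert s)

  -- The separator dropped by one insertion is the symbol carried into the next, so that all
  -- remaining stacks move right by one cell; the last separator is written at the end.
  inserts : ℕ → TapeProg ⊤
  inserts zero    = op (λ _ → blank , mR) (λ _ → ret tt)
  inserts (suc k) = insert blank >> inserts k

  run-inserts : ∀ {k} (S : Vec Str k) {l r} →
    Run (inserts k) (before l (stacks S r)) (suc (extent S * 2)) tt (before (stacksˡ (blank ∷ l) S) (rest r))
  run-inserts []      = r-op r-ret
  run-inserts (s ∷ S) = weaken
    (≤-reflexive (trans (+-suc (suc (length s) * 2) (extent S * 2))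
      (cong suc (sym (*-distribʳ-+ 2 (suc (length s)) (extent S))))))
    (r-then (run-insert s) (run-inserts S))

  leftwards : Sym → TapeOp
  leftwards c blank = blank , mS
  leftwards c s0    = c , mL
  leftwards c s1    = c , mL

  toBlank : TapeProg ⊤
  toBlank = loop enum-⊤ enum-⊤ (λ _ → op (λ s → leftwards s s) (λ s → ret (isBlank tt (λ _ → tt) s))) tt ret

  run-toBlank : ∀ s {l r} → top l ≡ blank → Run toBlank (after (cellsˡ l s) r) (suc (length s) * 2) tt
    (after l (cells s r))
  run-toBlank s {l} eq = weaken (≤-reflexive (+-comm (length s * 2) 2)) (walk s (stop {l} eq))
    where
    stop : ∀ {l r} → top l ≡ blank → Run toBlank (after l r) 2 tt (after l r)
    stop {l = l} eq rewrite eq = r-stop {m = 1} (r-op r-ret) r-ret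
    walk : ∀ s {l r n e z} → Run toBlank (after l (cells s r)) n e z →
      Run toBlank (after (cellsˡ l s) r) (length s * 2 + n) e z
    walk [] run = run
    walk (b ∷ s) {n = n} run =
      weaken (≤-reflexive (trans (+-suc (length s * 2) (suc n)) (cong suc (+-suc (length s * 2) n))))
        (walk s (cell b run))
      where
      cell : ∀ b {l r n e z} → Run toBlank (after l (toSym b ∷ r)) n e z →
        Run toBlank (after (toSym b ∷ l) r) (2 + n) e z
      cell false run = r-go {m = 1} (r-op r-ret) run
      cell true  run = r-go {m = 1} (r-op r-ret) run

  back : TapeProg ⊤
  back = op (λ s → s , mL) (λ _ → toBlank)

  run-back : ∀ s {l r} → top l ≡ blank →
    Run back (after (blank ∷ cellsˡ l s) r) (suc (length s) * 3) tt (after l (cells s (blank ∷ r)))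
  run-back s eq = weaken (s≤s (s≤s (s≤s (*-monoʳ-≤ (length s) (s≤s (s≤s z≤n)))))) (r-op (run-toBlank s eq))

  backs : ℕ → TapeProg ⊤
  backs zero    = ret tt
  backs (suc k) = backs k >> back

  run-backs : ∀ {k} (S : Vec Str k) {l r} → top l ≡ blank →
    Run (backs k) (after (stacksˡ l S) r) (extent S * 3) tt (after l (stacks S r))
  run-backs []      eq = r-ret
  run-backs (s ∷ S) eq = weaken
    (≤-reflexive (trans (+-comm (extent S * 3) _) (sym (*-distribʳ-+ 3 (suc (length s)) (extent S)))))
    (r-then (run-backs S refl) (run-back s eq))

  -- Deletion shifts cells to the left, from the right end on; the carried symbol is the one to be written next.
  remove : Sym → TapeProg Sym
  remove c = loop enum-Sym enum-Sym (λ c → op (leftwards c) (λ s → ret (isBlank c id s))) c ret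

  cells-∷ : ∀ s c r → Σ Sym λ c′ → Σ (List Sym) λ r′ → c′ ∷ r′ ≡ cells s (c ∷ r)
  cells-∷ []      c r = c , r , refl
  cells-∷ (b ∷ s) c r = toSym b , cells s (c ∷ r) , refl

  -- The carried symbol followed by the cells to the right reads the same as the old stack with `c`
  -- behind it. Nothing is lost, but the stack occupies one cell less, with its first symbol in the
  -- control state.
  run-remove : ∀ s {c c′ l r r′} → top l ≡ blank → c′ ∷ r′ ≡ cells s (c ∷ r) →
    Run (remove c) (after (cellsˡ l s) r) (suc (length s) * 2) c′ (after l r′)
  run-remove s {l = l} eq eq′ = weaken (≤-reflexive (+-comm (length s * 2) 2)) (walk s eq′ (stop {l = l} eq))
    where
    stop : ∀ {c l r} → top l ≡ blank → Run (remove c) (after l r) 2 c (after l r)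
    stop {l = l} eq rewrite eq = r-stop {m = 1} (r-op r-ret) r-ret
    cell : ∀ b {c l r n e z} → Run (remove (toSym b)) (after l (c ∷ r)) n e z →
      Run (remove c) (after (toSym b ∷ l) r) (2 + n) e z
    cell false run = r-go {m = 1} (r-op r-ret) run
    cell true  run = r-go {m = 1} (r-op r-ret) run
    walk : ∀ s {c c′ l r r′ n e z} → c′ ∷ r′ ≡ cells s (c ∷ r) → Run (remove c′) (after l r′) n e z →
      Run (remove c) (after (cellsˡ l s) r) (length s * 2 + n) e z
    walk [] refl run = run
    walk (b ∷ s) {c} {l = l} {r = r} {n = n} refl run with cells-∷ s c r
    ... | c₁ , r₁ , eq = weaken (≤-reflexive (trans (+-suc (length s * 2) (suc n)) (cong suc (+-suc (length s * 2) n))))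
      (walk s eq (cell b (subst (λ r → Run (remove (toSym b)) (after l r) n _ _) (sym eq) run)))

  removeStack : Sym → TapeProg Sym
  removeStack c = op (λ _ → c , mL) remove

  run-removeStack : ∀ s {c c′ l r r′} → top l ≡ blank → c′ ∷ r′ ≡ cells s (blank ∷ c ∷ r) →
    Run (removeStack c) (after (blank ∷ cellsˡ l s) r) (suc (length s) * 3) c′ (after l r′)
  run-removeStack s eq eq′ =
    weaken (s≤s (s≤s (s≤s (*-monoʳ-≤ (length s) (s≤s (s≤s z≤n)))))) (r-op (run-remove s eq eq′))

  removeStacks : ℕ → Sym → TapeProg Sym
  removeStacks zero    c = ret c
  removeStacks (suc k) c = removeStacks k c then removeStack

  run-removeStacks : ∀ {k} (S : Vec Str k) {c l r} → top l ≡ blank →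
    Σ Sym λ c′ → Σ (List Sym) λ r′ → (c′ ∷ r′ ≡ stacks S (c ∷ r)) ×
    Run (removeStacks k c) (after (stacksˡ l S) r) (extent S * 3) c′ (after l r′)
  run-removeStacks []      eq = _ , _ , refl , r-ret
  run-removeStacks (s ∷ S) {c} {l} {r} eq with run-removeStacks S {c} {blank ∷ cellsˡ l s} {r} refl
  ... | c₁ , r₁ , eq₁ , run₁ with cells-∷ s blank (c₁ ∷ r₁)
  ... | c₂ , r₂ , eq₂ = c₂ , r₂ , trans eq₂ (cong (λ x → cells s (blank ∷ x)) eq₁) , weaken
    (≤-reflexive (trans (+-comm (extent S * 3) _) (sym (*-distribʳ-+ 3 (suc (length s)) (extent S)))))
    (r-then run₁ (run-removeStack s eq eq₂))

  data StackOp (k : ℕ) : Set where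
    push : Fin k → Bool → StackOp k
    pop  : Fin k → StackOp k

  Reply : ∀ {k} → StackOp k → Set
  Reply (push _ _) = ⊤
  Reply (pop _)    = Maybe Bool

  pushOn : ∀ {k} → Fin k → Bool → Vec Str k → Vec Str k
  pushOn zero    b (s ∷ S) = (b ∷ s) ∷ S
  pushOn (suc i) b (s ∷ S) = s ∷ pushOn i b S

  popFrom : ∀ {k} → Fin k → Vec Str k → Maybe Bool × Vec Str k
  popFrom zero    ([] ∷ S)      = nothing , [] ∷ S
  popFrom zero    ((b ∷ s) ∷ S) = just b , s ∷ S
  popFrom (suc i) (s ∷ S)       = let (r , S′) = popFrom i S in r , s ∷ S′

  stackSem : ∀ {k} (o : StackOp k) → Vec Str k → Reply o × Vec Str k
  stackSem (push i b) S = tt , pushOn i b S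
  stackSem (pop i)    S = popFrom i S

  pushWalk : ∀ {k} → Fin k → Bool → TapeProg ⊤
  pushWalk {suc k} zero    b = insert (toSym b) >> (inserts k >> op (λ s → s , mL) (λ _ → backs (suc k)))
  pushWalk {suc k} (suc i) b = skip >> (pushWalk i b >> back)

  fromSym : Sym → Maybe Bool
  fromSym s0    = just false
  fromSym s1    = just true
  fromSym blank = nothing

  toEnd : ℕ → TapeProg ⊤
  toEnd k = skips k >> op (λ s → s , mL) (λ _ → ret tt)

  run-toEnd : ∀ {k} (S : Vec Str k) {l r} →
    Run (toEnd k) (before l (stacks S r)) (extent S * 2 + 1) tt (after (stacksˡ l S) (top r ∷ rest r))
  run-toEnd S = r-then (run-skips S) (r-op r-ret)

  -- Deletion starts at the right end, so a pop has to walk there first. The symbol carried out at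
  -- the left of the addressed stack is the bit popped.
  popOrBack : ℕ → Sym → TapeProg (Maybe Bool)
  popOrBack k blank = toEnd k >> (backs k >> ret nothing)
  popOrBack k _     = toEnd k >> (removeStacks k blank then λ s → ret (fromSym s))

  popWalk : ∀ {k} → Fin k → TapeProg (Maybe Bool)
  popWalk {suc k} zero = op (λ s → s , mS) (popOrBack (suc k))
  popWalk {suc k} (suc i) = skip >> (popWalk i then λ r → back >> ret r)

  stackOp : ∀ {k} (o : StackOp k) → TapeProg (Reply o)
  stackOp (push i b) = pushWalk i b >> op (λ s → s , mR) (λ _ → ret tt)
  stackOp (pop i)    = popWalk i then λ r → op (λ s → s , mR) (λ _ → ret r)

  private
    time₁ : ∀ a b → suc a * 2 + (suc (b * 2) + suc (suc (suc (a + b)) * 3)) ≡ (suc a + b) * 5 + 5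
    time₁ = solve-∀
    time₂ : ∀ a b → suc a * 2 + (b * 5 + 5 + suc a * 3) ≡ (suc a + b) * 5 + 5
    time₂ = solve-∀
    time₃ : ∀ e → suc (e * 2 + 1 + e * 3) + 3 ≡ e * 5 + 5
    time₃ = solve-∀

  run-pushWalk : ∀ {k} i b (S : Vec Str k) {l r} → top l ≡ blank → Σ (List Sym) λ r′ →
    Run (pushWalk i b) (before l (stacks S r)) (extent S * 5 + 5) tt (after l (stacks (pushOn i b S) r′))
  run-pushWalk zero b (s ∷ S) {l} {r} eq = top (rest r) ∷ rest (rest r) ,
    weaken (≤-reflexive (time₁ (length s) (extent S)))
    (r-then (run-insert s) (r-then (run-inserts S) (r-op (run-backs ((b ∷ s) ∷ S) eq))))
  run-pushWalk (suc i) b (s ∷ S) {l} {r} eq with run-pushWalk i b S {blank ∷ cellsˡ l s} {r} refl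
  ... | r′ , run = r′ , weaken (≤-reflexive (time₂ (length s) (extent S)))
    (r-then (run-skip s refl) (r-then run (run-back s eq)))

  run-popWalk : ∀ {k} i (S : Vec Str k) {l r} → top l ≡ blank → Σ (List Sym) λ r′ →
    Run (popWalk i) (before l (stacks S r)) (extent S * 5 + 5) (proj₁ (popFrom i S))
      (after l (stacks (proj₂ (popFrom i S)) r′))
  run-popWalk {suc k} zero ([] ∷ S) {l} {r} eq = top r ∷ rest r ,
    weaken (≤-trans (m≤m+n _ 3) (≤-reflexive (time₃ (extent ([] ∷ S)))))
      (r-op (r-then {p = toEnd (suc k)} (run-toEnd ([] ∷ S))
        (weaken (≤-reflexive (+-identityʳ _)) (r-then {p = backs (suc k)} (run-backs ([] ∷ S) eq) r-ret))))
  run-popWalk {suc k} zero ((b ∷ s) ∷ S) {l} {r} eq with run-removeStacks ((b ∷ s) ∷ S) {blank} {l} {top r ∷ rest r} eq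
  ... | c , _ , eq′ , run = blank ∷ top r ∷ rest r ,
    weaken (≤-trans (m≤m+n _ 3) (≤-reflexive (time₃ (extent ((b ∷ s) ∷ S))))) (found b eq′ run)
    where
    found : ∀ b {c r′} → c ∷ r′ ≡ stacks ((b ∷ s) ∷ S) (blank ∷ top r ∷ rest r) →
      Run (removeStacks (suc k) blank) (after (stacksˡ l ((b ∷ s) ∷ S)) (top r ∷ rest r))
        (extent ((b ∷ s) ∷ S) * 3) c (after l r′) →
      Run (popWalk {suc k} zero) (before l (stacks ((b ∷ s) ∷ S) r))
        (suc (extent ((b ∷ s) ∷ S) * 2 + 1 + extent ((b ∷ s) ∷ S) * 3))
        (just b) (after l (stacks (s ∷ S) (blank ∷ top r ∷ rest r)))
    found false refl run = r-op (r-then {p = toEnd (suc k)} (run-toEnd ((false ∷ s) ∷ S))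
      (weaken (≤-reflexive (+-identityʳ _)) (r-then {p = removeStacks (suc k) blank} run r-ret)))
    found true refl run = r-op (r-then {p = toEnd (suc k)} (run-toEnd ((true ∷ s) ∷ S))
      (weaken (≤-reflexive (+-identityʳ _)) (r-then {p = removeStacks (suc k) blank} run r-ret)))
  run-popWalk (suc i) (s ∷ S) {l} {r} eq with run-popWalk i S {blank ∷ cellsˡ l s} {r} refl
  ... | r′ , run = r′ , weaken (≤-reflexive (time₂ (length s) (extent S)))
    (r-then (run-skip s refl) (r-then run (weaken (≤-reflexive (+-identityʳ _)) (r-then (run-back s eq) r-ret))))

  -- The blank on the left stops the walks back. The cells beyond the last separator are left
  -- arbitrary, because shifting the stacks alters them.
  data Stored {k} (S : Vec Str k) : Tape → Set where
    stored : ∀ {l r} → top l ≡ blank → Stored S (before l (stacks S r))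

  private
    time₅ : ∀ e → e * 5 + 5 + 1 + e ≡ 6 * suc e
    time₅ = solve-∀
    time₆ : ∀ e → e * 2 + suc (e * 3 + 1) + (e + 4) ≡ 6 * suc e
    time₆ = solve-∀

  stackOp-sound : ∀ {k} (o : StackOp k) {S t} → Stored S t → Σ Tape λ t′ →
    Run (stackOp o) t (6 * suc (extent S)) (proj₁ (stackSem o S)) t′ × Stored (proj₂ (stackSem o S)) t′
  stackOp-sound (push i b) {S} (stored {l} {r} eq) with run-pushWalk i b S {l} {r} eq
  ... | r′ , run = _ , weaken (≤-trans (m≤m+n _ (extent S)) (≤-reflexive (time₅ (extent S))))
    (r-then run (r-op r-ret)) , stored {l = top l ∷ rest l} {r′} eq
  stackOp-sound (pop i) {S} (stored {l} {r} eq) with run-popWalk i S {l} {r} eq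
  ... | r′ , run = _ , weaken (≤-trans (m≤m+n _ (extent S)) (≤-reflexive (time₅ (extent S))))
    (r-then run (r-op r-ret)) , stored {l = top l ∷ rest l} {r′} eq

  extent-grows : ∀ {k} (o : StackOp k) S → extent (proj₂ (stackSem o S)) ≤ suc (extent S)
  extent-grows (push zero b)    (s ∷ S) = ≤-refl
  extent-grows (push (suc i) b) (s ∷ S) = ≤-trans (+-monoʳ-≤ (suc (length s)) (extent-grows (push i b) S))
    (≤-reflexive (+-suc (suc (length s)) (extent S)))
  extent-grows (pop zero)    ([] ∷ S)      = n≤1+n _
  extent-grows (pop zero)    ((b ∷ s) ∷ S) = m≤n+m _ 2
  extent-grows (pop (suc i)) (s ∷ S) = ≤-trans (+-monoʳ-≤ (suc (length s)) (extent-grows (pop i) S))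
    (≤-reflexive (+-suc (suc (length s)) (extent S)))

  -- The initial blank cells become separators.
  setUp : ℕ → TapeProg ⊤
  setUp k = skips k >> op (λ s → s , mL) (λ _ → backs k >> op (λ s → s , mR) (λ _ → ret tt))

  run-setUp : ∀ k x → Σ Tape λ t → Run (setUp (suc k)) (before [] (map toSym x))
    (6 * suc (extent {suc k} (x ∷ Vec.replicate k []))) tt t
    × Stored {suc k} (x ∷ Vec.replicate k []) t
  run-setUp k x = _ , weaken (≤-trans (m≤m+n _ (e + 4)) (≤-reflexive (time₆ e)))
    (r-then {p = skips (suc k)} (weaken (≤-reflexive (sym (*-distribʳ-+ 2 (suc (length x)) (extent E))))
      (r-then {p = skip} first (blanks k)))
      (r-op (r-then {p = backs (suc k)} (run-backs (x ∷ E) refl) (r-op r-ret)))) , stored refl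
    where
    E : Vec Str k
    E = Vec.replicate k []
    e = extent (x ∷ E)
    cells-map : ∀ x → map toSym x ≡ cells x []
    cells-map []      = refl
    cells-map (b ∷ x) = cong (toSym b ∷_) (cells-map x)
    first : Run skip (before [] (map toSym x)) (suc (length x) * 2) tt (before (blank ∷ cellsˡ [] x) [])
    first = subst (λ r → Run skip (before [] r) (suc (length x) * 2) tt (before (blank ∷ cellsˡ [] x) []))
      (sym (cells-map x)) (run-skip x refl)
    blanks : ∀ k {l} → Run (skips k) (before l []) (extent (Vec.replicate k []) * 2) tt
      (before (stacksˡ l (Vec.replicate k [])) [])
    blanks zero    = r-ret
    blanks (suc k) = r-then {p = skip} (run-skip [] {r = []} refl) (blanks k)

open StackStorage

-- Stack programs

StackProg : ℕ → Set → Set₁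
StackProg k = Prog (StackOp k) Reply

module _ {k : ℕ} where
  open Semantics (stackSem {k}) public

-- The output lies on the first stack: the head finally stands there, and the separator ends the
-- reading.
data Answer {k} : Maybe Str → Bool → Vec Str (suc k) → Set where
  accepted : ∀ {o ρ} → Answer (just o) true (o ∷ ρ)
  rejected : ∀ {S} → Answer nothing false S

-- Only inputs of the form `ι i` are constrained, so an algorithm may rely on a well-formed
-- encoding. For `ι = id` this is `FP`.
Computes : {I : Set} → (I → Str) → (I → Maybe Str) → Set
Computes ι f = Σ TM λ M → Σ ℕ λ k → ∀ i → exec M (poly k (length (ι i))) (ι i) ≡ just (f i)

Behaves : ∀ {d} → StackProg (suc d) Bool → Str → ℕ → Maybe Str → Set₁
Behaves {d} p x n r = Σ Bool λ b → Σ (Vec Str (suc d)) λ S → Run p (x ∷ Vec.replicate d []) n b S × Answer r b S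

record Program {I : Set} (ι : I → Str) (f : I → Maybe Str) : Set₁ where
  field
    depth   : ℕ
    code    : StackProg (suc depth) Bool
    bound   : ℕ → ℕ
    bounded : PolyBounded bound
    correct : ∀ i → Behaves code (ι i) (bound (length (ι i))) (f i)

readBits-top : ∀ s → readBits (top s ∷ rest s) ≡ readBits s
readBits-top []      = refl
readBits-top (_ ∷ _) = refl

readBits-cells : ∀ s r → readBits (cells s (blank ∷ r)) ≡ s
readBits-cells []          r = refl
readBits-cells (false ∷ s) r = cong (false ∷_) (readBits-cells s r)
readBits-cells (true ∷ s)  r = cong (true ∷_) (readBits-cells s r)

extent-blanks : ∀ k → extent (Vec.replicate k []) ≡ k
extent-blanks zero    = refl
extent-blanks (suc k) = cong suc (extent-blanks k)

drun-mono : ∀ {n} {δ : Fin n → Sym → Act n} {t u c r} → t ≤ u → drun δ t c ≡ just r → drun δ u c ≡ just r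
drun-mono {δ = δ} {suc t} {suc u} {c} (s≤s t≤u) eq with δ (st c) (hd c)
... | halt true  = eq
... | halt false = eq
... | go q s m   = drun-mono t≤u eq

exec-mono : ∀ M {t u x r} → t ≤ u → exec M t x ≡ just r → exec M u x ≡ just r
exec-mono M = drun-mono

program⇒TM : ∀ {I} {ι : I → Str} {f} → Program ι f → Computes ι f
program⇒TM {ι = ι} {f} P = Machine.machine prog , proj₁ dominated , λ i →
  exec-mono (Machine.machine prog) {x = ι i} (proj₂ dominated (length (ι i))) (computes i)
  where
  open Program P
  prog : TapeProg Bool
  prog = setUp (suc depth) >> handle stackOp code
  -- The extent of the initial store: the input, its separator and one separator for each empty
  -- stack.
  e : ℕ → ℕ
  e n = suc n + depth
  time : ℕ → ℕ
  time n = suc (6 * suc (e n) + bound n * suc (6 * suc (e n + bound n)))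
  pb-e : PolyBounded e
  pb-e = pb-+ (pb-+ (pb-const 1) pb-id) (pb-const depth)
  pb-time : PolyBounded time
  pb-time = pb-+ (pb-const 1) (pb-+ (pb-* (pb-const 6) (pb-+ (pb-const 1) pb-e))
    (pb-* bounded (pb-+ (pb-const 1) (pb-* (pb-const 6) (pb-+ (pb-const 1) (pb-+ pb-e bounded))))))
  dominated = poly-dominates pb-time
  matches : ∀ {r b S t} → Answer r b S → Stored S t → Machine.result prog b t ≡ r
  matches (accepted {o}) (stored _) = cong just (trans (readBits-top (cells o _)) (readBits-cells o _))
  matches rejected _          = refl
  computes : ∀ i → exec (Machine.machine prog) (time (length (ι i))) (ι i) ≡ just (f i)
  computes i with correct i | run-setUp depth (ι i)
  ... | b , S , run , ans | t , init , st
    with Simulation.simulate stackSem tapeSem stackOp Stored extent 6 extent-grows stackOp-sound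
           (extent (ι i ∷ Vec.replicate depth []) + bound (length (ι i))) run st ≤-refl
  ... | t′ , run′ , st′ , _ =
    trans (Machine.exec-machine prog {ι i} {n = t₁} (Semantics.weaken tapeSem (≤-reflexive time-eq)
      (Semantics.r-then tapeSem {p = setUp (suc depth)} init run′)))
      (cong just (matches ans st′))
    where
    x = ι i
    t₁ = 6 * suc (e (length x)) + bound (length x) * suc (6 * suc (e (length x) + bound (length x)))
    time-eq : 6 * suc (suc (length x) + extent (Vec.replicate depth []))
            + bound (length x) * suc (6 * suc (suc (length x) + extent (Vec.replicate depth []) + bound (length x)))
              ≡ t₁
    time-eq = cong (λ k → 6 * suc (suc (length x) + k) + bound (length x) * suc
      (6 * suc (suc (length x) + k + bound (length x)))) (extent-blanks depth)

step-by : ∀ {k} {E : Set} {o : StackOp k} {q : Reply o → StackProg k E} {S r S′ n e z} → stackSem o S ≡ (r , S′) →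
  Run (q r) S′ n e z →
          Run (op o q) S (suc n) e z
step-by {q = q} {n = n} {e} {z} eq run = r-op (subst (λ y → Run (q (proj₁ y)) (proj₂ y) n e z) (sym eq) run)

pushAll : ∀ {k} → Fin k → List Bool → StackProg k ⊤
pushAll i []       = ret tt
pushAll i (b ∷ bs) = op (push i b) (λ _ → pushAll i bs)

transfer : ∀ {k} → Fin k → Fin k → (Bool → List Bool) → StackProg k ⊤
transfer i j φ = loop enum-⊤ enum-⊤ (λ _ → op (pop i) next) tt ret
  where
  next : Maybe Bool → StackProg _ (⊤ ⊎ ⊤)
  next nothing  = ret (inj₂ tt)
  next (just b) = pushAll j (φ b) then λ _ → ret (inj₁ tt)

revMap : (Bool → List Bool) → Str → Str → Str
revMap φ []      d = d
revMap φ (b ∷ s) d = revMap φ s (φ b ʳ++ d)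

-- A store in which the contents of stacks i and j vary.
record Slots {k} (i j : Fin k) (S : Str → Str → Vec Str k) : Set where
  constructor slots
  field
    pop-[]  : ∀ d → popFrom i (S [] d) ≡ (nothing , S [] d)
    pop-∷   : ∀ b s d → popFrom i (S (b ∷ s) d) ≡ (just b , S s d)
    push-on : ∀ b s d → pushOn j b (S s d) ≡ S s (b ∷ d)

module _ {k} {i j : Fin k} {S : Str → Str → Vec Str k} (sl : Slots i j S) where
  open Slots sl

  run-pushAll : ∀ bs {s d} → Run (pushAll j bs) (S s d) (length bs) tt (S s (bs ʳ++ d))
  run-pushAll []       = r-ret
  run-pushAll (b ∷ bs) = step-by (cong (tt ,_) (push-on b _ _)) (run-pushAll bs)

  run-transfer : ∀ φ {w} → (∀ b → length (φ b) ≤ w) → ∀ s {d} →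
    Run (transfer i j φ) (S s d) (suc (length s) * (2 + w)) tt (S [] (revMap φ s d))
  run-transfer φ {w} short [] = weaken (s≤s (s≤s z≤n)) (r-stop {m = 1} (step-by (pop-[] _) r-ret) r-ret)
  run-transfer φ {w} short (b ∷ s) {d} = weaken (s≤s (s≤s
    (≤-reflexive (cong (_+ suc (length s) * (2 + w)) (+-identityʳ w)))))
    (r-go {m = suc (w + 0)} (step-by (pop-∷ b s d) (r-then (weaken (short b) (run-pushAll (φ b))) r-ret))
      (run-transfer φ short s))

pour : ∀ {k} → Fin k → Fin k → StackProg k ⊤
pour i j = transfer i j (λ b → b ∷ [])

clear : ∀ {k} → Fin k → StackProg k ⊤
clear i = transfer i i (λ _ → [])

revMap-pour : ∀ s d → revMap (λ b → b ∷ []) s d ≡ s ʳ++ d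
revMap-pour []      d = refl
revMap-pour (b ∷ s) d = revMap-pour s (b ∷ d)

length-rev : ∀ (s : Str) → length (s ʳ++ []) ≡ length s
length-rev s = trans (List.length-ʳ++ s) (+-identityʳ _)

rev-rev : ∀ (s : Str) {t} → (s ʳ++ []) ʳ++ t ≡ s ++ t
rev-rev s {t} = List.ʳ++-ʳ++ s {[]} {t}

unrev : ∀ (s : Str) → (s ʳ++ []) ʳ++ [] ≡ s
unrev s = trans (rev-rev s) (List.++-identityʳ s)

module _ {k} {i j : Fin k} {S} (sl : Slots i j S) where

  run-pour : ∀ s {d n} → length s ≤ n → Run (pour i j) (S s d) (suc n * 3) tt (S [] (s ʳ++ d))
  run-pour s {d} s≤n = weaken (*-monoˡ-≤ 3 (s≤s s≤n))
    (subst (λ x → Run (pour i j) (S s d) (suc (length s) * 3) tt (S [] x)) (revMap-pour s d)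
      (run-transfer sl (λ b → b ∷ []) (λ _ → s≤s z≤n) s))

  run-unpour : ∀ s {n} → length s ≤ n → Run (pour i j) (S (s ʳ++ []) []) (suc n * 3) tt (S [] s)
  run-unpour s {n} s≤n = subst (λ x → Run (pour i j) (S (s ʳ++ []) []) (suc n * 3) tt (S [] x)) (unrev s)
    (run-pour (s ʳ++ []) (≤-trans (≤-reflexive (length-rev s)) s≤n))

record Slot {k} (i : Fin k) (S : Str → Vec Str k) : Set where
  constructor slot
  field
    pop-nil  : popFrom i (S []) ≡ (nothing , S [])
    pop-cons : ∀ b s → popFrom i (S (b ∷ s)) ≡ (just b , S s)

module _ {k} {i : Fin k} {S : Str → Vec Str k} (sl : Slot i S) where
  open Slot sl

  run-clear : ∀ s {n} → length s ≤ n → Run (clear i) (S s) (suc n * 2) tt (S [])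
  run-clear []      _         = weaken (s≤s (s≤s z≤n)) (r-stop {m = 1} (step-by pop-nil r-ret) r-ret)
  run-clear (b ∷ s) (s≤s s≤n) = r-go {m = 1} (step-by (pop-cons b s) r-ret) (run-clear s s≤n)

pattern #0 = zero
pattern #1 = suc zero
pattern #2 = suc (suc zero)
pattern #3 = suc (suc (suc zero))
pattern #4 = suc (suc (suc (suc zero)))
pattern #5 = suc (suc (suc (suc (suc zero))))
pattern #6 = suc (suc (suc (suc (suc (suc zero)))))

module _ {k : ℕ} {ρ : Vec Str k} where
  slots₀₁ : Slots #0 #1 (λ s d → s ∷ d ∷ ρ)
  slots₀₁ = slots (λ _ → refl) (λ _ _ _ → refl) (λ _ _ _ → refl)

  slots₀₄ : ∀ {a b c} → Slots #0 #4 (λ s d → s ∷ a ∷ b ∷ c ∷ d ∷ ρ)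
  slots₀₄ = slots (λ _ → refl) (λ _ _ _ → refl) (λ _ _ _ → refl)

  slots₁₀ : Slots #1 #0 (λ s d → d ∷ s ∷ ρ)
  slots₁₀ = slots (λ _ → refl) (λ _ _ _ → refl) (λ _ _ _ → refl)

  slots₁₂ : ∀ {a} → Slots #1 #2 (λ s d → a ∷ s ∷ d ∷ ρ)
  slots₁₂ = slots (λ _ → refl) (λ _ _ _ → refl) (λ _ _ _ → refl)

  slots₁₄ : ∀ {a b c} → Slots #1 #4 (λ s d → a ∷ s ∷ b ∷ c ∷ d ∷ ρ)
  slots₁₄ = slots (λ _ → refl) (λ _ _ _ → refl) (λ _ _ _ → refl)

  slots₁₅ : ∀ {a b c e} → Slots #1 #5 (λ s d → a ∷ s ∷ b ∷ c ∷ e ∷ d ∷ ρ)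
  slots₁₅ = slots (λ _ → refl) (λ _ _ _ → refl) (λ _ _ _ → refl)

  slots₂₀ : ∀ {a} → Slots #2 #0 (λ s d → d ∷ a ∷ s ∷ ρ)
  slots₂₀ = slots (λ _ → refl) (λ _ _ _ → refl) (λ _ _ _ → refl)

  slots₃₀ : ∀ {a b} → Slots #3 #0 (λ s d → d ∷ a ∷ b ∷ s ∷ ρ)
  slots₃₀ = slots (λ _ → refl) (λ _ _ _ → refl) (λ _ _ _ → refl)

  slots₃₁ : ∀ {a b} → Slots #3 #1 (λ s d → a ∷ d ∷ b ∷ s ∷ ρ)
  slots₃₁ = slots (λ _ → refl) (λ _ _ _ → refl) (λ _ _ _ → refl)

  slots₄₀ : ∀ {a b c} → Slots #4 #0 (λ s d → d ∷ a ∷ b ∷ c ∷ s ∷ ρ)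
  slots₄₀ = slots (λ _ → refl) (λ _ _ _ → refl) (λ _ _ _ → refl)

  slots₄₂ : ∀ {a b c} → Slots #4 #2 (λ s d → a ∷ b ∷ d ∷ c ∷ s ∷ ρ)
  slots₄₂ = slots (λ _ → refl) (λ _ _ _ → refl) (λ _ _ _ → refl)

  slot₀ : Slot #0 (λ s → s ∷ ρ)
  slot₀ = slot refl (λ _ _ → refl)

  slot₁ : ∀ {a} → Slot #1 (λ s → a ∷ s ∷ ρ)
  slot₁ = slot refl (λ _ _ → refl)

  slot₂ : ∀ {a b} → Slot #2 (λ s → a ∷ b ∷ s ∷ ρ)
  slot₂ = slot refl (λ _ _ → refl)

  slot₄ : ∀ {a b c d} → Slot #4 (λ s → a ∷ b ∷ c ∷ d ∷ s ∷ ρ)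
  slot₄ = slot refl (λ _ _ → refl)

  slot₅ : ∀ {a b c d e} → Slot #5 (λ s → a ∷ b ∷ c ∷ d ∷ e ∷ s ∷ ρ)
  slot₅ = slot refl (λ _ _ → refl)

  slot₆ : ∀ {a b c d e f} → Slot #6 (λ s → a ∷ b ∷ c ∷ d ∷ e ∷ f ∷ s ∷ ρ)
  slot₆ = slot refl (λ _ _ → refl)

-- Calling a Turing machine from a stack program

-- The effect of a transfer on a reversed string: the order of the blocks is restored, while each
-- block is itself reversed by the pushes.
expand : (Bool → List Bool) → Str → Str → Str
expand φ []      d = d
expand φ (b ∷ s) d = φ b ʳ++ expand φ s d

revMap-ʳ++ : ∀ φ s t d → revMap φ (s ʳ++ t) d ≡ revMap φ t (expand φ s d)
revMap-ʳ++ φ []      t d = refl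
revMap-ʳ++ φ (b ∷ s) t d = revMap-ʳ++ φ s (b ∷ t) d

-- Symbols are stored as two bits, a flag for nonblank symbols on top, so that an exhausted
-- stack reads as blanks.
flag payload : Sym → Bool
flag blank = false
flag _     = true
payload s1 = true
payload _  = false

symbol : Bool → Maybe Bool → Sym
symbol true (just b) = toSym b
symbol _    _        = blank

coded : List Sym → Str
coded []       = []
coded (s ∷ ss) = flag s ∷ payload s ∷ coded ss

-- Pushed in this order, so that the flag comes to lie on top of the bit.
coding : Bool → List Bool
coding b = b ∷ true ∷ []

expand-coding : ∀ x → expand coding x [] ≡ coded (map toSym x)
expand-coding []          = refl
expand-coding (false ∷ x) = cong (λ y → true ∷ false ∷ y) (expand-coding x)
expand-coding (true ∷ x)  = cong (λ y → true ∷ true ∷ y) (expand-coding x)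

module _ {k : ℕ} {E : Set} where
  pushSym : Fin k → Sym → StackProg k E → StackProg k E
  pushSym i s p = op (push i (payload s)) λ _ → op (push i (flag s)) λ _ → p

  popSym : Fin k → (Sym → StackProg k E) → StackProg k E
  popSym i p = op (pop i) λ { nothing → p blank ; (just f) → op (pop i) λ b → p (symbol f b) }

  run-popSym : ∀ {i : Fin k} {S} → Slot i S → ∀ ss {p n e z} → Run (p (top ss)) (S (coded (rest ss))) n e z →
    Run (popSym i p) (S (coded ss)) (2 + n) e z
  run-popSym (slot nil cons) []           run = weaken (n≤1+n _) (step-by nil run)
  run-popSym (slot nil cons) (s0 ∷ ss)    run = step-by (cons _ _) (step-by (cons _ _) run)
  run-popSym (slot nil cons) (s1 ∷ ss)    run = step-by (cons _ _) (step-by (cons _ _) run)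
  run-popSym (slot nil cons) (blank ∷ ss) run = step-by (cons _ _) (step-by (cons _ _) run)

-- Stack `#1` holds the cells left of the head and stack `#2` the scanned cell with those to its
-- right; `#0` takes the input and the output. A call leaves `#1` and `#2` empty, so that calls can
-- follow each other.
module Call (M : TM) {k : ℕ} where
  open TM M

  private
    Prg : Set → Set₁
    Prg = StackProg (3 + k)

  load : Prg ⊤
  load = pour #0 #1 >> transfer #1 #2 coding

  moveHead : ∀ {E} → Sym → Move → Prg E → Prg E
  moveHead s mS p = pushSym #2 s p
  moveHead s mR p = pushSym #1 s p
  moveHead s mL p = pushSym #2 s (popSym #1 (λ s′ → pushSym #2 s′ p))

  perform : Sym → Act nQ → Prg (Fin nQ ⊎ Bool)
  perform s (halt b)    = pushSym #2 s (ret (inj₂ b))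
  perform s (go q s′ m) = moveHead s′ m (ret (inj₁ q))

  iterate : Fin nQ → Prg Bool
  iterate q = loop enum-Fin enum-Bool (λ q → popSym #2 (λ s → perform s (δ q s))) q ret

  unload : Prg ⊤
  unload = loop enum-⊤ enum-⊤ (λ _ → popSym #2 bit) tt ret
    where
    bit : Sym → Prg (⊤ ⊎ ⊤)
    bit blank = ret (inj₂ tt)
    bit s0    = op (push #0 false) λ _ → ret (inj₁ tt)
    bit s1    = op (push #0 true) λ _ → ret (inj₁ tt)

  finish : Bool → Prg Bool
  -- Unloading reverses the output and the three pours reverse it again, four times in all.
  finish true  = unload >> (clear #1 >> (clear #2 >> (pour #0 #1 >> (pour #1 #2 >> (pour #2 #0 >> ret true)))))
  finish false = clear #1 >> (clear #2 >> ret false)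

  call : Prg Bool
  call = load >> (iterate start then finish)

  module _ {ρ : Vec Str k} where
    run-load : ∀ x → Run load (x ∷ [] ∷ [] ∷ ρ) (suc (length x) * 7) tt ([] ∷ [] ∷ coded (map toSym x) ∷ ρ)
    run-load x = weaken (≤-reflexive (trans (cong (λ m → suc (length x) * 3 + suc m * 4) (length-rev x))
      (sym (*-distribˡ-+ (suc (length x)) 3 4))))
      (r-then {p = pour #0 #1} (run-pour slots₀₁ x ≤-refl)
        (subst (λ y → Run (transfer #1 #2 coding) ([] ∷ (x ʳ++ []) ∷ [] ∷ ρ) (suc (length (x ʳ++ [])) * 4) tt
          ([] ∷ [] ∷ y ∷ ρ))
          (trans (revMap-ʳ++ coding x [] []) (expand-coding x))
          (run-transfer slots₁₂ coding (λ _ → ≤-refl) (x ʳ++ []))))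

    length-rest : ∀ (r : List Sym) → suc (length (rest r)) ≤ suc (length r)
    length-rest []      = ≤-refl
    length-rest (_ ∷ r) = n≤1+n _

    Halted : Bool → Maybe Str → List Sym → Set
    Halted b r ss = r ≡ (if b then just (readBits ss) else nothing)

    -- Nine steps for each machine step: one for the loop, two to read the symbol and at most six to
    -- write and move. The tape gains at most two cells each time, and this bound later pays for
    -- clearing the stacks.
    Iterated : ℕ → Fin nQ → List Sym → List Sym → Maybe Str → Set₁
    Iterated t q l r res = Σ Bool λ b → Σ (List Sym) λ l′ → Σ (List Sym) λ r′ →
      Run (iterate q) ([] ∷ coded l ∷ coded r ∷ ρ) (t * 9) b ([] ∷ coded l′ ∷ coded r′ ∷ ρ)
      × Halted b res r′ × (length l′ + length r′ ≤ length l + length r + t * 2)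

    run-halt : ∀ t q l r {res} b → δ q (top r) ≡ halt b → Halted b res (top r ∷ rest r) → Iterated (suc t) q l r res
    run-halt t q l r b act halted = b , l , top r ∷ rest r ,
      weaken (s≤s (s≤s (s≤s (s≤s (s≤s z≤n))))) (r-stop {m = 4} (run-popSym slot₂ r
        (subst (λ a → Run (perform (top r) a) _ _ _ _) (sym act) (r-op (r-op r-ret)))) (r-ret {n = 0})) , halted ,
      ≤-trans (+-monoʳ-≤ (length l) (length-rest r)) (≤-trans (≤-reflexive (+-suc (length l) (length r)))
        (≤-trans (≤-reflexive (+-comm 1 _)) (+-monoʳ-≤ (length l + length r) (s≤s z≤n))))

    run-iterate : ∀ t q l r {res} → drun δ t (config q (before l r)) ≡ just res → Iterated t q l r res
    run-iterate (suc t) q l r eq with δ q (top r) in act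
    run-iterate (suc t) q l r refl | halt true  = run-halt t q l r true act refl
    run-iterate (suc t) q l r refl | halt false = run-halt t q l r false act refl
    run-iterate (suc t) q l r eq | go q′ s m = after-move m act
      (trans (sym (cong (drun δ t) (applyAct-shift q′ q s m (before l r)))) eq)
      where
      first : ∀ {m b z} → δ q (top r) ≡ go q′ s m → ∀ {l₁ r₁} →
        (∀ {n e z} → Run {E = Fin nQ ⊎ Bool} (ret (inj₁ q′)) ([] ∷ coded l₁ ∷ coded r₁ ∷ ρ) n e z →
                     Run (moveHead s m (ret (inj₁ q′))) ([] ∷ coded l ∷ coded (rest r) ∷ ρ) (6 + n) e z) →
        Run (iterate q′) ([] ∷ coded l₁ ∷ coded r₁ ∷ ρ) (t * 9) b z →
        Run (iterate q) ([] ∷ coded l ∷ coded r ∷ ρ) (suc t * 9) b z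
      first act mv run = r-go {m = 8} (run-popSym slot₂ r
        (subst (λ a → Run (perform (top r) a) _ _ _ _) (sym act) (mv r-ret))) run
      more-room : ∀ {x} a b → x ≤ a + t * 2 → a ≤ suc (suc b) → x ≤ b + suc t * 2
      more-room a b h h′ = ≤-trans h (≤-trans (+-monoˡ-≤ (t * 2) h′)
        (≤-reflexive (sym (trans (+-suc b (suc (t * 2))) (cong suc (+-suc b (t * 2)))))))
      after-move : ∀ m {res} → δ q (top r) ≡ go q′ s m →
        drun δ t (config q′ (shift (s , m) (before l r))) ≡ just res → Iterated (suc t) q l r res
      after-move mS act eq with run-iterate t q′ l (s ∷ rest r) eq
      ... | b , l′ , r′ , run , ok , sz = b , l′ , r′ ,
        first act (λ run → weaken (+-monoˡ-≤ _ (s≤s (s≤s z≤n))) (r-op (r-op run))) run , ok ,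
        more-room (length l + suc (length (rest r))) (length l + length r) sz
          (≤-trans (+-monoʳ-≤ (length l) (length-rest r))
            (≤-trans (≤-reflexive (+-suc (length l) (length r))) (n≤1+n _)))
      after-move mR act eq with run-iterate t q′ (s ∷ l) (rest r) eq
      ... | b , l′ , r′ , run , ok , sz = b , l′ , r′ ,
        first act (λ run → weaken (+-monoˡ-≤ _ (s≤s (s≤s z≤n))) (r-op (r-op run))) run , ok ,
        more-room (suc (length l) + length (rest r)) (length l + length r) sz
          (≤-trans (≤-reflexive (sym (+-suc (length l) (length (rest r)))))
            (≤-trans (+-monoʳ-≤ (length l) (length-rest r))
            (≤-trans (≤-reflexive (+-suc (length l) (length r))) (n≤1+n _))))
      after-move mL act eq with run-iterate t q′ (rest l) (top l ∷ s ∷ rest r) eq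
      ... | b , l′ , r′ , run , ok , sz = b , l′ , r′ ,
        first act (λ run → r-op (r-op (run-popSym slot₁ l (r-op (r-op run))))) run , ok ,
        more-room (length (rest l) + suc (suc (length (rest r)))) (length l + length r) sz (room l r)
        where
        room : ∀ (l r : List Sym) → length (rest l) + suc (suc (length (rest r))) ≤ suc (suc (length l + length r))
        room l r = ≤-trans
          (≤-reflexive (trans (+-suc (length (rest l)) (suc (length (rest r))))
            (cong suc (+-suc (length (rest l)) (length (rest r))))))
          (s≤s (s≤s (+-mono-≤ (≤-pred (length-rest l)) (≤-pred (length-rest r)))))

    run-unload : ∀ r o {l} → Σ (List Sym) λ r′ → (length r′ ≤ length r) ×
      Run unload (o ∷ l ∷ coded r ∷ ρ) (suc (length r) * 4) tt ((readBits r ʳ++ o) ∷ l ∷ coded r′ ∷ ρ)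
    run-unload [] o {l} = [] , z≤n , weaken (s≤s (s≤s (s≤s z≤n)))
      (r-stop {m = 2} (run-popSym slot₂ [] r-ret) (r-ret {n = 0}))
    run-unload (s0 ∷ r) o {l} with run-unload r (false ∷ o) {l}
    ... | r′ , le , run = r′ , ≤-trans le (n≤1+n _) ,
      r-go {m = 3} (run-popSym slot₂ (s0 ∷ r) (r-op r-ret)) run
    run-unload (s1 ∷ r) o {l} with run-unload r (true ∷ o) {l}
    ... | r′ , le , run = r′ , ≤-trans le (n≤1+n _) ,
      r-go {m = 3} (run-popSym slot₂ (s1 ∷ r) (r-op r-ret)) run
    run-unload (blank ∷ r) o {l} = r , n≤1+n _ ,
      weaken (s≤s (s≤s (s≤s z≤n))) (r-stop {m = 2} (run-popSym slot₂ (blank ∷ r) r-ret) (r-ret {n = 0}))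

    length-coded : ∀ ss → length (coded ss) ≡ length ss * 2
    length-coded []       = refl
    length-coded (s ∷ ss) = cong (λ n → suc (suc n)) (length-coded ss)

    length-readBits : ∀ ss → length (readBits ss) ≤ length ss
    length-readBits []           = z≤n
    length-readBits (s0 ∷ ss)    = s≤s (length-readBits ss)
    length-readBits (s1 ∷ ss)    = s≤s (length-readBits ss)
    length-readBits (blank ∷ ss) = z≤n

    run-clear₁ : ∀ {m} l {a c} → length l ≤ m → Run (clear #1) (a ∷ coded l ∷ c ∷ ρ) (suc m * 4) tt (a ∷ [] ∷ c ∷ ρ)
    run-clear₁ {m} l {a} {c} le = weaken (s≤s (s≤s (≤-trans (≤-reflexive (*-assoc m 2 2)) (m≤n+m _ 2))))
      (run-clear slot₁ (coded l) (≤-trans (≤-reflexive (length-coded l)) (*-monoˡ-≤ 2 le)))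

    run-clear₂ : ∀ {m} l {a c} → length l ≤ m → Run (clear #2) (a ∷ c ∷ coded l ∷ ρ) (suc m * 4) tt (a ∷ c ∷ [] ∷ ρ)
    run-clear₂ {m} l {a} {c} le = weaken (s≤s (s≤s (≤-trans (≤-reflexive (*-assoc m 2 2)) (m≤n+m _ 2))))
      (run-clear slot₂ (coded l) (≤-trans (≤-reflexive (length-coded l)) (*-monoˡ-≤ 2 le)))

    run-finish : ∀ m b l r {res} → length l + length r ≤ m → Halted b res r →
      Run (finish b) ([] ∷ coded l ∷ coded r ∷ ρ) (suc m * 21) (is-just res) (fromMaybe [] res ∷ [] ∷ [] ∷ ρ)
      × (length (fromMaybe [] res) ≤ m)
    run-finish m false l r sz refl = weaken (*-monoʳ-≤ (suc m) {8} {21}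
      (s≤s (s≤s (s≤s (s≤s (s≤s (s≤s (s≤s (s≤s z≤n)))))))))
      (weaken (≤-reflexive (trans (cong (suc m * 4 +_) (+-identityʳ _)) (sym (*-distribˡ-+ (suc m) 4 4))))
        (r-then {p = clear #1} (run-clear₁ l (m+n≤o⇒m≤o _ sz))
          (r-then {p = clear #2} (run-clear₂ r (m+n≤o⇒n≤o _ sz)) (r-ret {n = 0})))) , z≤n
    run-finish m true l r sz refl with run-unload r [] {coded l}
    ... | r′ , le , run = weaken (≤-reflexive (total m))
      (r-then {p = unload} (weaken (*-monoˡ-≤ 4 (s≤s r≤m)) run)
      (r-then {p = clear #1} (run-clear₁ l (m+n≤o⇒m≤o _ sz))
      (r-then {p = clear #2} (run-clear₂ r′ (≤-trans le r≤m))
      (r-then {p = pour #0 #1} (run-pour slots₀₁ o o≤m)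
      (r-then {p = pour #1 #2} (run-unpour slots₁₂ o o≤m)
      (r-then {p = pour #2 #0} (run-unpour slots₂₀ (readBits r) bits≤m) (r-ret {n = 0}))))))) , bits≤m
      where
      o : Str
      o = readBits r ʳ++ []
      r≤m : length r ≤ m
      r≤m = m+n≤o⇒n≤o (length l) sz
      bits≤m : length (readBits r) ≤ m
      bits≤m = ≤-trans (length-readBits r) r≤m
      o≤m : length o ≤ m
      o≤m = ≤-trans (≤-reflexive (length-rev (readBits r))) bits≤m
      total : ∀ m → suc m * 4 + (suc m * 4 + (suc m * 4 + (suc m * 3 + (suc m * 3 + (suc m * 3 + 0))))) ≡ suc m * 21
      total = solve-∀

    run-call : ∀ {t x res} → exec M t x ≡ just res →
      Run call (x ∷ [] ∷ [] ∷ ρ) (suc (length x + t * 2) * 42) (is-just res) (fromMaybe [] res ∷ [] ∷ [] ∷ ρ)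
      × (length (fromMaybe [] res) ≤ length x + t * 2)
    run-call {t} {x} {res} eq with run-iterate t start [] (map toSym x) (trans (cong (drun δ t) (initial x)) eq)
      where
      initial : ∀ x → config start (before [] (map toSym x)) ≡ initCfg start x
      initial []      = refl
      initial (_ ∷ _) = refl
    ... | b , l , r , run , halted , sz with run-finish (length x + t * 2) b l r
      (≤-trans sz (≤-reflexive (cong (_+ t * 2) (List.length-map toSym x)))) halted
    ... | run′ , short = weaken (≤-trans (+-mono-≤ (*-monoˡ-≤ 7 (s≤s (m≤m+n (length x) (t * 2))))
      (+-monoˡ-≤ (suc (length x + t * 2) * 21) iter)) (≤-reflexive (total (length x + t * 2))))
      (r-then {p = load} (run-load x) (r-then {p = iterate start} run run′)) , short
      where
      iter : t * 9 ≤ suc (length x + t * 2) * 14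
      iter = ≤-trans (≤-trans (*-monoʳ-≤ t {9} {28} (s≤s (s≤s (s≤s (s≤s (s≤s (s≤s (s≤s (s≤s (s≤s z≤n))))))))))
        (≤-reflexive (sym (*-assoc t 2 14))))
        (*-monoˡ-≤ 14 (≤-trans (m≤n+m (t * 2) (length x)) (n≤1+n _)))
      total : ∀ m → suc m * 7 + (suc m * 14 + suc m * 21) ≡ suc m * 42
      total = solve-∀

-- Closure properties of polynomial time

abstract
  -- A single bound for the time of a call and for the length of its output, so that costs of
  -- successive calls can be nested.
  cost : ℕ → ℕ → ℕ
  cost k n = suc (n + poly k n * 2) * 42

  cost-mono : ∀ k {m n} → m ≤ n → cost k m ≤ cost k n
  cost-mono k le = *-monoˡ-≤ 42 (s≤s (+-mono-≤ le (*-monoˡ-≤ 2 (poly-mono k le))))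

  pb-cost : ∀ k {f} → PolyBounded f → PolyBounded (λ n → cost k (f n))
  pb-cost k F = pb-* (pb-+ (pb-const 1) (pb-+ F (pb-* (pb-poly k F) (pb-const 2)))) (pb-const 42)

  callTM : TM → ∀ {d} → StackProg (3 + d) Bool
  callTM M = Call.call M

  run-callTM : ∀ M k {x res d} {ρ : Vec Str d} → exec M (poly k (length x)) x ≡ just res →
    Run (callTM M) (x ∷ [] ∷ [] ∷ ρ) (cost k (length x)) (is-just res) (fromMaybe [] res ∷ [] ∷ [] ∷ ρ)
  run-callTM M k {x} eq = proj₁ (Call.run-call M {t = poly k (length x)} {x = x} eq)

  short-callTM : ∀ M k {x res} → exec M (poly k (length x)) x ≡ just res → length (fromMaybe [] res) ≤ cost k (length x)
  short-callTM M k {x} eq = ≤-trans (proj₂ (Call.run-call M {ρ = []} {t = poly k (length x)} {x = x} eq))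
    (≤-trans (n≤1+n _) (m≤m*n _ 42))

answer : ∀ res {k} {ρ : Vec Str k} → Answer res (is-just res) (fromMaybe [] res ∷ ρ)
answer (just _) = accepted
answer nothing  = rejected

map-id : ∀ {A : Set} (r : Maybe A) → Maybe.map id r ≡ r
map-id (just _) = refl
map-id nothing  = refl

respects : ∀ {I} {ι : I → Str} {f g} → (∀ i → f i ≡ g i) → Computes ι f → Computes ι g
respects f≗g (M , k , eq) = M , k , λ i → trans (eq i) (cong just (f≗g i))

Encoding : Set → Set
Encoding A = A → Str

infixr 2 _⊗_
_⊗_ : ∀ {A B} → Encoding A → Encoding B → Encoding (A × B)
(ι ⊗ κ) (a , b) = enc2 (ι a) (κ b)

-- As a record, it lets the encodings and the function be recovered from the type of a proof.
record PTime {A B : Set} (ι : Encoding A) (κ : Encoding B) (f : A → Maybe B) : Set where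
  constructor pTime
  field computes : Computes ι (λ a → Maybe.map κ (f a))
open PTime public

pTime-cong : ∀ {A B} {ι : Encoding A} {κ : Encoding B} {f g} → (∀ a → f a ≡ g a) → PTime ι κ f → PTime ι κ g
pTime-cong {κ = κ} f≗g (pTime c) = pTime (respects (λ a → cong (Maybe.map κ) (f≗g a)) c)

module _ {A B C : Set} {ι : Encoding A} {κ : Encoding B} {μ : Encoding C} where

  compose : ∀ {f g} → PTime ι κ f → PTime κ μ g → PTime ι μ (λ a → f a >>= g)
  compose {f} {g} (pTime (M , k , runs)) (pTime (M′ , k′ , runs′)) = pTime $ program⇒TM record
    { depth = 2
    ; code = code
    ; bound = bound
    ; bounded = pb-+ (pb-cost k pb-id) (pb-cost k′ (pb-cost k pb-id))
    ; correct = λ a → correct a (f a) refl }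
    where
    second : Bool → StackProg 3 Bool
    second true  = callTM M′
    second false = ret false
    code : StackProg 3 Bool
    code = callTM M then second
    bound : ℕ → ℕ
    bound n = cost k n + cost k′ (cost k n)
    correct : ∀ a fa → f a ≡ fa → Behaves code (ι a) (bound (length (ι a))) (Maybe.map μ (f a >>= g))
    correct a nothing eq = false , _ , r-then {f = second}
      (run-callTM M k (trans (runs a) (cong (just ∘ Maybe.map κ) eq))) r-ret
      , subst (λ r → Answer (Maybe.map μ (r >>= g)) false ([] ∷ [] ∷ [] ∷ [])) (sym eq) rejected
    correct a (just b) eq = _ , _ , r-then {f = second} (run-callTM M k runs-a)
        (weaken (cost-mono k′ (short-callTM M k runs-a)) (run-callTM M′ k′ (runs′ b)))
      , subst (λ r → Answer (Maybe.map μ (r >>= g)) (is-just (Maybe.map μ (g b)))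
        (fromMaybe [] (Maybe.map μ (g b)) ∷ [] ∷ [] ∷ []))
          (sym eq) (answer (Maybe.map μ (g b)))
      where
      runs-a : exec M (poly k (length (ι a))) (ι a) ≡ just (just (κ b))
      runs-a = trans (runs a) (cong (just ∘ Maybe.map κ) eq)

split : ∀ {d} → StackProg (4 + d) ⊤
split = loop enum-⊤ enum-⊤ (λ _ → op (pop #1) both) tt ret
  where
  both : Maybe Bool → StackProg _ (⊤ ⊎ ⊤)
  both nothing  = ret (inj₂ tt)
  both (just b) = op (push #0 b) λ _ → op (push #3 b) λ _ → ret (inj₁ tt)

run-split : ∀ s {t d} {ρ : Vec Str d} → Run split (t ∷ s ∷ [] ∷ t ∷ ρ) (suc (length s) * 4) tt
  ((s ʳ++ t) ∷ [] ∷ [] ∷ (s ʳ++ t) ∷ ρ)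
run-split []      = weaken (s≤s (s≤s z≤n)) (r-stop {m = 1} (r-op r-ret) r-ret)
run-split (b ∷ s) = r-go {m = 3} (r-op (r-op (r-op r-ret))) (run-split s)

copy : ∀ {d} → StackProg (4 + d) ⊤
copy = pour #0 #1 >> split

restore : ∀ {d} → StackProg (4 + d) ⊤
restore = pour #3 #1 >> pour #1 #0

run-copy : ∀ x {d} {ρ : Vec Str d} → Run copy (x ∷ [] ∷ [] ∷ [] ∷ ρ) (suc (length x) * 7) tt (x ∷ [] ∷ [] ∷ x ∷ ρ)
run-copy x {ρ = ρ} = weaken (≤-reflexive (trans (cong (λ m → suc (length x) * 3 + suc m * 4) (length-rev x))
  (sym (*-distribˡ-+ (suc (length x)) 3 4))))
  (r-then {p = pour #0 #1} (run-pour slots₀₁ x ≤-refl)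
    (subst (λ y → Run split ([] ∷ (x ʳ++ []) ∷ [] ∷ [] ∷ ρ) (suc (length (x ʳ++ [])) * 4) tt (y ∷ [] ∷ [] ∷ y ∷ ρ))
      (unrev x) (run-split (x ʳ++ []))))

run-restore : ∀ x {d} {ρ : Vec Str d} → Run restore ([] ∷ [] ∷ [] ∷ x ∷ ρ) (suc (length x) * 6) tt
  (x ∷ [] ∷ [] ∷ [] ∷ ρ)
run-restore x = weaken (≤-reflexive (sym (*-distribˡ-+ (suc (length x)) 3 3)))
  (r-then {p = pour #3 #1} (run-pour slots₃₁ x ≤-refl) (run-unpour slots₁₀ x ≤-refl))

twice : Bool → List Bool
twice b = b ∷ b ∷ []

expand-twice : ∀ x d → expand twice x d ≡ double x ++ d
expand-twice []      d = refl
expand-twice (b ∷ x) d = cong (λ y → b ∷ b ∷ y) (expand-twice x d)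

module _ {A B C : Set} {ι : Encoding A} {κ : Encoding B} {μ : Encoding C} where

  -- Calls touch only the first three stacks. A copy of the input therefore survives on `#3`, and
  -- the first output, reversed, on `#4`, from where it is doubled onto the second output to form
  -- `enc2`.
  fork : ∀ {f g} → PTime ι κ f → PTime ι μ g → PTime ι (κ ⊗ μ) (λ a → f a >>= λ b → Maybe.map (b ,_) (g a))
  fork {f} {g} (pTime (M , k , runs)) (pTime (M′ , k′ , runs′)) = pTime $ program⇒TM record
    { depth = 4
    ; code = code
    ; bound = bound
    ; bounded = pb-+ (pb-linear 13) (pb-+ (pb-cost k pb-id) (pb-+ (pb-cost k′ pb-id)
        (pb-+ (pb-* (pb-+ (pb-const 1) (pb-cost k pb-id)) (pb-const 7)) (pb-const 2))))
    ; correct = λ a → correct a (f a) refl (g a) refl }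
    where
    bound : ℕ → ℕ
    bound n = suc n * 13 + (cost k n + (cost k′ n + (suc (cost k n) * 7 + 2)))
    second : Bool → StackProg 5 Bool
    second false = ret false
    second true  = op (push #0 true) λ _ → op (push #0 false) λ _ → transfer #4 #0 twice >> ret true
    first : Bool → StackProg 5 Bool
    first false = ret false
    first true  = pour #0 #4 >> (restore >> (callTM M′ then second))
    code : StackProg 5 Bool
    code = copy >> (callTM M then first)
    result : Maybe B → Maybe C → Maybe Str
    result r r′ = Maybe.map (κ ⊗ μ) (r >>= λ b → Maybe.map (b ,_) r′)
    conclude : ∀ a {b S r r′} → f a ≡ r → g a ≡ r′ → Run code (ι a ∷ Vec.replicate 4 []) (bound (length (ι a))) b S →
      Answer (result r r′) b S → Behaves code (ι a) (bound (length (ι a))) (result (f a) (g a))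
    conclude a refl refl run ans = _ , _ , run , ans
    correct : ∀ a fa → f a ≡ fa → ∀ ga → g a ≡ ga → Behaves code (ι a) (bound (length (ι a))) (result (f a) (g a))
    correct a nothing eq ga eq′ = conclude a eq eq′
      (weaken (+-mono-≤ (*-monoʳ-≤ (suc (length (ι a))) {7} {13} (s≤s (s≤s (s≤s (s≤s (s≤s (s≤s (s≤s z≤n))))))))
        (+-monoʳ-≤ (cost k (length (ι a))) z≤n))
        (r-then {p = copy} (run-copy (ι a)) (r-then (run-callTM M k (trans (runs a) (cong (just ∘ Maybe.map κ) eq)))
          (r-ret {n = 0})))) rejected
    correct a (just b) eq ga eq′ = finish ga eq′
      where
      n = length (ι a)
      K = cost k n
      K′ = cost k′ n
      runs-a : exec M (poly k n) (ι a) ≡ just (just (κ b))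
      runs-a = trans (runs a) (cong (just ∘ Maybe.map κ) eq)
      short : length (κ b) ≤ K
      short = short-callTM M k runs-a
      arith : ∀ n K K′ r → suc n * 7 + (K + (suc K * 3 + (suc n * 6 + (K′ + r)))) ≡ suc n * 13 +
        (K + (K′ + (suc K * 3 + r)))
      arith = solve-∀
      upto : ∀ {r c S} → Run (second (is-just (Maybe.map μ (g a))))
        (fromMaybe [] (Maybe.map μ (g a)) ∷ [] ∷ [] ∷ [] ∷ (κ b ʳ++ []) ∷ []) r c S →
        r ≤ suc K * 4 + 2 →
        Run code (ι a ∷ Vec.replicate 4 []) (bound n) c S
      upto {r} run le = weaken (≤-trans (≤-reflexive (arith n K K′ r))
        (+-monoʳ-≤ (suc n * 13) (+-monoʳ-≤ K (+-monoʳ-≤ K′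
          (≤-trans (+-monoʳ-≤ (suc K * 3) le) (≤-reflexive
            (trans (sym (+-assoc (suc K * 3) (suc K * 4) 2)) (cong (_+ 2) (sym (*-distribˡ-+ (suc K) 3 4))))))))))
        (r-then {p = copy} (run-copy (ι a)) (r-then (run-callTM M k runs-a) (r-then {p = pour #0 #4}
          (run-pour slots₀₄ (κ b) short)
          (r-then {p = restore} (run-restore (ι a)) (r-then (run-callTM M′ k′ (runs′ a)) run)))))
      finish : ∀ ga → g a ≡ ga → Behaves code (ι a) (bound (length (ι a))) (result (f a) (g a))
      finish nothing eq′ = conclude a eq eq′ (upto (subst
        (λ r → Run (second (is-just (Maybe.map μ r))) (fromMaybe [] (Maybe.map μ r) ∷ [] ∷ [] ∷ [] ∷ (κ b ʳ++ [])
        ∷ []) 0 false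
        ([] ∷ [] ∷ [] ∷ [] ∷ (κ b ʳ++ []) ∷ [])) (sym eq′) r-ret) z≤n) rejected
      finish (just c) eq′ = conclude a eq eq′ (upto (subst
        (λ r → Run (second (is-just (Maybe.map μ r))) (fromMaybe [] (Maybe.map μ r) ∷ [] ∷ [] ∷ [] ∷ (κ b ʳ++ []) ∷ [])
          (2 + (suc (length (κ b ʳ++ [])) * 4 + 0)) true (enc2 (κ b) (μ c) ∷ [] ∷ [] ∷ [] ∷ [] ∷ [])) (sym eq′)
          (r-op (r-op (r-then {p = transfer #4 #0 twice}
            (subst (λ y → Run (transfer #4 #0 twice) ((false ∷ true ∷ μ c) ∷ [] ∷ [] ∷ [] ∷ (κ b ʳ++ []) ∷ [])
            (suc (length (κ b ʳ++ [])) * 4) tt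
            (y ∷ [] ∷ [] ∷ [] ∷ [] ∷ [])) (trans (revMap-ʳ++ twice (κ b) [] (false ∷ true ∷ μ c))
              (expand-twice (κ b) (false ∷ true ∷ μ c)))
            (run-transfer slots₄₀ twice (λ _ → ≤-refl) (κ b ʳ++ []))) r-ret))))
        (≤-trans (≤-reflexive (trans (cong (2 +_) (trans (+-identityʳ _)
          (cong (λ m → suc m * 4) (length-rev (κ b))))) (+-comm 2 _))) (+-monoˡ-≤ 2 (*-monoˡ-≤ 4 (s≤s short)))))
        accepted

module _ {A B : Set} {ι : Encoding A} {κ : Encoding B} where

  ite : ∀ {D : Set} {δ : Encoding D} {t : A → Maybe D} {f g : A → Maybe B} → PTime ι δ t → PTime ι κ f → PTime ι κ g →
    PTime ι κ (λ a → if is-just (t a) then f a else g a)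
  ite {δ = δ} {t} {f} {g} (pTime (Mt , kt , runst)) (pTime (M , k , runs))
    (pTime (M′ , k′ , runs′)) = pTime $ program⇒TM record
    { depth = 3
    ; code = copy >> (callTM Mt then λ b → clear #0 >> (restore >> branch b))
    ; bound = bound
    ; bounded = pb-+ (pb-linear 7) (pb-+ (pb-cost kt pb-id)
      (pb-+ (pb-* (pb-+ (pb-const 1) (pb-cost kt pb-id)) (pb-const 2))
        (pb-+ (pb-linear 6) (pb-+ (pb-cost k pb-id) (pb-cost k′ pb-id)))))
    ; correct = λ a → is-just (Maybe.map κ (if is-just (t a) then f a else g a)) , _ ,
        r-then {p = copy} (run-copy (ι a)) (r-then (run-callTM Mt kt (runst a)) (r-then {p = clear #0}
          (run-clear slot₀ _ (short-callTM Mt kt (runst a)))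
          (r-then {p = restore} (run-restore (ι a)) (run-branch a (t a)))))
        , answer _ }
    where
    branch : Bool → StackProg 4 Bool
    branch true  = callTM M
    branch false = callTM M′
    bound : ℕ → ℕ
    bound n = suc n * 7 + (cost kt n + (suc (cost kt n) * 2 + (suc n * 6 + (cost k n + cost k′ n))))
    run-branch : ∀ a r → let res = Maybe.map κ (if is-just r then f a else g a) in
      Run (branch (is-just (Maybe.map δ r))) (ι a ∷ [] ∷ [] ∷ [] ∷ [])
        (cost k (length (ι a)) + cost k′ (length (ι a))) (is-just res) (fromMaybe [] res ∷ [] ∷ [] ∷ [] ∷ [])
    run-branch a (just _) = weaken (m≤m+n _ _) (run-callTM M k (runs a))
    run-branch a nothing  = weaken (m≤n+m _ _) (run-callTM M′ k′ (runs′ a))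

infixr 2 _⊕_
_⊕_ : ∀ {A B} → Encoding A → Encoding B → Encoding (A ⊎ B)
(ι ⊕ κ) (inj₁ a) = false ∷ ι a
(ι ⊕ κ) (inj₂ b) = true ∷ κ b

module _ {A S B : Set} {ι : Encoding A} {σ : Encoding S} {κ : Encoding B} (step : S → Maybe (S ⊎ B)) where

  data Iterates (size : ℕ) : S → ℕ → B → Set where
    stop : ∀ {s b} → length (σ s) ≤ size → step s ≡ just (inj₂ b) → Iterates size s 1 b
    go   : ∀ {s s′ n b} → length (σ s) ≤ size → step s ≡ just (inj₁ s′) → Iterates size s′ n b →
      Iterates size s (suc n) b

  data Outcome (init : A → Maybe S) (q : ℕ → ℕ) (a : A) : Maybe B → Set where
    undefined : init a ≡ nothing → Outcome init q a nothing
    defined   : ∀ {s n b} → init a ≡ just s → n ≤ q (length (ι a)) → Iterates (q (length (ι a))) s n b →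
      Outcome init q a (just b)

  -- The output of each call is the input of the next, and its first bit, the tag of `⊕`, controls
  -- the loop. Since calls could square lengths again and again, `q` has to bound the size of every
  -- intermediate state as well as the number of rounds.
  iterate : ∀ {init h q} → PolyBounded q → PTime ι σ init → PTime σ (σ ⊕ κ) step → (∀ a → Outcome init q a (h a)) →
    PTime ι κ h
  iterate {init} {h} {q} pb (pTime (M , k , runs)) (pTime (M′ , k′ , runs′)) outcome = pTime $ program⇒TM record
    { depth = 2
    ; code = code
    ; bound = bound
    ; bounded = pb-+ (pb-cost k pb-id) (pb-* pb (pb-+ (pb-const 2) (pb-cost k′ pb)))
    ; correct = λ a → correct a (outcome a) }
    where
    bound : ℕ → ℕ
    bound n = cost k n + q n * (2 + cost k′ (q n))
    next : Maybe Bool → StackProg 3 (⊤ ⊎ Bool)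
    next nothing      = ret (inj₂ false)
    next (just true)  = ret (inj₂ true)
    next (just false) = ret (inj₁ tt)
    called : Bool → StackProg 3 (⊤ ⊎ Bool)
    called false = ret (inj₂ false)
    called true  = op (pop #0) next
    repeat : StackProg 3 Bool
    repeat = loop enum-⊤ enum-Bool (λ _ → callTM M′ then called) tt ret
    begun : Bool → StackProg 3 Bool
    begun false = ret false
    begun true  = repeat
    code : StackProg 3 Bool
    code = callTM M then begun
    step-runs : ∀ {size s r} → length (σ s) ≤ size → step s ≡ just r →
      ∀ {c S m} → Run (called true) ((σ ⊕ κ) r ∷ [] ∷ [] ∷ []) m c S →
        Run (callTM M′ then called) (σ s ∷ [] ∷ [] ∷ []) (cost k′ size + m) c S
    step-runs {s = s} le eq run = r-then (weaken (cost-mono k′ le)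
      (run-callTM M′ k′ (trans (runs′ s) (cong (just ∘ Maybe.map (σ ⊕ κ)) eq)))) run
    time : ∀ K → suc (K + 1 + 0) ≡ 2 + K + 0
    time K = cong suc (cong (_+ 0) (+-comm K 1))
    run-repeat : ∀ {size s n b} → Iterates size s n b →
      Run repeat (σ s ∷ [] ∷ [] ∷ []) (n * (2 + cost k′ size)) true (κ b ∷ [] ∷ [] ∷ [])
    run-repeat {size} (stop le eq) = weaken (≤-reflexive (time (cost k′ size)))
      (r-stop (step-runs le eq (r-op r-ret)) r-ret)
    run-repeat {size} (go {n = n} le eq its) =
      weaken (≤-reflexive (cong (λ m → suc (m + n * (2 + cost k′ size))) (+-comm (cost k′ size) 1)))
        (r-go (step-runs le eq (r-op r-ret)) (run-repeat its))
    correct : ∀ a {r} → Outcome init q a r → Behaves code (ι a) (bound (length (ι a))) (Maybe.map κ r)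
    correct a (undefined eq) = _ , _ , r-then (run-callTM M k (trans (runs a) (cong (just ∘ Maybe.map σ) eq))) r-ret
      , rejected
    correct a (defined eq le its) = _ , _ ,
      r-then (run-callTM M k (trans (runs a) (cong (just ∘ Maybe.map σ) eq)))
        (weaken (*-monoˡ-≤ (2 + cost k′ (q (length (ι a)))) le) (run-repeat its)) , accepted

-- Basic polynomial-time functions

bits : Encoding Str
bits = id

unit : Encoding ⊤
unit _ = []

identity : ∀ {A} {ι : Encoding A} → PTime ι ι just
identity = pTime $ program⇒TM record
  { depth = 0 ; code = ret true ; bound = λ _ → 0 ; bounded = pb-const 0 ; correct = λ _ → _ , _ , r-ret , accepted }

prepend : ∀ {A B} {ι : Encoding A} {κ : Encoding B} c {h : A → B} → (∀ a → κ (h a) ≡ c ++ ι a) → PTime ι κ (just ∘ h)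
prepend {ι = ι} {κ} c {h} eq = pTime $ program⇒TM record
  { depth = 0
  ; code = pushAll #0 (reverse c) >> ret true
  ; bound = λ _ → length (reverse c) + 0
  ; bounded = pb-const _
  ; correct = λ a → true , _ , r-then {p = pushAll #0 (reverse c)} (run-pushes (reverse c)) (r-ret {n = 0})
      , subst (λ o → Answer (just (κ (h a))) true (o ∷ [])) (trans (eq a) (sym (rev-rev c))) accepted }
  where
  run-pushes : ∀ bs {x} → Run (pushAll {k = 1} #0 bs) (x ∷ []) (length bs) tt ((bs ʳ++ x) ∷ [])
  run-pushes []       = r-ret
  run-pushes (b ∷ bs) = r-op (run-pushes bs)

expanding : ∀ {A B} {ι : Encoding A} {κ : Encoding B} φ {w} → (∀ b → length (φ b) ≤ w) → {h : A → B} →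
  (∀ a → κ (h a) ≡ expand φ (ι a) []) → PTime ι κ (just ∘ h)
expanding {ι = ι} {κ} φ {w} short {h} eq = pTime $ program⇒TM record
  { depth = 2
  ; code = pour #0 #1 >> (transfer #1 #0 φ >> ret true)
  ; bound = λ n → suc n * 3 + (suc n * (2 + w) + 0)
  ; bounded = pb-+ (pb-linear 3) (pb-+ (pb-linear (2 + w)) (pb-const 0))
  ; correct = λ a → true , _ , r-then {p = pour #0 #1} (run-pour slots₀₁ (ι a) ≤-refl)
      (r-then {p = transfer #1 #0 φ} (weaken (≤-reflexive (cong (λ m → suc m * (2 + w)) (length-rev (ι a))))
        (run-transfer slots₁₀ φ short (ι a ʳ++ []))) (r-ret {n = 0}))
      , subst (λ o → Answer (just (κ (h a))) true (o ∷ [] ∷ [] ∷ []))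
        (trans (eq a) (sym (revMap-ʳ++ φ (ι a) [] []))) accepted }

constant : ∀ {A B} {ι : Encoding A} {κ : Encoding B} b → PTime ι κ (λ _ → just b)
constant {ι = ι} {κ} b = compose {κ = unit} {μ = κ} (expanding {κ = unit} (λ _ → []) (λ _ → ≤-refl) {h = λ _ → tt}
  (λ a → sym (empty (ι a))))
  (prepend {ι = unit} {κ = κ} (κ b) {h = λ _ → b} (λ _ → sym (List.++-identityʳ (κ b))))
  where
  empty : ∀ x → expand (λ _ → []) x [] ≡ []
  empty []      = refl
  empty (_ ∷ x) = empty x

agree : Bool → Bool → Bool
agree true  b = b
agree false b = not b

-- The remainder after a first component encoded as in enc2, and that component reversed onto d; a malformed
-- component ends at the first defect.
parsed : Str → Str → Str × Str
parsed (true ∷ true ∷ s)   d = parsed s (true ∷ d)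
parsed (false ∷ false ∷ s) d = parsed s (false ∷ d)
parsed (true ∷ false ∷ s)  d = s , d
parsed (false ∷ true ∷ s)  d = s , d
parsed (_ ∷ [])            d = [] , d
parsed []                  d = [] , d

parsed-enc2 : ∀ a {b d} → parsed (enc2 a b) d ≡ (b , a ʳ++ d)
parsed-enc2 []          = refl
parsed-enc2 (true ∷ a)  = parsed-enc2 a
parsed-enc2 (false ∷ a) = parsed-enc2 a

parse : ∀ {k} → Fin k → Fin k → StackProg k ⊤
parse i j = loop enum-⊤ enum-⊤ (λ _ → op (pop i) first) tt ret
  where
  pair : Bool → Bool → StackProg _ (⊤ ⊎ ⊤)
  pair true  true  = op (push j true) λ _ → ret (inj₁ tt)
  pair false false = op (push j false) λ _ → ret (inj₁ tt)
  pair _     _     = ret (inj₂ tt)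
  second : Bool → Maybe Bool → StackProg _ (⊤ ⊎ ⊤)
  second b nothing  = ret (inj₂ tt)
  second b (just c) = pair b c
  first : Maybe Bool → StackProg _ (⊤ ⊎ ⊤)
  first nothing  = ret (inj₂ tt)
  first (just b) = op (pop i) (second b)

module _ {k} {i j : Fin k} {S : Str → Str → Vec Str k} (sl : Slots i j S) where
  open Slots sl

  run-parsed : ∀ s {d} → Run (parse i j) (S s d) (suc (length s) * 4) tt (S (proj₁ (parsed s d)) (proj₂ (parsed s d)))
  run-parsed []           = weaken (s≤s (s≤s z≤n)) (r-stop {m = 1} (step-by (pop-[] _) r-ret) r-ret)
  run-parsed (true ∷ [])  = weaken (m≤n+m 3 5) (r-stop {m = 2} (step-by (pop-∷ _ _ _) (step-by (pop-[] _) r-ret)) r-ret)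
  run-parsed (false ∷ []) = weaken (m≤n+m 3 5) (r-stop {m = 2} (step-by (pop-∷ _ _ _) (step-by (pop-[] _) r-ret)) r-ret)
  run-parsed (true ∷ true ∷ s)   = weaken (m≤n+m _ 4) (r-go {m = 3}
    (step-by (pop-∷ _ _ _) (step-by (pop-∷ _ _ _) (step-by (cong (tt ,_) (push-on _ _ _)) r-ret))) (run-parsed s))
  run-parsed (false ∷ false ∷ s) = weaken (m≤n+m _ 4) (r-go {m = 3}
    (step-by (pop-∷ _ _ _) (step-by (pop-∷ _ _ _) (step-by (cong (tt ,_) (push-on _ _ _)) r-ret))) (run-parsed s))
  run-parsed (true ∷ false ∷ s)  = weaken (s≤s (s≤s (s≤s z≤n)))
    (r-stop {m = 2} (step-by (pop-∷ _ _ _) (step-by (pop-∷ _ _ _) r-ret)) r-ret)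
  run-parsed (false ∷ true ∷ s)  = weaken (s≤s (s≤s (s≤s z≤n)))
    (r-stop {m = 2} (step-by (pop-∷ _ _ _) (step-by (pop-∷ _ _ _) r-ret)) r-ret)

  run-parse : ∀ a {b d} → Run (parse i j) (S (enc2 a b) d) (suc (length (enc2 a b)) * 4) tt (S b (a ʳ++ d))
  run-parse a {b} {d} = subst (λ p → Run (parse i j) (S (enc2 a b) d) (suc (length (enc2 a b)) * 4) tt
    (S (proj₁ p) (proj₂ p))) (parsed-enc2 a) (run-parsed (enc2 a b))

length-enc2 : ∀ a b → length (enc2 a b) ≡ length a * 2 + (2 + length b)
length-enc2 []      b = refl
length-enc2 (_ ∷ a) b = cong (2 +_) (length-enc2 a b)

enc2-longˡ : ∀ a b → length a ≤ length (enc2 a b)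
enc2-longˡ a b = ≤-trans (m≤m*n (length a) 2) (≤-trans (m≤m+n _ _) (≤-reflexive (sym (length-enc2 a b))))

enc2-longʳ : ∀ a b → length b ≤ length (enc2 a b)
enc2-longʳ a b = ≤-trans (m≤n+m _ 2) (≤-trans (m≤n+m _ (length a * 2)) (≤-reflexive (sym (length-enc2 a b))))

module _ {A B : Set} {ι : Encoding A} {κ : Encoding B} where

  first : PTime (ι ⊗ κ) ι (just ∘ proj₁)
  first = pTime $ program⇒TM record
    { depth = 1
    ; code = parse #0 #1 >> (clear #0 >> (pour #1 #0 >> ret true))
    ; bound = λ n → suc n * 4 + (suc n * 2 + (suc n * 3 + 0))
    ; bounded = pb-+ (pb-linear 4) (pb-+ (pb-linear 2) (pb-+ (pb-linear 3) (pb-const 0)))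
    ; correct = λ { (a , b) → true , _ ,
        r-then {p = parse #0 #1} (run-parse slots₀₁ (ι a))
        (r-then {p = clear #0} (run-clear slot₀ (κ b) (enc2-longʳ (ι a) (κ b)))
        (r-then {p = pour #1 #0} (run-unpour slots₁₀ (ι a) (enc2-longˡ (ι a) (κ b))) (r-ret {n = 0})))
        , accepted } }

  second : PTime (ι ⊗ κ) κ (just ∘ proj₂)
  second = pTime $ program⇒TM record
    { depth = 1
    ; code = parse #0 #1 >> ret true
    ; bound = λ n → suc n * 4 + 0
    ; bounded = pb-+ (pb-* (pb-+ (pb-const 1) pb-id) (pb-const 4)) (pb-const 0)
    ; correct = λ { (a , b) → true , _ ,
        r-then {p = parse #0 #1} (run-parse slots₀₁ (ι a)) (r-ret {n = 0})
        , accepted } }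

concatenate : PTime (bits ⊗ bits) bits (λ { (a , b) → just (a ++ b) })
concatenate = pTime $ program⇒TM record
  { depth = 1
  ; code = parse #0 #1 >> (pour #1 #0 >> ret true)
  ; bound = λ n → suc n * 4 + (suc n * 3 + 0)
  ; bounded = pb-+ (pb-linear 4) (pb-+ (pb-linear 3) (pb-const 0))
  ; correct = λ { (a , b) → true , _ ,
      r-then {p = parse #0 #1} (run-parse slots₀₁ a)
      (r-then {p = pour #1 #0} (run-pour slots₁₀ (a ʳ++ []) (≤-trans (≤-reflexive (length-rev a)) (enc2-longˡ a b)))
        (r-ret {n = 0}))
      , subst (λ o → Answer (just (a ++ b)) true (o ∷ [] ∷ [])) (sym (rev-rev a)) accepted } }

-- Two tests in one: `agree` with `false` compares for equality, and a constantly true `φ` with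
-- `true` compares lengths. The bit `e` is the verdict if the first string is the shorter one.
pointwise : (Bool → Bool → Bool) → Bool → Str → Str → Bool
pointwise φ e []      []      = true
pointwise φ e []      (_ ∷ _) = e
pointwise φ e (_ ∷ _) []      = false
pointwise φ e (a ∷ x) (b ∷ y) = φ a b ∧ pointwise φ e x y

guard : Bool → Maybe ⊤
guard true  = just tt
guard false = nothing

comparing : ∀ φ e → PTime (bits ⊗ bits) unit (λ { (a , b) → guard (pointwise φ e a b) })
comparing φ e = pTime $ program⇒TM record
  { depth = 2
  ; code = code
  ; bound = bound
  ; bounded = pb-+ (pb-linear 4) (pb-+ (pb-linear 3) (pb-+ (pb-linear 3) (pb-+ (pb-linear 2) (pb-const 0))))
  ; correct = λ { (a , b) → correct a b } }
  where
  continue : Bool → StackProg 3 (⊤ ⊎ Bool)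
  continue true  = ret (inj₁ tt)
  continue false = ret (inj₂ false)
  both : Maybe Bool → Maybe Bool → StackProg 3 (⊤ ⊎ Bool)
  both nothing  nothing  = ret (inj₂ true)
  both nothing  (just _) = ret (inj₂ e)
  both (just _) nothing  = ret (inj₂ false)
  both (just a) (just b) = continue (φ a b)
  scan : StackProg 3 Bool
  scan = loop enum-⊤ enum-Bool (λ _ → op (pop #2) λ a → op (pop #0) λ b → both a b) tt ret
  end : Bool → StackProg 3 Bool
  end true  = clear #0 >> ret true
  end false = ret false
  code : StackProg 3 Bool
  code = parse #0 #1 >> (pour #1 #2 >> (scan then end))
  bound : ℕ → ℕ
  bound n = suc n * 4 + (suc n * 3 + (suc n * 3 + (suc n * 2 + 0)))
  run-scan : ∀ a b → Σ Str λ a′ → Σ Str λ b′ → (length b′ ≤ length b) ×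
    Run scan (b ∷ [] ∷ a ∷ []) (suc (length a) * 3) (pointwise φ e a b) (b′ ∷ [] ∷ a′ ∷ [])
  run-scan []      []      = [] , [] , ≤-refl , r-stop {m = 2} (r-op (r-op r-ret)) r-ret
  run-scan []      (b ∷ y) = [] , y , n≤1+n _ , r-stop {m = 2} (r-op (r-op r-ret)) r-ret
  run-scan (a ∷ x) []      = x , [] , ≤-refl , weaken (s≤s (s≤s (s≤s z≤n)))
    (r-stop {m = 2} (r-op (r-op r-ret)) (r-ret {n = 0}))
  run-scan (a ∷ x) (b ∷ y) with φ a b in eq | run-scan x y
  ... | true  | x′ , y′ , le , run = x′ , y′ , ≤-trans le (n≤1+n _) ,
    r-go {m = 2} (r-op (r-op (subst (λ c → Run (continue c) _ _ _ _) (sym eq) r-ret))) run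
  ... | false | _ = x , y , n≤1+n _ , weaken (s≤s (s≤s (s≤s z≤n)))
    (r-stop {m = 2} (r-op (r-op (subst (λ c → Run (continue c) (y ∷ [] ∷ x ∷ []) 0 (inj₂ false) (y ∷ [] ∷ x ∷ []))
    (sym eq) r-ret))) (r-ret {n = 0}))
  correct : ∀ a b → Behaves code (enc2 a b) (bound (length (enc2 a b))) (Maybe.map unit (guard (pointwise φ e a b)))
  correct a b with run-scan a b
  ... | a′ , b′ , le , run = finish (pointwise φ e a b) run
    where
    n = length (enc2 a b)
    all : ∀ {c d S} → Run scan (b ∷ [] ∷ a ∷ []) (suc (length a) * 3) c (b′ ∷ [] ∷ a′ ∷ []) →
      Run (end c) (b′ ∷ [] ∷ a′ ∷ []) (suc n * 2 + 0) d S → Run code (enc2 a b ∷ [] ∷ [] ∷ []) (bound n) d S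
    all run run′ = r-then {p = parse #0 #1} (run-parse slots₀₁ a)
      (r-then {p = pour #1 #2} (run-unpour slots₁₂ a (enc2-longˡ a b))
      (r-then {p = scan} (weaken (*-monoˡ-≤ 3 (s≤s (enc2-longˡ a b))) run) run′))
    finish : ∀ c → Run scan (b ∷ [] ∷ a ∷ []) (suc (length a) * 3) c (b′ ∷ [] ∷ a′ ∷ []) →
      Behaves code (enc2 a b) (bound n) (Maybe.map unit (guard c))
    finish true  run = true , _ , all run (r-then {p = clear #0} (run-clear slot₀ b′ (≤-trans le (enc2-longʳ a b)))
      (r-ret {n = 0})) , accepted
    finish false run = false , _ , all run (r-ret {n = suc n * 2 + 0}) , rejected

-- Unary multiplication is the source of the polynomially long clocks and paddings. Every bit of `a`
-- lets `b` pass to `#3` and back, with one mark left on `#2` for each bit of `b`.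
multiply : PTime (bits ⊗ bits) bits (λ { (a , b) → just (replicate (length a * length b) true) })
multiply = pTime $ program⇒TM record
  { depth = 3
  ; code = code
  ; bound = bound
  ; bounded = pb-+ (pb-linear 4) (pb-+ (pb-* (pb-+ (pb-const 1) pb-id)
    (pb-* (pb-const 9) (pb-+ (pb-const 1) pb-id))) (pb-+ (pb-linear 2)
    (pb-+ (pb-* (pb-+ (pb-const 1) (pb-* pb-id pb-id)) (pb-const 3)) (pb-const 0))))
  ; correct = λ { (a , b) → true , _ ,
      r-then {p = parse #0 #1} (run-parse slots₀₁ a)
      (r-then {p = outer} (weaken (*-mono-≤ (s≤s (≤-trans (≤-reflexive (length-rev a)) (enc2-longˡ a b)))
        (*-monoʳ-≤ 9 (s≤s (enc2-longʳ a b)))) (run-outer (a ʳ++ []) b))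
      (r-then {p = clear #0} (run-clear slot₀ b (enc2-longʳ a b))
      (r-then {p = pour #2 #0} (run-pour slots₂₀ (ones (a ʳ++ []) b [])
        (≤-trans (≤-reflexive (trans (cong length (ones-count a b)) (List.length-replicate (length a * length b))))
        (*-mono-≤ (enc2-longˡ a b) (enc2-longʳ a b)))) (r-ret {n = 0}))))
      , subst (λ o → Answer (just (replicate (length a * length b) true)) true (o ∷ [] ∷ [] ∷ [] ∷ []))
          (sym (trans (cong (_ʳ++ []) (ones-count a b))
            (trans (replicate-ʳ++ (length a * length b) 0) (cong (λ m → replicate m true) (+-identityʳ _)))))
            accepted } }
  where
  tally : Maybe Bool → StackProg 4 (⊤ ⊎ ⊤)
  tally nothing  = ret (inj₂ tt)
  tally (just b) = op (push #3 b) λ _ → op (push #2 true) λ _ → ret (inj₁ tt)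
  inner : StackProg 4 ⊤
  inner = loop enum-⊤ enum-⊤ (λ _ → op (pop #0) tally) tt ret
  row : Maybe Bool → StackProg 4 (⊤ ⊎ ⊤)
  row nothing  = ret (inj₂ tt)
  row (just _) = inner >> (pour #3 #0 >> ret (inj₁ tt))
  outer : StackProg 4 ⊤
  outer = loop enum-⊤ enum-⊤ (λ _ → op (pop #1) row) tt ret
  code : StackProg 4 Bool
  code = parse #0 #1 >> (outer >> (clear #0 >> (pour #2 #0 >> ret true)))
  bound : ℕ → ℕ
  bound n = suc n * 4 + (suc n * (9 * suc n) + (suc n * 2 + (suc (n * n) * 3 + 0)))
  replicate-ʳ++ : ∀ m n → replicate m true ʳ++ replicate n true ≡ replicate (m + n) true
  replicate-ʳ++ zero    n = refl
  replicate-ʳ++ (suc m) n = trans (replicate-ʳ++ m (suc n)) (cong (λ k → replicate k true) (+-suc m n))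
  ones : Str → Str → Str → Str
  ones []      b c = c
  ones (_ ∷ a) b c = ones a b (replicate (length b) true ʳ++ c)
  ones-replicate : ∀ a b n → ones a b (replicate n true) ≡ replicate (length a * length b + n) true
  ones-replicate []      b n = refl
  ones-replicate (_ ∷ a) b n = trans (cong (ones a b) (replicate-ʳ++ (length b) n))
    (trans (ones-replicate a b (length b + n))
    (cong (λ k → replicate k true) (trans (sym (+-assoc (length a * length b) (length b) n))
      (cong (_+ n) (+-comm (length a * length b) (length b))))))
  ones-count : ∀ a b → ones (a ʳ++ []) b [] ≡ replicate (length a * length b) true
  ones-count a b = trans (ones-replicate (a ʳ++ []) b 0)
    (cong (λ k → replicate k true) (trans (+-identityʳ _) (cong (_* length b) (length-rev a))))
  run-inner : ∀ b {a c d} → Run inner (b ∷ a ∷ c ∷ d ∷ []) (suc (length b) * 4) tt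
    ([] ∷ a ∷ (replicate (length b) true ʳ++ c) ∷ (b ʳ++ d) ∷ [])
  run-inner []      = weaken (s≤s (s≤s z≤n)) (r-stop {m = 1} (r-op r-ret) r-ret)
  run-inner (_ ∷ b) = r-go {m = 3} (r-op (r-op (r-op r-ret))) (run-inner b)
  small : ∀ n → 2 + (7 + 9 * n) ≡ 1 * (9 * suc n)
  small = solve-∀
  run-outer : ∀ a b {c} → Run outer (b ∷ a ∷ c ∷ [] ∷ []) (suc (length a) * (9 * suc (length b))) tt
    (b ∷ [] ∷ ones a b c ∷ [] ∷ [])
  run-outer []      b = weaken (≤-trans (m≤m+n 2 (7 + 9 * length b)) (≤-reflexive (small (length b))))
    (r-stop {m = 1} (r-op r-ret) r-ret)
  run-outer (x ∷ a) b {c} = weaken (≤-trans (m≤m+n _ (2 * length b))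
    (≤-reflexive (arith (length b) (suc (length a) * (9 * suc (length b))))))
    (r-go {m = 1 + (suc (length b) * 4 + (suc (length b) * 3 + 0))}
      (r-op (r-then {p = inner} (run-inner b) (r-then {p = pour #3 #0} (run-unpour slots₃₀ b ≤-refl)
      (r-ret {n = 0})))) (run-outer a b))
    where
    arith : ∀ n r → suc (suc (suc n * 4 + (suc n * 3 + 0)) + r) + 2 * n ≡ 9 * suc n + r
    arith = solve-∀

power : ∀ k → PTime bits bits (λ x → just (replicate (length x ^ k) true))
power zero    = constant {κ = bits} (true ∷ [])
power (suc k) = pTime-cong (λ x → cong (λ m → just (replicate (length x * m) true))
  (List.length-replicate (length x ^ k)))
  (compose {ι = bits} {κ = bits ⊗ bits} {μ = bits} (fork {ι = bits} {κ = bits} {μ = bits} identity (power k)) multiply)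

unary : ∀ k → PTime bits bits (λ x → just (replicate (poly k (length x)) true))
unary k = pTime-cong (λ x → cong just (trans (replicate-++ k (length x ^ k))
  (cong (λ m → replicate m true) (+-comm k _))))
  (compose {κ = bits} {μ = bits} (power k) (prepend {ι = bits} {κ = bits}
    (replicate k true) {h = λ y → replicate k true ++ y} (λ _ → refl)))
  where
  replicate-++ : ∀ m n → replicate m true ++ replicate n true ≡ replicate (m + n) true
  replicate-++ zero    n = refl
  replicate-++ (suc m) n = cong (true ∷_) (replicate-++ m n)

module _ (pr : Pairing) where
  open Pairing pr

  pair-PTime : PTime (bits ⊗ bits) bits (λ (a , b) → just (pair a b))
  pair-PTime = let M , k , runs = pair-FP in pTime $ M , k , λ (a , b) → exec-mono M {x = enc2 a b} (poly-mono k (shorter a b)) (runs a b)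
    where
    shorter : ∀ a b → length a + length b ≤ length (enc2 a b)
    shorter a b = ≤-trans (+-mono-≤ (m≤m*n (length a) 2) (m≤n+m (length b) 2)) (≤-reflexive (sym (length-enc2 a b)))

-- The universal verifier

-- Rules of a table are lists of three-bit instructions on a coded tape, closed by 000. The tape is
-- a pair of stacks that are continued by zeros.
data Instr : Set where
  accept fromLeft toLeft : Instr
  match write            : Bool → Instr

decode : Bool → Bool → Bool → Maybe Instr
decode false false false = nothing
decode false false true  = just accept
decode false true  false = just fromLeft
decode false true  true  = just toLeft
decode true  false b     = just (match b)
decode true  true  b     = just (write b)

top₂ : Str → Bool
top₂ []      = false
top₂ (b ∷ _) = b

rest₂ : Str → Str
rest₂ []      = []
rest₂ (_ ∷ s) = s

data Effect : Set where
  failed accepts : Effect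
  next           : Str → Str → Effect

matched : Bool → Str → Str → Effect
matched true  l r = next l r
matched false l r = failed

effect : Instr → Str → Str → Effect
effect accept    l r = accepts
effect fromLeft  l r = next (rest₂ l) (top₂ l ∷ r)
effect toLeft    l r = next (top₂ r ∷ l) (rest₂ r)
effect (match b) l r = matched (agree b (top₂ r)) l (rest₂ r)
effect (write b) l r = next l (b ∷ r)

skipRule : Str → Maybe Str
skipRule (a ∷ b ∷ c ∷ t) with decode a b c
... | nothing = just t
... | just _  = skipRule t
skipRule _ = nothing

execRule : Str → Str → Str → Effect
execRule (a ∷ b ∷ c ∷ t) l r with decode a b c
... | nothing = next l r
... | just i with effect i l r
...   | failed     = failed
...   | accepts    = accepts
...   | next l′ r′ = execRule t l′ r′
execRule _ l r = failed

-- The witness w steers a pointer t₂ into the rule table t: 0 skips a rule, 1 executes one at the cost of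
-- one bit of the clock p and rewinds.
verifies : Str → (w p t₂ l r : Str) → Bool
verifies t []          p       t₂ l r = false
verifies t (false ∷ w) p       t₂ l r with skipRule t₂
... | nothing  = false
... | just t₂′ = verifies t w p t₂′ l r
verifies t (true ∷ w)  []      t₂ l r = false
verifies t (true ∷ w)  (_ ∷ p) t₂ l r with execRule t₂ l r
... | failed     = false
-- A witness must end here. Otherwise it could be continued at will, and no bound on the factors of
-- a product would hold.
... | accepts    = null w
... | next l′ r′ = verifies t w p t l′ r′

Prog₇ : Set → Set₁
Prog₇ = StackProg 7

-- The table is split at the pointer, with the part already passed reversed on `t₁`; rewinding is
-- pouring it back, and `t₁ ʳ++ t₂` is invariant. The query `x` is kept because it is part of the
-- product.
store : (x t₁ t₂ p w r l : Str) → Vec Str 7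
store x t₁ t₂ p w r l = x ∷ t₁ ∷ t₂ ∷ p ∷ w ∷ r ∷ l ∷ []

fetch : ∀ {E} → Prog₇ E → (Maybe Instr → Prog₇ E) → Prog₇ E
fetch none k =
  bit λ a → bit λ b → bit λ c → k (decode a b c)
  where
  bit : (Bool → Prog₇ _) → Prog₇ _
  bit k = op (pop #2) λ { nothing → none ; (just b) → op (push #1 b) λ _ → k b }

skipNext : Maybe Instr → Prog₇ (⊤ ⊎ Bool)
skipNext nothing  = ret (inj₂ true)
skipNext (just _) = ret (inj₁ tt)

skipping : Prog₇ Bool
skipping = loop enum-⊤ enum-Bool (λ _ → fetch (ret (inj₂ false)) skipNext) tt ret

pull : ∀ {E} → Fin 7 → (Bool → Prog₇ E) → Prog₇ E
pull i k = op (pop i) λ b → k (fromMaybe false b)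

verdict : Bool → Prog₇ (⊤ ⊎ Maybe Bool)
verdict true  = ret (inj₁ tt)
verdict false = ret (inj₂ nothing)

perform : Instr → Prog₇ (⊤ ⊎ Maybe Bool)
perform accept    = ret (inj₂ (just true))
perform fromLeft  = pull #6 λ b → op (push #5 b) λ _ → ret (inj₁ tt)
perform toLeft    = pull #5 λ b → op (push #6 b) λ _ → ret (inj₁ tt)
perform (match b) = pull #5 λ c → verdict (agree b c)
perform (write b) = op (push #5 b) λ _ → ret (inj₁ tt)

obey : Maybe Instr → Prog₇ (⊤ ⊎ Maybe Bool)
obey nothing  = ret (inj₂ (just false))
obey (just i) = perform i

executing : Prog₇ (Maybe Bool)
executing = loop enum-⊤ (enum-Maybe enum-Bool) (λ _ → fetch (ret (inj₂ nothing)) obey) tt ret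

skipped : Bool → Prog₇ (⊤ ⊎ Bool)
skipped true  = ret (inj₁ tt)
skipped false = ret (inj₂ false)

atEnd : Maybe Bool → Prog₇ (⊤ ⊎ Bool)
atEnd nothing  = ret (inj₂ true)
atEnd (just _) = ret (inj₂ false)

executed : Maybe Bool → Prog₇ (⊤ ⊎ Bool)
executed nothing      = ret (inj₂ false)
executed (just true)  = op (pop #4) atEnd
executed (just false) = pour #1 #2 >> ret (inj₁ tt)

ticked : Maybe Bool → Prog₇ (⊤ ⊎ Bool)
ticked nothing  = ret (inj₂ false)
ticked (just _) = executing then executed

steered : Maybe Bool → Prog₇ (⊤ ⊎ Bool)
steered nothing      = ret (inj₂ false)
steered (just false) = skipping then skipped
steered (just true)  = op (pop #3) ticked

verifying : Prog₇ Bool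
verifying = loop enum-⊤ enum-Bool (λ _ → op (pop #4) steered) tt ret

module _ (x : Str) where

  -- Only the query on `#0` has to survive the verification.
  Keeps : ∀ {E} → Prog₇ E → Vec Str 7 → ℕ → E → Set₁
  Keeps q S n e = Σ (Vec Str 6) λ ρ → Run q S n e (x ∷ ρ)

  run-fetch : ∀ {E none} (k : Maybe Instr → Prog₇ E) a b c {i t t₁ p w r l n z} {e : E} → decode a b c ≡ i →
    Run (k i) (store x (c ∷ b ∷ a ∷ t₁) t p w r l) n e z →
    Run (fetch none k) (store x t₁ (a ∷ b ∷ c ∷ t) p w r l) (6 + n) e z
  run-fetch k a b c refl run = r-op (r-op (r-op (r-op (r-op (r-op run)))))

  run-fetch-none : ∀ {E} (k : Maybe Instr → Prog₇ E) t {t₁ p w r l} {e : E} → length t < 3 →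
    Keeps (fetch (ret e) k) (store x t₁ t p w r l) 6 e
  run-fetch-none k []              _ = _ , r-op r-ret
  run-fetch-none k (a ∷ [])        _ = _ , r-op (r-op (r-op r-ret))
  run-fetch-none k (a ∷ b ∷ [])    _ = _ , r-op (r-op (r-op (r-op (r-op r-ret))))
  run-fetch-none k (_ ∷ _ ∷ _ ∷ _) (s≤s (s≤s (s≤s ())))

  private
    slow : ∀ {n} m → n ≤ 9 → n ≤ suc m * 9
    slow m le = ≤-trans le (m≤m+n 9 (m * 9))

    ≤⁺ : ∀ {m} n → m ≤ n + m
    ≤⁺ n = m≤n+m _ n

  run-skipping : ∀ t₂ {t₁ p w r l t₂′} → skipRule t₂ ≡ just t₂′ →
    Σ Str λ t₁′ → (t₁′ ʳ++ t₂′ ≡ t₁ ʳ++ t₂) × Run skipping (store x t₁ t₂ p w r l) (suc (length t₂) * 9) true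
      (store x t₁′ t₂′ p w r l)
  run-skipping (a ∷ b ∷ c ∷ t) {t₁} eq with decode a b c in d
  run-skipping (a ∷ b ∷ c ∷ t) {t₁} refl | nothing = c ∷ b ∷ a ∷ t₁ , refl ,
    weaken (slow (3 + length t) (≤⁺ 2)) (r-stop {m = 6} (run-fetch skipNext a b c d (r-ret {n = 0})) (r-ret {n = 0}))
  run-skipping (a ∷ b ∷ c ∷ t) {t₁} eq | just i with run-skipping t {c ∷ b ∷ a ∷ t₁} eq
  ... | t₁′ , inv , run = t₁′ , inv , weaken (≤⁺ 20) (r-go {m = 6} (run-fetch skipNext a b c d (r-ret {n = 0})) run)

  run-skipping-off : ∀ t₂ {t₁ p w r l} → skipRule t₂ ≡ nothing →
    Keeps skipping (store x t₁ t₂ p w r l) (suc (length t₂) * 9) false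
  run-skipping-off t@[] eq with run-fetch-none skipNext t (s≤s z≤n)
  ... | _ , run = _ , weaken (slow 0 (≤⁺ 2)) (r-stop run (r-ret {n = 0}))
  run-skipping-off t@(a ∷ []) eq with run-fetch-none skipNext t (s≤s (s≤s z≤n))
  ... | _ , run = _ , weaken (slow 1 (≤⁺ 2)) (r-stop run (r-ret {n = 0}))
  run-skipping-off t@(a ∷ b ∷ []) eq with run-fetch-none skipNext t (s≤s (s≤s (s≤s z≤n)))
  ... | _ , run = _ , weaken (slow 2 (≤⁺ 2)) (r-stop run (r-ret {n = 0}))
  run-skipping-off (a ∷ b ∷ c ∷ t) {t₁} eq with decode a b c in d
  ... | just i with run-skipping-off t {c ∷ b ∷ a ∷ t₁} eq
  ...   | _ , run = _ , weaken (≤⁺ 20) (r-go {m = 6} (run-fetch skipNext a b c d (r-ret {n = 0})) run)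

  data Executes (t p w : Str) : Effect → Maybe Bool → Vec Str 7 → Set where
    failing   : ∀ {ρ} → Executes t p w failed nothing (x ∷ ρ)
    accepting : ∀ {t₁ t₂ r l} → Executes t p w accepts (just true) (store x t₁ t₂ p w r l)
    going     : ∀ {t₁ t₂ r l} → t₁ ʳ++ t₂ ≡ t → Executes t p w (next l r) (just false) (store x t₁ t₂ p w r l)

  pull-top : ∀ {E} (k : Bool → Prog₇ E) {i S} → Slot i S → ∀ s {n z} {e : E} → Run (k (top₂ s)) (S (rest₂ s)) n e z →
    Run (pull i k) (S s) (suc n) e z
  pull-top k (slot nil cons) []      run = step-by nil run
  pull-top k (slot nil cons) (_ ∷ _) run = step-by (cons _ _) run

  run-perform-next : ∀ i {l r l′ r′ t₁ t₂ p w} → effect i l r ≡ next l′ r′ →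
    Run (perform i) (store x t₁ t₂ p w r l) 2 (inj₁ tt) (store x t₁ t₂ p w r′ l′)
  run-perform-next fromLeft {l} {r} {t₁ = t₁} {t₂} {p} {w} refl = pull-top
    (λ b → op (push #5 b) λ _ → ret (inj₁ tt)) slot₆ l (r-op r-ret)
  run-perform-next toLeft {l} {r} {t₁ = t₁} {t₂} {p} {w} refl = pull-top
    (λ b → op (push #6 b) λ _ → ret (inj₁ tt)) slot₅ r (r-op r-ret)
  run-perform-next (write b) refl = r-op r-ret
  run-perform-next (match b) {l} {r} {t₁ = t₁} {t₂} {p} {w} eq = pull-top (λ c → verdict (agree b c)) slot₅ r
    (test (agree b (top₂ r)) eq)
    where
    test : ∀ c {l r l′ r′ t₁ t₂ p w} → matched c l r ≡ next l′ r′ →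
      Run (verdict c) (store x t₁ t₂ p w r l) 1 (inj₁ tt) (store x t₁ t₂ p w r′ l′)
    test true refl = r-ret

  run-perform-failed : ∀ i {l r t₁ t₂ p w} → effect i l r ≡ failed →
    Keeps (perform i) (store x t₁ t₂ p w r l) 2 (inj₂ nothing)
  run-perform-failed (match b) {l} {r} {t₁} {t₂} {p} {w} eq = _ ,
    pull-top (λ c → verdict (agree b c)) slot₅ r (test (agree b (top₂ r)) eq)
    where
    test : ∀ c {l r t₁ t₂ p w} → matched c l r ≡ failed →
      Run (verdict c) (store x t₁ t₂ p w r l) 1 (inj₂ nothing) (store x t₁ t₂ p w r l)
    test false refl = r-ret

  run-perform-accepts : ∀ i {l r t₁ t₂ p w} → effect i l r ≡ accepts →
    Run (perform i) (store x t₁ t₂ p w r l) 2 (inj₂ (just true)) (store x t₁ t₂ p w r l)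
  run-perform-accepts accept refl = r-ret
  run-perform-accepts (match b) {r = r} eq with agree b (top₂ r)
  run-perform-accepts (match b) () | true
  run-perform-accepts (match b) () | false

  Execution : (t₁ t₂ p w r l : Str) → Set₁
  Execution t₁ t₂ p w r l = Σ (Maybe Bool) λ b → Σ (Vec Str 7) λ S →
    Run executing (store x t₁ t₂ p w r l) (suc (length t₂) * 9) b S × Executes (t₁ ʳ++ t₂) p w (execRule t₂ l r) b S

  run-executing : ∀ t₂ {t₁ p w r l} → Execution t₁ t₂ p w r l
  run-executing t@[] with run-fetch-none obey t (s≤s z≤n)
  ... | _ , run = _ , _ , weaken (slow 0 (≤⁺ 2)) (r-stop run (r-ret {n = 0})) , failing
  run-executing t@(a ∷ []) with run-fetch-none obey t (s≤s (s≤s z≤n))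
  ... | _ , run = _ , _ , weaken (slow 1 (≤⁺ 2)) (r-stop run (r-ret {n = 0})) , failing
  run-executing t@(a ∷ b ∷ []) with run-fetch-none obey t (s≤s (s≤s (s≤s z≤n)))
  ... | _ , run = _ , _ , weaken (slow 2 (≤⁺ 2)) (r-stop run (r-ret {n = 0})) , failing
  run-executing (a ∷ b ∷ c ∷ t) {t₁} {r = r} {l} with decode a b c in d
  ... | nothing = _ , _ , weaken (slow (3 + length t) (≤⁺ 2))
    (r-stop {m = 6} (run-fetch obey a b c d (r-ret {n = 0})) (r-ret {n = 0})) , going refl
  ... | just i with effect i l r in eff
  ...   | failed = _ , _ , weaken (slow (3 + length t) ≤-refl)
      (r-stop {m = 8} (run-fetch obey a b c d (proj₂ (run-perform-failed i eff))) (r-ret {n = 0})) , failing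
  ...   | accepts = _ , _ , weaken (slow (3 + length t) ≤-refl)
      (r-stop {m = 8} (run-fetch obey a b c d (run-perform-accepts i eff)) (r-ret {n = 0})) , accepting
  ...   | next l′ r′ with run-executing t {c ∷ b ∷ a ∷ t₁} {r = r′} {l′}
  ...     | b′ , S , run , ex = b′ , S , weaken (≤⁺ 18)
    (r-go {m = 8} (run-fetch obey a b c d (run-perform-next i eff)) run) , ex

  run-verifying : ∀ t w p {t₁ t₂ r l} → t₁ ʳ++ t₂ ≡ t →
    Keeps verifying (store x t₁ t₂ p w r l) (suc (length w) * (suc (length t) * 15)) (verifies t w p t₂ l r)
  run-verifying t = run
    where
    -- One iteration takes at most `suc (length t) * 9` for skipping or executing,
    -- `suc (length t) * 3` for rewinding, and two steps for the bits of the witness and the clock.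
    -- `suc round` is `suc (length t) * 15`.
    round : ℕ
    round = 14 + length t * 15
    fit : ∀ {a b} → a ≤ suc (length t) * 9 → b ≤ suc (length t) * 3 → 2 + (a + (b + 0)) ≤ round
    fit {a} {b} le le′ = ≤-trans (s≤s (s≤s (+-mono-≤ le (+-monoˡ-≤ 0 le′))))
      (≤-trans (m≤m+n _ (length t * 3)) (≤-reflexive (arith (length t))))
      where
      arith : ∀ n → 2 + (suc n * 9 + (suc n * 3 + 0)) + n * 3 ≡ 14 + n * 15
      arith = solve-∀
    within : ∀ {t₁ t₂ : Str} → t₁ ʳ++ t₂ ≡ t → (length t₁ ≤ length t) × (length t₂ ≤ length t)
    within {t₁} {t₂} refl rewrite List.length-ʳ++ t₁ {t₂} = m≤m+n _ _ , m≤n+m _ _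
    quick : ∀ {m} w → m ≤ 15 → m ≤ suc w * (suc (length t) * 15)
    quick w le = ≤-trans le (≤-trans (m≤m+n 15 (length t * 15)) (m≤m+n _ _))
    finished : ∀ {w S b} → Keeps (op (pop #4) steered) S round (inj₂ b) →
      Keeps verifying S (suc w * (suc (length t) * 15)) b
    finished {w} (_ , body) = _ , weaken (≤-trans (≤-reflexive (cong suc (+-identityʳ round)))
      (m≤m+n _ (w * (suc (length t) * 15)))) (r-stop body (r-ret {n = 0}))
    run : ∀ w p {t₁ t₂ r l} → t₁ ʳ++ t₂ ≡ t →
      Keeps verifying (store x t₁ t₂ p w r l) (suc (length w) * (suc (length t) * 15)) (verifies t w p t₂ l r)
    run [] p inv = _ , weaken (quick 0 (m≤n+m 2 13)) (r-stop {m = 1} (r-op r-ret) (r-ret {n = 0}))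
    run (false ∷ w) p {t₁} {t₂} inv with skipRule t₂ in eq
    ... | nothing with run-skipping-off t₂ eq
    ...   | _ , off = finished {suc (length w)} (_ , weaken
      (≤-trans (s≤s (n≤1+n _)) (fit {b = 0} (*-monoˡ-≤ 9 (s≤s (proj₂ (within {t₁} {t₂} inv)))) z≤n))
      (r-op (r-then {p = skipping} off r-ret)))
    run (false ∷ w) p {t₁} {t₂} inv | just t₂′ with run-skipping t₂ eq
    ...   | t₁′ , inv′ , on with run w p {t₁′} {t₂′} (trans inv′ inv)
    ...     | _ , rec = _ , r-go {m = round} (weaken (≤-trans (s≤s (n≤1+n _))
      (fit {b = 0} (*-monoˡ-≤ 9 (s≤s (proj₂ (within {t₁} {t₂} inv)))) z≤n)) (r-op (r-then {p = skipping} on r-ret))) rec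
    run (true ∷ w) [] inv = _ , weaken (quick (suc (length w)) (m≤n+m 3 12))
      (r-stop {m = 2} (r-op (r-op r-ret)) (r-ret {n = 0}))
    run (true ∷ w) (c ∷ p) {t₁} {t₂} {r} {l} inv with execRule t₂ l r | run-executing t₂ {t₁} {p} {w} {r} {l}
    ... | failed | _ , _ , ex , failing = finished {suc (length w)}
      (_ , weaken (fit {b = 0} (*-monoˡ-≤ 9 (s≤s (proj₂ (within {t₁} {t₂} inv)))) z≤n)
      (r-op (r-op (r-then {p = executing} ex r-ret))))
    ... | accepts | _ , _ , ex , accepting = finished {suc (length w)} (end w ex)
      where
      end : ∀ w {w′ t₁′ t₂′ r′ l′} → Run executing (store x t₁ t₂ p w′ r l) (suc (length t₂) * 9) (just true)
        (store x t₁′ t₂′ p w r′ l′) →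
        Keeps (op (pop #4) steered) (store x t₁ t₂ (c ∷ p) (true ∷ w′) r l) round (inj₂ (null w))
      end [] ex = _ , weaken (fit {b = 1} (*-monoˡ-≤ 9 (s≤s (proj₂ (within {t₁} {t₂} inv)))) (s≤s z≤n))
        (r-op (r-op (r-then {p = executing} ex (r-op r-ret))))
      end (_ ∷ _) ex = _ , weaken (fit {b = 1} (*-monoˡ-≤ 9 (s≤s (proj₂ (within {t₁} {t₂} inv)))) (s≤s z≤n))
        (r-op (r-op (r-then {p = executing} ex (r-op r-ret))))
    ... | next l′ r′ | _ , _ , ex , going {t₁′} {t₂′} inv′ with run w p {[]} {t} {r′} {l′} refl
    ...   | _ , rec = _ , r-go {m = round}
      (weaken (fit (*-monoˡ-≤ 9 (s≤s (proj₂ (within {t₁} {t₂} inv))))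
        (*-monoˡ-≤ 3 (s≤s (proj₁ (within {t₁′} {t₂′} (trans inv′ inv))))))
        (r-op (r-op (r-then {p = executing} ex (r-then {p = pour #1 #2}
          (subst (λ y → Run (pour #1 #2) (store x t₁′ t₂′ p w r′ l′) (suc (length t₁′) * 3) tt
            (store x [] y p w r′ l′)) (trans inv′ inv)
            (run-pour slots₁₂ t₁′ ≤-refl)) r-ret))))) rec

-- The product

-- A query x is a rule table, an initial coded tape and a clock.
checks : Str → Str → Bool
checks x w = verifies t w p t [] r
  where
  t = proj₂ (parsed x []) ʳ++ []
  p = proj₁ (parsed (proj₁ (parsed x [])) [])
  r = proj₂ (parsed (proj₁ (parsed x [])) []) ʳ++ []

data Tag : Set where
  inert query witness : Tag
  atom                : Bool → Tag

-- The arguments are the results of two pops, where `nothing` stands for an exhausted string.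
classify : Maybe Bool → Maybe Bool → Tag
classify nothing      _            = inert
classify (just b)     nothing      = atom b
classify (just true)  (just false) = query
classify (just true)  (just true)  = witness
classify (just false) (just _)     = inert

tag : Str → Tag
tag []          = inert
tag (a ∷ [])    = atom a
tag (a ∷ b ∷ _) = classify (just a) (just b)

-- Two strings 10x and 11w with a witness w for x have the product 00x, whose products with further strings are z. Hence
-- only the operation on strings of length one matters for commutativity and associativity.
module Product (z : Maybe Str) (_·_ : Bool → Bool → Bool) where

  outcome : Bool → Str → Maybe Str
  outcome true  x = just (false ∷ false ∷ x)
  outcome false x = z

  combine : Tag → Tag → Str → Str → Maybe Str
  combine (atom a) (atom b) _ _ = just ((a · b) ∷ [])
  combine query    witness  x w = outcome (checks x w) x
  combine witness  query    w x = outcome (checks x w) x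
  combine _        _        _ _ = z

  σ : Fn2
  σ u v = combine (tag u) (tag v) (drop 2 u) (drop 2 v)

parsed-short : ∀ s d → (length (proj₁ (parsed s d)) ≤ length s) × (length (proj₂ (parsed s d)) ≤ length s + length d)
parsed-short [] d = z≤n , ≤-refl
parsed-short (true ∷ []) d = z≤n , n≤1+n _
parsed-short (false ∷ []) d = z≤n , n≤1+n _
parsed-short (true ∷ false ∷ s) d = m≤n+m _ 2 , m≤n+m _ (2 + length s)
parsed-short (false ∷ true ∷ s) d = m≤n+m _ 2 , m≤n+m _ (2 + length s)
parsed-short (true ∷ true ∷ s) d with parsed-short s (true ∷ d)
... | l , r = ≤-trans l (m≤n+m _ 2) , ≤-trans r (≤-trans (≤-reflexive (+-suc (length s) (length d))) (n≤1+n _))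
parsed-short (false ∷ false ∷ s) d with parsed-short s (false ∷ d)
... | l , r = ≤-trans l (m≤n+m _ 2) , ≤-trans r (≤-trans (≤-reflexive (+-suc (length s) (length d))) (n≤1+n _))

module ProductProgram (total : Bool) (_·_ : Bool → Bool → Bool) where
  z : Maybe Str
  z = if total then just [] else nothing

  open Product z _·_

  private
    default : Prog₇ Bool
    default = clear #0 >> ret total

    swap : Prog₇ ⊤
    swap = pour #0 #1 >> (pour #4 #2 >> (pour #1 #4 >> pour #2 #0))

    conclude : Bool → Prog₇ Bool
    conclude true  = op (push #0 false) λ _ → op (push #0 false) λ _ → ret true
    conclude false = default

    check : Prog₇ Bool
    -- The query stays on `#0`. Its copy on `#3` is parsed twice, giving the table on `#2` and the
    -- tape on `#5`; what remains on `#3` is the clock.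
    check = copy >> (parse #3 #1 >> (pour #1 #2 >> (parse #3 #1 >> (pour #1 #5 >> (verifying then conclude)))))

    dispatch : Tag → Tag → Prog₇ Bool
    dispatch (atom a) (atom b) = clear #0 >> op (push #0 (a · b)) λ _ → ret true
    -- `check` expects the query on `#0` and the witness on `#4`, where the second and the first
    -- factor lie.
    dispatch query    witness  = swap >> check
    dispatch witness  query    = check
    dispatch _        _        = default

    tagOf : Fin 7 → (Tag → Prog₇ Bool) → Prog₇ Bool
    tagOf i k = op (pop i) λ a → op (pop i) λ b → k (classify a b)

    code : Prog₇ Bool
    code = parse #0 #1 >> (pour #1 #4 >> tagOf #4 (λ a → tagOf #0 (dispatch a)))

    run-tagOf : ∀ k {i S} → Slot i S → ∀ s {n b y} → Run (k (tag s)) (S (drop 2 s)) n b y →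
      Run (tagOf i k) (S s) (2 + n) b y
    run-tagOf k (slot nil cons) []          run = step-by nil (step-by nil run)
    run-tagOf k (slot nil cons) (a ∷ [])    run = step-by (cons _ _) (step-by nil run)
    run-tagOf k (slot nil cons) (a ∷ b ∷ s) run = step-by (cons _ _) (step-by (cons _ _) run)

    last-time check-time time : ℕ → ℕ
    last-time n = suc n * 2 + 2
    check-time n = suc n * 7 + (suc n * 4 + (suc n * 3 +
      (suc n * 4 + (suc n * 3 + (suc n * (suc n * 15) + last-time n)))))
    time n = suc n * 4 + (suc n * 3 + (4 + ((suc n * 3 + (suc n * 3 + (suc n * 3 + suc n * 3))) + check-time n)))

    Ends : Prog₇ Bool → Vec Str 7 → ℕ → Maybe Str → Set₁
    Ends q S n r = Σ Bool λ b → Σ (Vec Str 7) λ S′ → Run q S n b S′ × Answer r b S′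

    run-default : ∀ {s ρ n} → length s ≤ n → Ends default (s ∷ ρ) (last-time n) z
    run-default {s} {ρ} {n} le = total , _ , r-then {p = clear #0} (run-clear slot₀ s le) r-ret , ans total
      where
      ans : ∀ t → Answer (if t then just [] else nothing) t ([] ∷ ρ)
      ans true  = accepted
      ans false = rejected

    run-check : ∀ x w {n} → length x ≤ n → length w ≤ n →
      Ends check (store x [] [] [] w [] []) (check-time n) (outcome (checks x w) x)
    run-check x w {n} x≤ w≤ with run-verifying x t w p {[]} {t} {r} {[]} refl
      where
      t = proj₂ (parsed x []) ʳ++ []
      p = proj₁ (parsed (proj₁ (parsed x [])) [])
      r = proj₂ (parsed (proj₁ (parsed x [])) []) ʳ++ []
    ... | ρ , run = finish (checks x w) run
      where
      x₁ = proj₁ (parsed x [])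
      t′ = proj₂ (parsed x [])
      t = t′ ʳ++ []
      p = proj₁ (parsed x₁ [])
      r′ = proj₂ (parsed x₁ [])
      r = r′ ʳ++ []
      short₁ = parsed-short x []
      short₂ = parsed-short x₁ []
      x₁≤ : length x₁ ≤ n
      x₁≤ = ≤-trans (proj₁ short₁) x≤
      t′≤ : length t′ ≤ n
      t′≤ = ≤-trans (proj₂ short₁) (≤-trans (≤-reflexive (+-identityʳ _)) x≤)
      r′≤ : length r′ ≤ n
      r′≤ = ≤-trans (proj₂ short₂) (≤-trans (≤-reflexive (+-identityʳ _)) x₁≤)
      before-end : ∀ {c b S} → Run verifying (store x [] t p w r []) (suc (length w) * (suc (length t) * 15)) c
        (x ∷ ρ) →
        Run (conclude c) (x ∷ ρ) (last-time n) b S → Run check (store x [] [] [] w [] []) (check-time n) b S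
      before-end run run′ =
        r-then {p = copy} (weaken (*-monoˡ-≤ 7 (s≤s x≤)) (run-copy x))
        (r-then {p = parse #3 #1} (weaken (*-monoˡ-≤ 4 (s≤s x≤)) (run-parsed slots₃₁ x))
        (r-then {p = pour #1 #2} (run-pour slots₁₂ t′ t′≤)
        (r-then {p = parse #3 #1} (weaken (*-monoˡ-≤ 4 (s≤s x₁≤)) (run-parsed slots₃₁ x₁))
        (r-then {p = pour #1 #5} (run-pour slots₁₅ r′ r′≤)
        (r-then {p = verifying} (weaken (*-mono-≤ (s≤s w≤)
          (*-monoˡ-≤ 15 (s≤s (≤-trans (≤-reflexive (length-rev t′)) t′≤)))) run) run′)))))
      finish : ∀ c → Run verifying (store x [] t p w r []) (suc (length w) * (suc (length t) * 15)) c (x ∷ ρ) →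
        Ends check (store x [] [] [] w [] []) (check-time n) (outcome c x)
      finish true run = true , _ , before-end run (weaken (m≤n+m 2 (suc n * 2)) (r-op (r-op (r-ret {n = 0})))) ,
        accepted
      finish false run with run-default {x} {ρ} x≤
      ... | _ , _ , run′ , ans = _ , _ , before-end run run′ , ans

    run-swap : ∀ x w {n} → length x ≤ n → length w ≤ n →
      Run swap (store w [] [] [] x [] []) (suc n * 3 + (suc n * 3 + (suc n * 3 + suc n * 3))) tt
        (store x [] [] [] w [] [])
    run-swap x w x≤ w≤ =
      r-then {p = pour #0 #1} (run-pour slots₀₁ w w≤)
      (r-then {p = pour #4 #2} (run-pour slots₄₂ x x≤)
      (r-then {p = pour #1 #4} (run-unpour slots₁₄ w w≤) (run-unpour slots₂₀ x x≤)))

    run-dispatch : ∀ a b s s′ {n} → length s ≤ n → length s′ ≤ n →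
      Ends (dispatch a b) (store s′ [] [] [] s [] []) ((suc n * 3 + (suc n * 3 + (suc n * 3 + suc n * 3))) +
        check-time n) (combine a b s s′)
    run-dispatch a b s s′ {n} s≤ s′≤ = cases a b
      where
      later : ∀ {q S r} → Ends q S (last-time n) r → Ends q S
        ((suc n * 3 + (suc n * 3 + (suc n * 3 + suc n * 3))) + check-time n) r
      later (_ , _ , run , ans) = _ , _ , weaken (≤-trans (≤-trans (m≤n+m (last-time n) (suc n * (suc n * 15)))
        (≤-trans (m≤n+m _ (suc n * 3)) (≤-trans (m≤n+m _ (suc n * 4))
          (≤-trans (m≤n+m _ (suc n * 3)) (≤-trans (m≤n+m _ (suc n * 4)) (m≤n+m _ (suc n * 7)))))))
          (m≤n+m (check-time n) (suc n * 3 + (suc n * 3 + (suc n * 3 + suc n * 3))))) run , ans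
      cases : ∀ a b → Ends (dispatch a b) (store s′ [] [] [] s [] [])
        ((suc n * 3 + (suc n * 3 + (suc n * 3 + suc n * 3))) + check-time n) (combine a b s s′)
      cases (atom a) (atom b) = later (true , _ , r-then {p = clear #0} (run-clear slot₀ s′ s′≤)
        (weaken (s≤s z≤n) (r-op (r-ret {n = 0}))) , accepted)
      cases query    witness with run-check s s′ s≤ s′≤
      ... | _ , _ , run , ans = _ , _ , r-then {p = swap} (run-swap s s′ s≤ s′≤) run , ans
      cases witness  query with run-check s′ s s′≤ s≤
      ... | _ , _ , run , ans = _ , _ , weaken (m≤n+m (check-time n)
        (suc n * 3 + (suc n * 3 + (suc n * 3 + suc n * 3)))) run , ans
      cases inert    inert    = later (run-default s′≤)
      cases inert    query    = later (run-default s′≤)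
      cases inert    witness  = later (run-default s′≤)
      cases inert    (atom _) = later (run-default s′≤)
      cases query    inert    = later (run-default s′≤)
      cases query    query    = later (run-default s′≤)
      cases query    (atom _) = later (run-default s′≤)
      cases witness  inert    = later (run-default s′≤)
      cases witness  witness  = later (run-default s′≤)
      cases witness  (atom _) = later (run-default s′≤)
      cases (atom _) inert    = later (run-default s′≤)
      cases (atom _) query    = later (run-default s′≤)
      cases (atom _) witness  = later (run-default s′≤)

    length-drop≤ : ∀ (s : Str) {n} → length s ≤ n → length (drop 2 s) ≤ n
    length-drop≤ s le = ≤-trans (≤-reflexive (List.length-drop 2 s)) (≤-trans (m∸n≤m (length s) 2) le)

    run-code : ∀ u v → Ends code (store (enc2 u v) [] [] [] [] [] []) (time (length (enc2 u v))) (σ u v)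
    run-code u v with run-dispatch (tag u) (tag v) (drop 2 u) (drop 2 v) (length-drop≤ u (enc2-longˡ u v))
      (length-drop≤ v (enc2-longʳ u v))
    ... | _ , _ , run , ans = _ , _ ,
      r-then {p = parse #0 #1} (run-parse slots₀₁ u)
      (r-then {p = pour #1 #4} (run-unpour slots₁₄ u (enc2-longˡ u v))
      (run-tagOf (λ a → tagOf #0 (dispatch a)) slot₄ u
        (run-tagOf (dispatch (tag u)) slot₀ v run))) , ans

  product-PTime : PTime (bits ⊗ bits) bits (λ { (u , v) → σ u v })
  product-PTime = pTime $ respects (λ { (u , v) → sym (map-id (σ u v)) }) (program⇒TM record
    { depth = 6
    ; code = code
    ; bound = time
    ; bounded = pb-+ (pb-linear 4) (pb-+ (pb-linear 3) (pb-+ (pb-const 4)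
      (pb-+ (pb-+ (pb-linear 3) (pb-+ (pb-linear 3) (pb-+ (pb-linear 3) (pb-linear 3))))
        (pb-+ (pb-linear 7) (pb-+ (pb-linear 4) (pb-+ (pb-linear 3)
          (pb-+ (pb-linear 4) (pb-+ (pb-linear 3) (pb-+ (pb-* (pb-+ (pb-const 1) pb-id) (pb-linear 15))
          (pb-+ (pb-linear 2) (pb-const 2)))))))))))
    ; correct = λ { (u , v) → run-code u v } })

skipRule-shorter : ∀ t₂ {t₂′} → skipRule t₂ ≡ just t₂′ → length t₂′ < length t₂
skipRule-shorter (a ∷ b ∷ c ∷ t) eq with decode a b c
skipRule-shorter (a ∷ b ∷ c ∷ t) refl | nothing = m≤n+m _ 2
skipRule-shorter (a ∷ b ∷ c ∷ t) eq   | just _  = ≤-trans (skipRule-shorter t eq) (m≤n+m _ 3)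

-- Between two executed rules the pointer can be advanced at most length t times.
witness-short : ∀ t w p t₂ l r → length t₂ ≤ length t → verifies t w p t₂ l r ≡ true →
  length w ≤ length p * suc (length t) + length t₂
witness-short t (false ∷ w) p t₂ l r le eq with skipRule t₂ in sk
... | just t₂′ = ≤-trans (s≤s (witness-short t w p t₂′ l r (≤-trans (<⇒≤ (skipRule-shorter t₂ sk)) le) eq))
  (≤-trans (≤-reflexive (sym (+-suc (length p * suc (length t)) (length t₂′))))
    (+-monoʳ-≤ (length p * suc (length t)) (skipRule-shorter t₂ sk)))
witness-short t (true ∷ w) (_ ∷ p) t₂ l r le eq with execRule t₂ l r
witness-short t (true ∷ []) (_ ∷ p) t₂ l r le eq | accepts = s≤s z≤n
... | next l′ r′ = ≤-trans (≤-trans (s≤s (witness-short t w p t l′ r′ ≤-refl eq))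
  (≤-reflexive (trans (sym (+-suc (length p * suc (length t)) (length t)))
    (+-comm (length p * suc (length t)) (suc (length t)))))) (m≤m+n _ (length t₂))

checks-short : ∀ x w → checks x w ≡ true → length w ≤ length x * suc (length x) + length x
checks-short x w eq = ≤-trans (witness-short t w p t [] r ≤-refl eq) (+-mono-≤ (*-mono-≤ p≤ (s≤s t≤)) t≤)
  where
  t′ = proj₂ (parsed x [])
  t = t′ ʳ++ []
  p = proj₁ (parsed (proj₁ (parsed x [])) [])
  r = proj₂ (parsed (proj₁ (parsed x [])) []) ʳ++ []
  t≤ : length t ≤ length x
  t≤ = ≤-trans (≤-reflexive (length-rev t′)) (≤-trans (proj₂ (parsed-short x [])) (≤-reflexive (+-identityʳ _)))
  p≤ : length p ≤ length x
  p≤ = ≤-trans (proj₁ (parsed-short (proj₁ (parsed x [])) [])) (proj₁ (parsed-short x []))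

-- Honesty, commutativity and associativity of the product

module ProductProperties (total : Bool) (_·_ : Bool → Bool → Bool) where
  open ProductProgram total _·_ public using (z; product-PTime)
  open Product z _·_ public

  -- A query times a string that is no witness for it falls under `absorb`.
  data View (u v : Str) : Set where
    atoms  : ∀ a b → u ≡ a ∷ [] → v ≡ b ∷ [] → σ u v ≡ just ((a · b) ∷ []) → View u v
    found  : ∀ x w → checks x w ≡ true → (u ≡ true ∷ false ∷ x × v ≡ true ∷ true ∷ w) ⊎
      (u ≡ true ∷ true ∷ w × v ≡ true ∷ false ∷ x) →
             σ u v ≡ just (false ∷ false ∷ x) → View u v
    absorb : σ u v ≡ z → View u v

  view : ∀ u v → View u v
  view []                  v                   = absorb refl
  view (false ∷ _ ∷ _)     v                   = absorb refl
  view (a ∷ [])            []                  = absorb refl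
  view (a ∷ [])            (b ∷ [])            = atoms a b refl refl refl
  view (a ∷ [])            (false ∷ _ ∷ _)     = absorb refl
  view (a ∷ [])            (true ∷ false ∷ _)  = absorb refl
  view (a ∷ [])            (true ∷ true ∷ _)   = absorb refl
  view (true ∷ false ∷ x)  []                  = absorb refl
  view (true ∷ false ∷ x)  (b ∷ [])            = absorb refl
  view (true ∷ false ∷ x)  (false ∷ _ ∷ _)     = absorb refl
  view (true ∷ false ∷ x)  (true ∷ false ∷ _)  = absorb refl
  view (true ∷ false ∷ x)  (true ∷ true ∷ w) with checks x w in eq
  ... | true  = found x w eq (inj₁ (refl , refl)) (cong (λ b → outcome b x) eq)
  ... | false = absorb (cong (λ b → outcome b x) eq)
  view (true ∷ true ∷ w)   []                  = absorb refl
  view (true ∷ true ∷ w)   (b ∷ [])            = absorb refl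
  view (true ∷ true ∷ w)   (false ∷ _ ∷ _)     = absorb refl
  view (true ∷ true ∷ w)   (true ∷ true ∷ _)   = absorb refl
  view (true ∷ true ∷ w)   (true ∷ false ∷ x) with checks x w in eq
  ... | true  = found x w eq (inj₂ (refl , refl)) (cong (λ b → outcome b x) eq)
  ... | false = absorb (cong (λ b → outcome b x) eq)

  σ-[]ʳ : ∀ u → σ u [] ≡ z
  σ-[]ʳ u with tag u
  ... | inert   = refl
  ... | query   = refl
  ... | witness = refl
  ... | atom _  = refl

  -- The bound of `checks-short`, plus two for the prefix of a witness. It is taken at the length of
  -- the image `00x`, which exceeds that of `x`.
  reach : ℕ → ℕ
  reach n = 2 + (n * suc n + n)

  -- The value `z` has factors of unbounded length, so it is kept apart: there the empty string
  -- replaces a long factor.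
  Near : Str → Str → Str → Set
  Near u v y = (z ≡ just y) ⊎ (length u ≤ reach (length y) × length v ≤ reach (length y))

  preimages : ∀ u v {y} → σ u v ≡ just y → Near u v y
  preimages u v {y} eq with view u v
  ... | absorb eq′ = inj₁ (trans (sym eq′) eq)
  ... | atoms a b refl refl eq′ = inj₂ (s≤s z≤n , s≤s z≤n)
  ... | found x w ok uv eq′ with refl ← trans (sym eq) eq′ = inj₂ (both uv)
    where
    n = 2 + length x
    x≤ : 2 + length x ≤ reach n
    x≤ = ≤-trans (m≤n+m n (n * suc n)) (m≤n+m _ 2)
    w≤ : 2 + length w ≤ reach n
    w≤ = s≤s (s≤s (≤-trans (checks-short x w ok) (+-mono-≤
      (*-mono-≤ (m≤n+m (length x) 2) (s≤s (m≤n+m (length x) 2))) (m≤n+m (length x) 2))))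
    both : (u ≡ true ∷ false ∷ x × v ≡ true ∷ true ∷ w) ⊎ (u ≡ true ∷ true ∷ w × v ≡ true ∷ false ∷ x) →
      length u ≤ reach n × length v ≤ reach n
    both (inj₁ (refl , refl)) = x≤ , w≤
    both (inj₂ (refl , refl)) = w≤ , x≤

  private
    pb-reach : PolyBounded reach
    pb-reach = pb-+ (pb-const 2) (pb-+ (pb-* pb-id (pb-+ (pb-const 1) pb-id)) pb-id)

    dominated = poly-dominates (pb-+ pb-reach pb-reach)
    k = proj₁ dominated

    reach≤ : ∀ n → reach n + reach n ≤ poly k n
    reach≤ = proj₂ dominated

  honest : ∀ pr → Honest pr σ
  honest pr = k , λ u v y eq → close u v y eq (preimages u v eq)
    where
    close : ∀ u v y → σ u v ≡ just y → Near u v y → Σ Str λ u′ → Σ Str λ v′ → (σ u′ v′ ≡ just y) ×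
      (length u′ + length v′ ≤ poly k (length y))
    close u v y eq (inj₁ eq′)       = [] , [] , eq′ , z≤n
    close u v y eq (inj₂ (u≤ , v≤)) = u , v , eq , ≤-trans (+-mono-≤ u≤ v≤) (reach≤ (length y))

  sHonest : ∀ pr → SHonest pr σ
  sHonest pr = k , (λ u v y eq → left u v y eq (preimages u v eq)) , (λ u v y eq → right u v y eq (preimages u v eq))
    where
    left : ∀ u v y → σ u v ≡ just y → Near u v y → Σ Str λ v′ → (σ u v′ ≡ just y) ×
      (length v′ ≤ poly k (length u + length y))
    left u v y eq (inj₁ eq′)      = [] , trans (σ-[]ʳ u) eq′ , z≤n
    left u v y eq (inj₂ (_ , v≤)) = v , eq , ≤-trans v≤
      (≤-trans (m≤m+n _ _) (≤-trans (reach≤ (length y)) (poly-mono k (m≤n+m _ _))))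
    right : ∀ u v y → σ u v ≡ just y → Near u v y → Σ Str λ u′ → (σ u′ v ≡ just y) ×
      (length u′ ≤ poly k (length v + length y))
    right u v y eq (inj₁ eq′)      = [] , eq′ , z≤n
    right u v y eq (inj₂ (u≤ , _)) = u , eq , ≤-trans u≤
      (≤-trans (m≤m+n _ _) (≤-trans (reach≤ (length y)) (poly-mono k (m≤n+m _ _))))

  combine-comm : (∀ a b → a · b ≡ b · a) → ∀ t t′ s s′ → combine t t′ s s′ ≡ combine t′ t s′ s
  combine-comm comm (atom a) (atom b) s s′ = cong (λ c → just (c ∷ [])) (comm a b)
  combine-comm comm (atom _) inert    s s′ = refl
  combine-comm comm (atom _) query    s s′ = refl
  combine-comm comm (atom _) witness  s s′ = refl
  combine-comm comm inert    (atom _) s s′ = refl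
  combine-comm comm inert    inert    s s′ = refl
  combine-comm comm inert    query    s s′ = refl
  combine-comm comm inert    witness  s s′ = refl
  combine-comm comm query    (atom _) s s′ = refl
  combine-comm comm query    inert    s s′ = refl
  combine-comm comm query    query    s s′ = refl
  combine-comm comm query    witness  s s′ = refl
  combine-comm comm witness  (atom _) s s′ = refl
  combine-comm comm witness  inert    s s′ = refl
  combine-comm comm witness  query    s s′ = refl
  combine-comm comm witness  witness  s s′ = refl

  commutative : (∀ a b → a · b ≡ b · a) → Commutative σ
  commutative comm u v = combine-comm comm (tag u) (tag v) (drop 2 u) (drop 2 v)

  Dead : Maybe Str → Set
  Dead r = ∀ y → (hat σ r (just y) ≡ z) × (hat σ (just y) r ≡ z)

  dead-product : ∀ x → Dead (just (false ∷ false ∷ x))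
  dead-product x []                 = refl , refl
  dead-product x (_ ∷ [])           = refl , refl
  dead-product x (false ∷ _ ∷ _)    = refl , refl
  dead-product x (true ∷ false ∷ _) = refl , refl
  dead-product x (true ∷ true ∷ _)  = refl , refl

  z-cases : ∀ b → let z = if b then just [] else nothing in (z ≡ nothing) ⊎ (z ≡ just {A = Str} [])
  z-cases true  = inj₂ refl
  z-cases false = inj₁ refl

  dead-z : ∀ {r} → r ≡ z → Dead r
  dead-z {r} refl y with z-cases total
  ... | inj₁ eq = subst (λ r → (hat σ r (just y) ≡ z) × (hat σ (just y) r ≡ z)) (sym eq) (sym eq , sym eq)
  ... | inj₂ eq = subst (λ r → (hat σ r (just y) ≡ z) × (hat σ (just y) r ≡ z)) (sym eq) (refl , σ-[]ʳ y)

  data Length1 (s : Str) : Set where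
    one   : ∀ a → s ≡ a ∷ [] → Length1 s
    other : (∀ a → s ≢ a ∷ []) → Length1 s

  length1 : ∀ s → Length1 s
  length1 []          = other (λ _ ())
  length1 (a ∷ [])    = one a refl
  length1 (_ ∷ _ ∷ _) = other (λ _ ())

  dead : ∀ u v → (∀ a b → u ≡ a ∷ [] → v ≡ b ∷ [] → ⊥) → Dead (σ u v)
  dead u v not-atoms with view u v
  ... | atoms a b eq eq′ _ = ⊥-elim (not-atoms a b eq eq′)
  ... | found x _ _ _ eq   = subst Dead (sym eq) (dead-product x)
  ... | absorb eq          = dead-z eq

  absorbˡ : ∀ s → (∀ a → s ≢ a ∷ []) → ∀ b → (σ s (b ∷ []) ≡ z) × (σ (b ∷ []) s ≡ z)
  absorbˡ []                  _ b = refl , refl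
  absorbˡ (a ∷ [])            n b = ⊥-elim (n a refl)
  absorbˡ (false ∷ _ ∷ _)     _ b = refl , refl
  absorbˡ (true ∷ false ∷ _)  _ b = refl , refl
  absorbˡ (true ∷ true ∷ _)   _ b = refl , refl

  -- Unless all three factors are single bits, both sides are `z`. Indeed a product is dead if its
  -- factors are not both single bits, and a single bit times a string of another length is `z`.
  associative : (∀ a b c → (a · b) · c ≡ a · (b · c)) → Associative σ
  associative assoc u v y with length1 u | length1 v | length1 y
  ... | one a refl | one b refl | one c refl = cong (λ d → just (d ∷ [])) (assoc a b c)
  ... | one a refl | one b refl | other ny   = trans (proj₂ (absorbˡ y ny (a · b)))
    (sym (proj₂ (dead (b ∷ []) y (λ _ c _ → ny c) (a ∷ []))))
  ... | one a refl | other nv   | _          = trans (proj₁ (dead (a ∷ []) v (λ _ b _ → nv b) y))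
    (sym (proj₂ (dead v y (λ b _ eq _ → nv b eq) (a ∷ []))))
  ... | other nu   | one b refl | one c refl = trans (proj₁ (dead u (b ∷ []) (λ a _ eq _ → nu a eq) (c ∷ [])))
    (sym (proj₁ (absorbˡ u nu (b · c))))
  ... | other nu   | one b refl | other ny   = trans (proj₁ (dead u (b ∷ []) (λ a _ eq _ → nu a eq) y))
    (sym (proj₂ (dead (b ∷ []) y (λ _ c _ → ny c) u)))
  ... | other nu   | other nv   | _          = trans (proj₁ (dead u v (λ a _ eq _ → nu a eq) y))
    (sym (proj₂ (dead v y (λ b _ eq _ → nv b eq) u)))

  noncommutative : ∀ a b → a · b ≢ b · a → ¬ Commutative σ
  noncommutative a b ne comm with comm (a ∷ []) (b ∷ [])
  ... | eq = ne (atom-injective eq)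
    where
    atom-injective : ∀ {c d} → just (c ∷ []) ≡ just (d ∷ []) → c ≡ d
    atom-injective refl = refl

  nonassociative : ∀ a b c → (a · b) · c ≢ a · (b · c) → ¬ Associative σ
  nonassociative a b c ne assoc with assoc (a ∷ []) (b ∷ []) (c ∷ [])
  ... | eq = ne (atom-injective eq)
    where
    atom-injective : ∀ {c d} → just (c ∷ []) ≡ just (d ∷ []) → c ≡ d
    atom-injective refl = refl

-- Rule tables of nondeterministic machines

encodeInstr : Instr → Str → Str
encodeInstr accept    t = false ∷ false ∷ true ∷ t
encodeInstr fromLeft  t = false ∷ true ∷ false ∷ t
encodeInstr toLeft    t = false ∷ true ∷ true ∷ t
encodeInstr (match b) t = true ∷ false ∷ b ∷ t
encodeInstr (write b) t = true ∷ true ∷ b ∷ t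

encodeRule : List Instr → Str → Str
encodeRule []       t = false ∷ false ∷ false ∷ t
encodeRule (i ∷ is) t = encodeInstr i (encodeRule is t)

encodeTable : List (List Instr) → Str
encodeTable []       = []
encodeTable (r ∷ rs) = encodeRule r (encodeTable rs)

executes : List Instr → Str → Str → Effect
onNext : Effect → List Instr → Effect

executes []       l r = next l r
executes (i ∷ is) l r = onNext (effect i l r) is

onNext failed     is = failed
onNext accepts    is = accepts
onNext (next l r) is = executes is l r

skipRule-encodeRule : ∀ is t → skipRule (encodeRule is t) ≡ just t
skipRule-encodeRule []             t = refl
skipRule-encodeRule (accept ∷ is)  t = skipRule-encodeRule is t
skipRule-encodeRule (fromLeft ∷ is) t = skipRule-encodeRule is t
skipRule-encodeRule (toLeft ∷ is)  t = skipRule-encodeRule is t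
skipRule-encodeRule (match b ∷ is) t = skipRule-encodeRule is t
skipRule-encodeRule (write b ∷ is) t = skipRule-encodeRule is t

execRule-encodeRule : ∀ is t l r → execRule (encodeRule is t) l r ≡ executes is l r
execRule-encodeRule []             t l r = refl
execRule-encodeRule (accept ∷ is)  t l r = refl
execRule-encodeRule (fromLeft ∷ is) t l r = execRule-encodeRule is t _ _
execRule-encodeRule (toLeft ∷ is)  t l r = execRule-encodeRule is t _ _
execRule-encodeRule (match b ∷ is) t l r with agree b (top₂ r)
... | true  = execRule-encodeRule is t _ _
... | false = refl
execRule-encodeRule (write b ∷ is) t l r = execRule-encodeRule is t _ _

-- The bits of a cell change sides one at a time, so on the left stack they lie in the opposite
-- order.
codedˡ : List Sym → Str
codedˡ []       = []
codedˡ (s ∷ ss) = payload s ∷ flag s ∷ codedˡ ss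

-- The state lies on top of the right-hand stack. Its unary code is prefix-free, so a rule for
-- another state fails before any symbol is matched.
onState : ∀ {n} → Fin n → Str → Str
onState zero    r = false ∷ r
onState (suc q) r = true ∷ onState q r

matchState : ∀ {n} → Fin n → List Instr → List Instr
matchState zero    is = match false ∷ is
matchState (suc q) is = match true ∷ matchState q is

writeState : ∀ {n} → Fin n → List Instr → List Instr
writeState zero    is = write false ∷ is
writeState (suc q) is = writeState q (write true ∷ is)

-- In place of the inequality, the second alternative carries the consequence that is wanted: the
-- rule fails.
data Dec≡ {A : Set} (a b : A) (R : Set) : Set where
  same      : a ≡ b → Dec≡ a b R
  different : R → Dec≡ a b R

executes-matchState : ∀ {n} (q q′ : Fin n) is l r →
  Dec≡ q q′ (executes (matchState q is) l (onState q′ r) ≡ failed)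
executes-matchState zero    zero     is l r = same refl
executes-matchState zero    (suc q′) is l r = different refl
executes-matchState (suc q) zero     is l r = different refl
executes-matchState (suc q) (suc q′) is l r with executes-matchState q q′ is l r
... | same refl    = same refl
... | different eq = different eq

executes-matchState-same : ∀ {n} (q : Fin n) is l r → executes (matchState q is) l (onState q r) ≡ executes is l r
executes-matchState-same zero    is l r = refl
executes-matchState-same (suc q) is l r = executes-matchState-same q is l r

executes-writeState : ∀ {n} (q : Fin n) is l r → executes (writeState q is) l r ≡ executes is l (onState q r)
executes-writeState zero    is l r = refl
executes-writeState (suc q) is l r = executes-writeState q (write true ∷ is) l r

matchSym : Sym → List Instr → List Instr
matchSym s is = match (flag s) ∷ match (payload s) ∷ is

executes-matchSym-same : ∀ is l R → executes (matchSym (top R) is) l (coded R) ≡ executes is l (coded (rest R))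
executes-matchSym-same is l []          = refl
executes-matchSym-same is l (s0 ∷ R)    = refl
executes-matchSym-same is l (s1 ∷ R)    = refl
executes-matchSym-same is l (blank ∷ R) = refl

executes-matchSym : ∀ s is l R → Dec≡ s (top R) (executes (matchSym s is) l (coded R) ≡ failed)
executes-matchSym s0    is l []          = different refl
executes-matchSym s1    is l []          = different refl
executes-matchSym blank is l []          = same refl
executes-matchSym s0    is l (s0 ∷ R)    = same refl
executes-matchSym s1    is l (s0 ∷ R)    = different refl
executes-matchSym blank is l (s0 ∷ R)    = different refl
executes-matchSym s0    is l (s1 ∷ R)    = different refl
executes-matchSym s1    is l (s1 ∷ R)    = same refl
executes-matchSym blank is l (s1 ∷ R)    = different refl
executes-matchSym s0    is l (blank ∷ R) = different refl
executes-matchSym s1    is l (blank ∷ R) = different refl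
executes-matchSym blank is l (blank ∷ R) = same refl

move : Move → List Instr → List Instr
move mS is = is
move mR is = toLeft ∷ toLeft ∷ is
move mL is = fromLeft ∷ fromLeft ∷ is

-- The transition writes s on the right-hand stack, from where both of its bits are moved.
action : ∀ {n} → Act n → List Instr
action (halt true)  = accept ∷ []
-- Writing a zero and then matching a one always fails, as a rejecting branch should.
action (halt false) = write false ∷ match true ∷ []
action (go q s m)   = write (payload s) ∷ write (flag s) ∷ move m (writeState q [])

rule : ∀ {n} → Fin n → Sym → Act n → List Instr
rule q s a = matchState q (matchSym s (action a))

moved : Sym → Move → List Sym → List Sym → List Sym × List Sym
moved s mL l R = rest l , top l ∷ s ∷ rest R
moved s mR l R = s ∷ l , rest R
moved s mS l R = l , s ∷ rest R

executes-move : ∀ {n} (q : Fin n) s m l R → executes (action (go q s m)) (codedˡ l) (coded (rest R)) ≡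
  next (codedˡ (proj₁ (moved s m l R))) (onState q (coded (proj₂ (moved s m l R))))
executes-move q s mS l R = executes-writeState q [] (codedˡ l) (flag s ∷ payload s ∷ coded (rest R))
executes-move q s mR l R = executes-writeState q [] (payload s ∷ flag s ∷ codedˡ l) (coded (rest R))
-- The exhausted left stack yields two zeros, and these are the code of a blank.
executes-move q s mL [] R = executes-writeState q [] [] (false ∷ false ∷ flag s ∷ payload s ∷ coded (rest R))
executes-move q s mL (x ∷ l) R = executes-writeState q [] (codedˡ l)
  (flag x ∷ payload x ∷ flag s ∷ payload s ∷ coded (rest R))

config-moved : ∀ {n} (q q′ : Fin n) s m l R → applyAct q s m (config q′ (before l R)) ≡ config q
  (before (proj₁ (moved s m l R)) (proj₂ (moved s m l R)))
config-moved q q′ s mL l R = applyAct-shift q q′ s mL (before l R)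
config-moved q q′ s mR l R = applyAct-shift q q′ s mR (before l R)
config-moved q q′ s mS l R = applyAct-shift q q′ s mS (before l R)

syms : List Sym
syms = s0 ∷ s1 ∷ blank ∷ []

∈-syms : ∀ s → s ∈ syms
∈-syms s0    = here refl
∈-syms s1    = there (here refl)
∈-syms blank = there (there (here refl))

afterwards : Str → Str → Str → Effect → Bool
afterwards t w p failed     = false
afterwards t w p accepts    = null w
afterwards t w p (next l r) = verifies t w p t l r

verifies-true : ∀ t w b p t₂ l r → verifies t (true ∷ w) (b ∷ p) t₂ l r ≡ afterwards t w p (execRule t₂ l r)
verifies-true t w b p t₂ l r with execRule t₂ l r
... | failed   = refl
... | accepts  = refl
... | next _ _ = refl

module Table (M : NTM) where
  open NTM M

  rulesAt : Fin nQ → Sym → List (List Instr)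
  rulesAt q s = map (rule q s) (δ q s)

  rules : List (List Instr)
  rules = concatMap (λ q → concatMap (rulesAt q) syms) (allFin nQ)

  rule-∈ : ∀ {q s a} → a ∈ δ q s → rule q s a ∈ rules
  rule-∈ {q} {s} a∈ = ∈-concatMap⁺ (λ q → concatMap (rulesAt q) syms)
    (lose (∈-allFin q) (∈-concatMap⁺ (rulesAt q) (lose (∈-syms s) (∈-map⁺ (rule q s) a∈))))

  ∈-rules : ∀ {is} → is ∈ rules → Σ (Fin nQ) λ q → Σ Sym λ s → Σ (Act nQ) λ a → (a ∈ δ q s) × (is ≡ rule q s a)
  ∈-rules is∈ with find (∈-concatMap⁻ (λ q → concatMap (rulesAt q) syms) {xs = allFin nQ} is∈)
  ... | q , _ , is∈′ with find (∈-concatMap⁻ (rulesAt q) {xs = syms} is∈′)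
  ...   | s , _ , is∈″ with ∈-map⁻ (rule q s) is∈″
  ...     | a , a∈ , eq = q , s , a , a∈ , eq

  table : Str
  table = encodeTable rules

  Verifies : Str → Str → Str → Fin nQ → List Sym → List Sym → Set
  Verifies w p t₂ q l R = verifies table w p t₂ (codedˡ l) (onState q (coded R)) ≡ true

  skip-rule : ∀ {is t₂ w p q l R} → Verifies w p t₂ q l R → Verifies (false ∷ w) p (encodeRule is t₂) q l R
  skip-rule {is} {t₂} ok rewrite skipRule-encodeRule is t₂ = ok

  skip-to : ∀ rs {rs′ w p q l R} → Verifies w p (encodeTable rs′) q l R →
    Verifies (replicate (length rs) false ++ w) p (encodeTable (rs ++ rs′)) q l R
  skip-to []       ok = ok
  skip-to (is ∷ rs) {rs′} {w} {p} {q} {l} {R} ok = skip-rule {is} {encodeTable (rs ++ rs′)} {replicate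
    (length rs) false ++ w} {p} {q} {l} {R} (skip-to rs {rs′} {w} {p} {q} {l} {R} ok)

  executes-rule : ∀ (q : Fin nQ) a l R → executes (rule q (top R) a) (codedˡ l) (onState q (coded R)) ≡ executes
    (action a) (codedˡ l) (coded (rest R))
  executes-rule q a l R = trans (executes-matchState-same q (matchSym (top R) (action a)) (codedˡ l) (coded R))
    (executes-matchSym-same (action a) (codedˡ l) R)

  -- The witness starts with one zero for each rule that precedes the wanted one in the table, and
  -- then a one.
  select : ∀ q l R a p w → a ∈ δ q (top R) →
    (∀ t₂ → Verifies (true ∷ w) p (encodeRule (rule q (top R) a) t₂) q l R) → Σ Str λ w → Verifies w p table q l R
  select q l R a p w a∈ ok with ∈-∃++ (rule-∈ a∈)
  ... | rs , rs′ , eq = replicate (length rs) false ++ (true ∷ w) ,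
    subst (λ t → verifies table (replicate (length rs) false ++ true ∷ w) p (encodeTable t) (codedˡ l)
      (onState q (coded R)) ≡ true) (sym eq)
      (skip-to rs {rule q (top R) a ∷ rs′} {true ∷ w} {p} {q} {l} {R} (ok (encodeTable rs′)))

  select-effect : ∀ {q l R a b p w eff} → a ∈ δ q (top R) → executes (action a) (codedˡ l) (coded (rest R)) ≡ eff →
    afterwards table w p eff ≡ true → Σ Str λ w → Verifies w (b ∷ p) table q l R
  select-effect {q} {l} {R} {a} {b} {p} {w} a∈ eq ok = select q l R a (b ∷ p) w a∈ λ t₂ →
    trans (verifies-true table w b p (encodeRule (rule q (top R) a) t₂) (codedˡ l) (onState q (coded R)))
      (trans (cong (afterwards table w p) (trans (execRule-encodeRule (rule q (top R) a) t₂ (codedˡ l)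
        (onState q (coded R))) (trans (executes-rule q a l R) eq))) ok)

  complete : ∀ p q l R → nacc δ (length p) (config q (before l R)) → Σ Str λ w → Verifies w p table q l R
  complete (b ∷ p) q l R acc with find acc
  ... | halt true , a∈ , _ = select-effect {b = b} {w = []} a∈ refl refl
  ... | go q′ s m , a∈ , acc′ with complete p q′ (proj₁ (moved s m l R)) (proj₂ (moved s m l R))
    (subst (nacc δ (length p)) (config-moved q′ q s m l R) acc′)
  ...   | w , ok = select-effect {b = b} {w = w} a∈ (executes-move q′ s m l R) ok

  -- The pointer may be anywhere in the table, hence the generalisation to a list `rs` of some of
  -- its rules. An executed rule that belongs to another state or symbol would have failed, so it is
  -- a legal transition.
  sound : ∀ w p rs q l R → (∀ {is} → is ∈ rs → is ∈ rules) → Verifies w p (encodeTable rs) q l R →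
    nacc δ (length p) (config q (before l R))
  by : ∀ w b p q l R a → a ∈ δ q (top R) → afterwards table w p
    (executes (action a) (codedˡ l) (coded (rest R))) ≡ true →
       nacc δ (length (b ∷ p)) (config q (before l R))

  sound (false ∷ w) p (is ∷ rs) q l R sub ok rewrite skipRule-encodeRule is (encodeTable rs) = sound w p rs q l R
    (sub ∘ there) ok
  sound (true ∷ w) (b ∷ p) (is ∷ rs) q l R sub ok with ∈-rules (sub (here refl))
  ... | q₀ , s₀ , a , a∈ , refl = decided (executes-matchState q₀ q (matchSym s₀ (action a)) (codedˡ l) (coded R))
    where
    ok′ : afterwards table w p (executes (rule q₀ s₀ a) (codedˡ l) (onState q (coded R))) ≡ true
    ok′ = trans (cong (afterwards table w p) (sym (execRule-encodeRule (rule q₀ s₀ a) (encodeTable rs) (codedˡ l)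
      (onState q (coded R)))))
      (trans (sym (verifies-true table w b p (encodeRule (rule q₀ s₀ a) (encodeTable rs)) (codedˡ l)
        (onState q (coded R)))) ok)
    impossible : executes (rule q₀ s₀ a) (codedˡ l) (onState q (coded R)) ≡ failed → ⊥
    impossible eq with () ← trans (sym (cong (afterwards table w p) eq)) ok′
    decided : Dec≡ q₀ q (executes (rule q₀ s₀ a) (codedˡ l) (onState q (coded R)) ≡ failed) →
      nacc δ (length (b ∷ p)) (config q (before l R))
    decided (different eq) = ⊥-elim (impossible eq)
    decided (same refl) with executes-matchSym s₀ (action a) (codedˡ l) R
    ... | different eq = ⊥-elim (impossible (trans (executes-matchState-same q (matchSym s₀ (action a)) (codedˡ l)
      (coded R)) eq))
    ... | same refl    = by w b p q l R a a∈ (trans (cong (afterwards table w p) (sym (executes-rule q a l R))) ok′)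

  by w b p q l R (halt true) a∈ ok = lose a∈ tt
  by w b p q l R (go q′ s m) a∈ ok = lose a∈ (subst (nacc δ (length p)) (sym (config-moved q′ q s m l R))
    (sound w p rules q′ (proj₁ (moved s m l R)) (proj₂ (moved s m l R)) id
      (trans (cong (afterwards table w p) (sym (executes-move q′ s m l R))) ok)))

  -- The query whose witnesses are the accepting runs on y with clock p.
  instance′ : Str → Str → Str
  instance′ y p = enc2 table (enc2 (onState start (coded (map toSym y))) p)

  private
    checks-instance : ∀ y p w → checks (instance′ y p) w ≡ verifies table w p table []
      (onState start (coded (map toSym y)))
    checks-instance y p w
      rewrite parsed-enc2 table {enc2 (onState start (coded (map toSym y))) p} {[]} | unrev table
      | parsed-enc2 (onState start (coded (map toSym y))) {p} {[]} | unrev (onState start (coded (map toSym y))) = refl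

    initial : ∀ y → config start (before [] (map toSym y)) ≡ initCfg start y
    initial []      = refl
    initial (_ ∷ _) = refl

  checks-complete : ∀ y p → NAccepts M (length p) y → Σ Str λ w → checks (instance′ y p) w ≡ true
  checks-complete y p acc with complete p start [] (map toSym y) (subst (nacc δ (length p)) (sym (initial y)) acc)
  ... | w , ok = w , trans (checks-instance y p w) ok

  checks-sound : ∀ y p w → checks (instance′ y p) w ≡ true → NAccepts M (length p) y
  checks-sound y p w ok = subst (nacc δ (length p)) (initial y)
    (sound w p rules start [] (map toSym y) id (trans (sym (checks-instance y p w)) ok))

-- Hardness of the product

FP⇒PTime : ∀ {f} → FP f → PTime bits bits f
FP⇒PTime {f} c = pTime (respects (λ x → sym (map-id (f x))) c)

PTime⇒FP : ∀ {f} → PTime bits bits f → FP f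
PTime⇒FP {f} (pTime c) = respects (λ x → map-id (f x)) c

PTime⇒InP : ∀ {f L} → PTime bits unit f → (∀ y → L y ⇔ (f y ≡ just tt)) → InP L
PTime⇒InP {f} (pTime (M , k , runs)) L⇔ = M , k , λ y → Maybe.map unit (f y) , runs y ,
  mk⇔ (λ Ly → accepted⇒ (Equivalence.to (L⇔ y) Ly)) (λ def → Equivalence.from (L⇔ y) (⇒accepted (f y) def))
  where
  accepted⇒ : ∀ {r} → r ≡ just tt → IsDefined (Maybe.map unit r)
  accepted⇒ refl = tt
  ⇒accepted : ∀ r → IsDefined (Maybe.map unit r) → r ≡ just tt
  ⇒accepted (just tt) _ = refl

agree-sound : ∀ a b → agree a b ≡ true → a ≡ b
agree-sound true  true  _ = refl
agree-sound false false _ = refl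

agree-refl : ∀ a → agree a a ≡ true
agree-refl true  = refl
agree-refl false = refl

pointwise-agree : ∀ s t → pointwise agree false s t ≡ true → s ≡ t
pointwise-agree []      []      _  = refl
pointwise-agree (a ∷ s) (b ∷ t) eq with agree a b in ab
... | true = cong₂ _∷_ (agree-sound a b ab) (pointwise-agree s t eq)

pointwise-agree-refl : ∀ s → pointwise agree false s s ≡ true
pointwise-agree-refl []      = refl
pointwise-agree-refl (a ∷ s) rewrite agree-refl a = pointwise-agree-refl s

onState-++ : ∀ {n} (q : Fin n) r → onState q r ≡ onState q [] ++ r
onState-++ zero    r = refl
onState-++ (suc q) r = cong (true ∷_) (onState-++ q r)

module _ (nt : NTM) (k : ℕ) where
  open Table nt

  clock : Str → Str
  clock y = replicate (poly k (length y)) true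

  instance-PTime : PTime bits bits (λ y → just (instance′ y (clock y)))
  instance-PTime = pTime $ computes $ fork {κ = bits} {μ = bits ⊗ bits} (constant table)
    (fork {κ = bits} (compose {μ = bits}
    (expanding {κ = bits} coding (λ _ → ≤-refl) {h = λ y → coded (map toSym y)} (sym ∘ expand-coding))
    (prepend {κ = bits} (onState (NTM.start nt) []) {h = onState (NTM.start nt)} (onState-++ (NTM.start nt))))
      (unary k))

module Hardness (pr : Pairing) (total : Bool) (_·_ : Bool → Bool → Bool) where
  open Pairing pr
  open ProductProperties total _·_

  paired : Str → Maybe Str
  paired p = σ (π₁ p) (π₂ p)

  paired-PTime : PTime bits bits paired
  paired-PTime = compose
    (fork (FP⇒PTime π₁-FP) (FP⇒PTime π₂-FP)) product-PTime

  polyTime : PolyTime pr σ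
  polyTime = PTime⇒FP paired-PTime

  product query′ : Str → Str
  product x = false ∷ false ∷ x
  query′  x = true ∷ false ∷ x

  product-PTime′ : PTime bits bits (just ∘ product)
  product-PTime′ = prepend (false ∷ false ∷ []) (λ _ → refl)

  query-PTime : PTime bits bits (just ∘ query′)
  query-PTime = prepend (true ∷ false ∷ []) (λ _ → refl)

  σ-witness : ∀ x w → checks x w ≡ true → σ (true ∷ false ∷ x) (true ∷ true ∷ w) ≡ just (product x)
  σ-witness x w ok = cong (λ b → outcome b x) ok

  σ-witness′ : ∀ x w → checks x w ≡ true → σ (true ∷ true ∷ w) (true ∷ false ∷ x) ≡ just (product x)
  σ-witness′ x w ok = cong (λ b → outcome b x) ok

  -- Every preimage of `00x` will do, whatever its form: single bits multiply to strings of length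
  -- one, and `z` is not of the form `00x`, so only a query with a valid witness is left.
  product-witness : ∀ u v x → σ u v ≡ just (product x) → Σ Str λ w → checks x w ≡ true
  product-witness u v x eq with view u v
  ... | atoms a b _ _ eq′ with () ← trans (sym eq) eq′
  ... | found x′ w ok _ eq′ with refl ← trans (sym eq) eq′ = w , ok
  ... | absorb eq′ with z-cases total
  ...   | inj₁ eq″ with () ← trans (sym eq) (trans eq′ eq″)
  ...   | inj₂ eq″ with () ← trans (sym eq) (trans eq′ eq″)

  module _ (h : Str → Maybe Str) (h-PTime : PTime bits bits h)
    (inverts : ∀ x w → checks x w ≡ true → Σ Str λ p → (h x ≡ just p) × (paired p ≡ just (product x))) where

    -- The answer of `h` is multiplied out and compared with `00x`, so that nothing has to be known
    -- about `h` on queries without witnesses.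
    test : Str → Maybe ⊤
    test x = (just (product x) >>= λ a → Maybe.map (a ,_) (h x >>= paired)) >>= λ { (a , b) → guard (pointwise agree false a b) }

    test-PTime : PTime bits unit test
    test-PTime = compose
      (fork product-PTime′ (compose h-PTime paired-PTime))
      (comparing agree false)

    test-complete : ∀ x w → checks x w ≡ true → test x ≡ just tt
    test-complete x w ok with inverts x w ok
    ... | p , eq , eq′ rewrite eq | eq′ | pointwise-agree-refl x = refl

    test-sound : ∀ x → test x ≡ just tt → Σ Str λ w → checks x w ≡ true
    test-sound x eq with h x
    ... | just p with paired p in eq′
    ...   | just b with pointwise agree false (product x) b in same
    ...     | true = product-witness (π₁ p) (π₂ p) x (trans eq′ (cong just (sym (pointwise-agree (product x) b same))))

    collapse : ∀ L → InNP L → InP L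
    collapse L (nt , k , recog) = PTime⇒InP
      (compose (instance-PTime nt k) test-PTime)
      (λ y → mk⇔ (to y) (from y))
      where
      open Table nt
      clock-length : ∀ y → length (clock nt k y) ≡ poly k (length y)
      clock-length y = List.length-replicate (poly k (length y))
      to : ∀ y → L y → test (instance′ y (clock nt k y)) ≡ just tt
      to y Ly = let w , ok = checks-complete y (clock nt k y) (subst (λ n → NAccepts nt n y) (sym (clock-length y)) (Equivalence.to (recog y) Ly)) in
        test-complete (instance′ y (clock nt k y)) w ok
      from : ∀ y → test (instance′ y (clock nt k y)) ≡ just tt → L y
      from y eq = let w , ok = test-sound (instance′ y (clock nt k y)) eq in
        Equivalence.from (recog y) (subst (λ n → NAccepts nt n y) (clock-length y) (checks-sound y (clock nt k y) w ok))

  noninvertible : P≢NP → Noninvertible pr σ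
  noninvertible P≢NP (f , f-FP , inverts) = P≢NP (collapse (λ x → f (product x))
    (compose product-PTime′ (FP⇒PTime f-FP))
    λ x w ok → inverts (query′ x) (true ∷ true ∷ w) (product x) (σ-witness x w ok))

  ask : (Str → Maybe Str) → Str → Maybe Str
  ask g x = g (pair (query′ x) (product x))

  ask-PTime : ∀ {g} → FP g → PTime bits bits (ask g)
  ask-PTime g-FP = compose
    (compose (fork query-PTime product-PTime′) (pair-PTime pr))
    (FP⇒PTime g-FP)

  stronglyNoninvertible : P≢NP → StronglyNoninvertible pr σ
  stronglyNoninvertible P≢NP = notFirst , notSecond
    where
    notFirst : ¬ InvFirst pr σ
    -- Putting the known factor back next to the answer of `g` gives a full preimage.
    notFirst (g , g-FP , inverts) = P≢NP (collapse h
      (compose (fork query-PTime (ask-PTime g-FP)) (pair-PTime pr)) inverts′)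
      where
      h : Str → Maybe Str
      h x = (just (query′ x) >>= λ a → Maybe.map (a ,_) (ask g x)) >>= λ { (a , b) → just (pair a b) }
      inverts′ : ∀ x w → checks x w ≡ true → Σ Str λ p → (h x ≡ just p) × (paired p ≡ just (product x))
      inverts′ x w ok with inverts (query′ x) (true ∷ true ∷ w) (product x) (σ-witness x w ok)
      ... | w′ , eq , eq′ rewrite eq = _ , refl , trans (cong₂ σ (π₁-pair _ _) (π₂-pair _ _)) eq′
    notSecond : ¬ InvSecond pr σ
    notSecond (g , g-FP , inverts) = P≢NP (collapse h
      (compose (fork (ask-PTime g-FP) query-PTime) (pair-PTime pr)) inverts′)
      where
      h : Str → Maybe Str
      h x = (ask g x >>= λ a → Maybe.map (a ,_) (just (query′ x))) >>= λ { (a , b) → just (pair a b) }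
      inverts′ : ∀ x w → checks x w ≡ true → Σ Str λ p → (h x ≡ just p) × (paired p ≡ just (product x))
      inverts′ x w ok with inverts (true ∷ true ∷ w) (query′ x) (product x) (σ-witness′ x w ok)
      ... | w′ , eq , eq′ rewrite eq = _ , refl , trans (cong₂ σ (π₁-pair _ _) (π₂-pair _ _)) eq′

  oneWay : P≢NP → OneWay pr σ
  oneWay P≢NP = polyTime , honest pr , noninvertible P≢NP

  strong : P≢NP → Strong pr σ
  strong P≢NP = polyTime , sHonest pr , stronglyNoninvertible P≢NP

isTotal : Opt → Bool
isTotal N = false
isTotal _ = true

-- Implication is neither commutative nor associative, the first projection is only associative,
-- NAND is only commutative, and conjunction is both.
operation : Opt → Opt → Bool → Bool → Bool
operation N N a b = not a ∨ b
operation N _ a b = a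
operation _ N a b = not (a ∧ b)
operation _ _ a b = a ∧ b

-- Nondeterministic guessing

nacc-mono : ∀ {n} {δ : Fin n → Sym → List (Act n)} {t u c} → t ≤ u → nacc δ t c → nacc δ u c
accAct-mono : ∀ {n} {δ : Fin n → Sym → List (Act n)} {t u c} → t ≤ u → ∀ a → accAct δ t c a → accAct δ u c a
nacc-mono {t = suc t} (s≤s t≤u) acc = Any.map (λ {a} → accAct-mono t≤u a) acc
accAct-mono t≤u (halt true) acc = tt
accAct-mono t≤u (go q s m)  acc = nacc-mono t≤u acc

-- A nondeterministic machine that writes double w 01 for an arbitrary w in front of its input s, working
-- leftwards, and then runs a deterministic machine on enc2 w s.
module Guess (M : TM) where
  open TM M

  Q : ℕ
  Q = 7 + nQ

  pattern running q = suc (suc (suc (suc (suc (suc (suc q))))))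

  embedAct : Act nQ → Act Q
  embedAct (halt b)   = halt b
  embedAct (go q s m) = go (running q) s m

  once again : Bool → Fin Q
  once false  = #3
  once true   = #4
  again false = #5
  again true  = #6

  -- The front symbol `s` is written together with the choice, so that the head is still on it if
  -- the deterministic machine is started.
  choose : Sym → List (Act Q)
  choose s = go (running start) s mS ∷ go (once false) s mL ∷ go (once true) s mL ∷ []

  δ′ : Fin Q → Sym → List (Act Q)
  δ′ #0          s = go #1 s mL ∷ []
  δ′ #1          s = go #2 s1 mL ∷ []
  δ′ #2          s = choose s0
  δ′ #3          s = go #5 s0 mL ∷ []
  δ′ #4          s = go #6 s1 mL ∷ []
  δ′ #5          s = choose s0
  δ′ #6          s = choose s1
  δ′ (running q) s = embedAct (δ q s) ∷ []

  guess : NTM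
  guess = record { nQ = Q ; start = #0 ; δ = δ′ }

  embed : Config nQ → Config Q
  embed (cfg q l s r) = cfg (running q) l s r

  embed-applyAct : ∀ q s m c → applyAct (running q) s m (embed c) ≡ embed (applyAct q s m c)
  embed-applyAct q s mS (cfg _ l _ r)       = refl
  embed-applyAct q s mL (cfg _ [] _ r)      = refl
  embed-applyAct q s mL (cfg _ (x ∷ l) _ r) = refl
  embed-applyAct q s mR (cfg _ l _ [])      = refl
  embed-applyAct q s mR (cfg _ l _ (x ∷ r)) = refl

  embed-complete : ∀ t c {o} → drun δ t c ≡ just (just o) → nacc δ′ t (embed c)
  embed-complete (suc t) c eq with δ (st c) (hd c)
  ... | halt true = here tt
  ... | go q s m  = here (subst (nacc δ′ t) (sym (embed-applyAct q s m c)) (embed-complete t (applyAct q s m c) eq))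

  embed-sound : ∀ t c → nacc δ′ t (embed c) → Σ Str λ o → drun δ t c ≡ just (just o)
  embed-sound (suc t) c (here acc) with δ (st c) (hd c)
  ... | halt true = output c , refl
  ... | go q s m  = embed-sound t (applyAct q s m c) (subst (nacc δ′ t) (embed-applyAct q s m c) acc)

  module _ (s : Str) where
    -- The tape reads `enc2 w s` except for the first symbol, which is still pending in the state.
    choice : Str → Config Q
    choice w = cfg (state w) [] blank (rest (map toSym (enc2 w s)))
      where
      state : Str → Fin Q
      state []      = #2
      state (b ∷ _) = again b

    offers : ∀ w → δ′ (st (choice w)) blank ≡ choose (top (map toSym (enc2 w s)))
    offers []          = refl
    offers (false ∷ w) = refl
    offers (true ∷ w)  = refl

    written : Str → Bool → Config Q
    written w b = cfg (once b) [] blank (map toSym (enc2 w s))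

    written-step : ∀ w b {t} → nacc δ′ (suc t) (written w b) ⇔ nacc δ′ t (choice (b ∷ w))
    written-step w false = mk⇔ (λ { (here acc) → acc ; (there ()) }) here
    written-step w true  = mk⇔ (λ { (here acc) → acc ; (there ()) }) here

    started : ∀ w → Config Q
    started w = embed (initCfg start (enc2 w s))

    applied : ∀ w → (applyAct (running start) (top (map toSym (enc2 w s))) mS (choice w) ≡ started w) ×
      (∀ b → applyAct (once b) (top (map toSym (enc2 w s))) mL (choice w) ≡ written w b)
    applied []      = refl , λ _ → refl
    applied (_ ∷ _) = refl , λ _ → refl

    choose-start : ∀ w {t} → nacc δ′ t (started w) → nacc δ′ (suc t) (choice w)
    choose-start w {t} acc = subst (Any (accAct δ′ t (choice w))) (sym (offers w))
      (here (subst (nacc δ′ t) (sym (proj₁ (applied w))) acc))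

    choose-bit : ∀ w b {t} → nacc δ′ t (written w b) → nacc δ′ (suc t) (choice w)
    choose-bit w false {t} acc = subst (Any (accAct δ′ t (choice w))) (sym (offers w))
      (there (here (subst (nacc δ′ t) (sym (proj₂ (applied w) false)) acc)))
    choose-bit w true  {t} acc = subst (Any (accAct δ′ t (choice w))) (sym (offers w))
      (there (there (here (subst (nacc δ′ t) (sym (proj₂ (applied w) true)) acc))))

    chosen : ∀ w {t} → nacc δ′ (suc t) (choice w) → nacc δ′ t (started w) ⊎ Σ Bool λ b → nacc δ′ t (written w b)
    chosen w {t} acc with subst (Any (accAct δ′ t (choice w))) (offers w) acc
    ... | here acc′                 = inj₁ (subst (nacc δ′ t) (proj₁ (applied w)) acc′)
    ... | there (here acc′)         = inj₂ (false , subst (nacc δ′ t) (proj₂ (applied w) false) acc′)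
    ... | there (there (here acc′)) = inj₂ (true , subst (nacc δ′ t) (proj₂ (applied w) true) acc′)

    write-all : ∀ w v {t} → nacc δ′ t (choice (w ʳ++ v)) → nacc δ′ (length w * 2 + t) (choice v)
    write-all []      v acc = acc
    write-all (b ∷ w) v acc = choose-bit v b (Equivalence.from (written-step v b) (write-all w (b ∷ v) acc))

    guessed : ∀ t w → nacc δ′ t (choice w) → Σ Str λ w′ → Σ ℕ λ t′ → Σ Str λ o → exec M t′ (enc2 w′ s) ≡ just (just o)
    guessed (suc t) w acc with chosen w acc
    ... | inj₁ acc′ = w , t , embed-sound t (initCfg start (enc2 w s)) acc′
    guessed (suc (suc t)) w acc | inj₂ (b , acc′) = guessed t (b ∷ w) (Equivalence.to (written-step w b) acc′)

  begins : ∀ b s {t} → NAccepts guess (2 + t) (b ∷ s) ⇔ nacc δ′ t (choice (b ∷ s) [])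
  begins b s = mk⇔ (λ { (here (here acc)) → acc ; (here (there ())) ; (there ()) }) (λ acc → here (here acc))

  -- On the empty input, the first move would leave an explicit blank behind the code, and the
  -- configuration reached would not literally be an initial one; hence `s ≢ []`.
  complete : ∀ s w {t o} → s ≢ [] → exec M t (enc2 w s) ≡ just (just o) → NAccepts guess (3 + (length w * 2 + t)) s
  complete []      w s≢[] eq = ⊥-elim (s≢[] refl)
  -- Writing proceeds leftwards, so the bits of `w` are guessed from the last one on.
  complete (b ∷ s) w {t} _ eq = Equivalence.from (begins b s) (subst (λ n → nacc δ′ n (choice (b ∷ s) []))
      (trans (cong (λ n → n * 2 + suc t) (length-rev w)) (+-suc (length w * 2) t))
    (write-all (b ∷ s) (w ʳ++ []) [] (choose-start (b ∷ s) ((w ʳ++ []) ʳ++ [])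
      (subst (λ w → nacc δ′ t (started (b ∷ s) w)) (sym (trans (rev-rev w) (List.++-identityʳ w)))
        (embed-complete t (initCfg start (enc2 w (b ∷ s))) eq)))))

  sound : ∀ s t → s ≢ [] → NAccepts guess t s → Σ Str λ w → Σ ℕ λ t′ → Σ Str λ o → exec M t′ (enc2 w s) ≡ just (just o)
  sound []      t             s≢[] acc = ⊥-elim (s≢[] refl)
  sound (b ∷ s) (suc zero)    _ (here ())
  sound (b ∷ s) (suc (suc t)) _ acc = guessed (b ∷ s) t [] (Equivalence.to (begins b s) acc)

-- A run extracted from the guessing machine has an unknown number of steps; this identifies its
-- result with that of the run within the known bound.
exec-unique : ∀ M {t u x r r′} → exec M t x ≡ just r → exec M u x ≡ just r′ → r ≡ r′
exec-unique M {t} {u} {x} eq eq′ with ≤-total t u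
... | inj₁ t≤u = just-injective (trans (sym (exec-mono M {x = x} t≤u eq)) eq′)
... | inj₂ u≤t = just-injective (trans (sym eq) (exec-mono M {x = x} u≤t eq′))

-- If P = NP, then the existence of a short string that passes a polynomial-time test can be decided.
module Existential (collapse : ∀ L → InNP L → InP L) {A C : Set} {α : Encoding A} {κ : Encoding C} {test : Str × A →
  Maybe C}
  (nonempty : ∀ a → α a ≢ []) (test-PTime : PTime (bits ⊗ α) κ test)
    (short : ∀ r a {c} → test (r , a) ≡ just c → length r ≤ length (α a)) where

  Passed : A → Set
  Passed a = Σ Str λ r → Σ C λ c → test (r , a) ≡ just c

  private
    M = proj₁ (computes test-PTime)
    k = proj₁ (proj₂ (computes test-PTime))

    runs : ∀ r a → exec M (poly k (length (enc2 r (α a)))) (enc2 r (α a)) ≡ just (Maybe.map κ (test (r , a)))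
    runs r a = proj₂ (proj₂ (computes test-PTime)) (r , a)

    open Guess M using (guess; complete; sound)

    -- Here `n` bounds both the guess and the input. Each guessed bit takes two steps, three more
    -- lead to the separator and to the start of the test, and `n * 2 + (2 + n)` bounds the length
    -- of `enc2`.
    time : ℕ → ℕ
    time n = 3 + (n * 2 + poly k (n * 2 + (2 + n)))

    dominated : Σ ℕ λ k → ∀ n → time n ≤ poly k n
    dominated = poly-dominates (pb-+ (pb-const 3) (pb-+ (pb-* pb-id (pb-const 2))
      (pb-poly k (pb-+ (pb-* pb-id (pb-const 2)) (pb-+ (pb-const 2) pb-id)))))

    K = proj₁ dominated

    -- Defined by acceptance, so that membership in NP is immediate even for strings that encode
    -- nothing; the meaning is established only at encodings `α a`.
    language : Str → Set
    language s = NAccepts guess (poly K (length s)) s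

    decided : InP language
    decided = collapse language (guess , K , λ s → mk⇔ id id)

    language-complete : ∀ a → Passed a → language (α a)
    language-complete a (r , c , eq) =
      nacc-mono (≤-trans (+-monoʳ-≤ 3 (+-mono-≤ (*-monoˡ-≤ 2 r≤) (poly-mono k enc≤))) (proj₂ dominated (length (α a))))
        (complete (α a) r (nonempty a) (trans (runs r a) (cong (just ∘ Maybe.map κ) eq)))
      where
      r≤ : length r ≤ length (α a)
      r≤ = short r a eq
      enc≤ : length (enc2 r (α a)) ≤ length (α a) * 2 + (2 + length (α a))
      enc≤ = ≤-trans (≤-reflexive (length-enc2 r (α a))) (+-monoˡ-≤ (2 + length (α a)) (*-monoˡ-≤ 2 r≤))

    map-just : ∀ (m : Maybe C) {o} → just o ≡ Maybe.map κ m → Σ C λ c → m ≡ just c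
    map-just (just c) _ = c , refl

    language-sound : ∀ a → language (α a) → Passed a
    language-sound a acc =
      let r , t , o , run = sound (α a) (poly K (length (α a))) (nonempty a) acc in
      r , map-just (test (r , a)) (exec-unique M {t} {poly k (length (enc2 r (α a)))} {enc2 r (α a)} run (runs r a))

  asks : A → Maybe Str
  asks a = proj₁ (proj₂ (proj₂ decided) (α a))

  asks-PTime : PTime α bits asks
  asks-PTime = pTime (proj₁ decided , proj₁ (proj₂ decided) , λ a →
    trans (proj₁ (proj₂ (proj₂ (proj₂ decided) (α a)))) (cong just (sym (map-id (asks a)))))

  asks-⇔ : ∀ a → language (α a) ⇔ IsDefined (asks a)
  asks-⇔ a = proj₂ (proj₂ (proj₂ (proj₂ decided) (α a)))

  asks-just : ∀ a {s} → asks a ≡ just s → Passed a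
  asks-just a eq = language-sound a (Equivalence.from (asks-⇔ a) (subst IsDefined (sym eq) tt))

  asks-nothing : ∀ a → asks a ≡ nothing → ¬ Passed a
  asks-nothing a eq c = subst IsDefined eq (Equivalence.to (asks-⇔ a) (language-complete a c))

-- Inversion under P = NP

pointwise-length : ∀ s t → pointwise (λ _ _ → true) true s t ≡ true ⇔ length s ≤ length t
pointwise-length s t = mk⇔ (to s t) (from s t)
  where
  to : ∀ s t → pointwise (λ _ _ → true) true s t ≡ true → length s ≤ length t
  to []      t       _  = z≤n
  to (_ ∷ s) (_ ∷ t) eq = s≤s (to s t eq)
  from : ∀ s t → length s ≤ length t → pointwise (λ _ _ → true) true s t ≡ true
  from []      []      _        = refl
  from []      (_ ∷ _) _        = refl
  from (_ ∷ s) (_ ∷ t) (s≤s le) = from s t le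

module Search (collapse : ∀ L → InNP L → InP L) {τ : Str → Maybe Str} (τ-PTime : PTime bits bits τ) (k : ℕ) where

  -- A suffix of the wanted preimage, a string as long as preimages may be, and the image.
  Goal : Set
  Goal = Str × Str × Str

  goal : Encoding Goal
  goal = bits ⊗ bits ⊗ bits

  Completed : Str × Goal → Set
  Completed (r , p , pad , z) = (length (r ++ p) ≤ length pad) × (τ (r ++ p) ≡ just z)

  Completable : Goal → Set
  Completable g = Σ Str λ r → Completed (r , g)

  private
    joined : Str × Goal → Maybe Str
    joined (r , p , _) = just (r ++ p)

    joined-PTime : PTime (bits ⊗ goal) bits joined
    joined-PTime = compose (fork first (compose second first)) concatenate

    pad-PTime : PTime (bits ⊗ goal) bits (λ (_ , _ , pad , _) → just pad)
    pad-PTime = compose second (compose second first)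

    image-PTime : PTime (bits ⊗ goal) bits (λ (_ , _ , _ , z) → just z)
    image-PTime = compose second (compose second second)

    short : Str × Goal → Maybe ⊤
    short (r , p , pad , z) = guard (pointwise (λ _ _ → true) true (r ++ p) pad)

    short-PTime : PTime (bits ⊗ goal) unit short
    short-PTime = compose (fork joined-PTime pad-PTime) (comparing (λ _ _ → true) true)

    matches : Str → Str → Maybe ⊤
    matches w z = (τ w >>= λ y → just (y , z)) >>= λ (y , z) → guard (pointwise agree false y z)

    matches-sound : ∀ w z → matches w z ≡ just tt → τ w ≡ just z
    matches-sound w z eq with τ w
    ... | just y with pointwise agree false y z in same
    ...   | true = cong just (pointwise-agree y z same)

    matches-complete : ∀ w z → τ w ≡ just z → matches w z ≡ just tt
    matches-complete w z eq rewrite eq | pointwise-agree-refl z = refl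

    completes : Str × Goal → Maybe (⊤ × ⊤)
    completes a@(r , p , pad , z) = short a >>= λ b → Maybe.map (b ,_) (matches (r ++ p) z)

    completes-PTime : PTime (bits ⊗ goal) (unit ⊗ unit) completes
    completes-PTime = fork short-PTime (compose (fork (compose joined-PTime τ-PTime) image-PTime)
      (comparing agree false))

    completes-sound : ∀ a → completes a ≡ just (tt , tt) → Completed a
    completes-sound (r , p , pad , z) eq with pointwise (λ _ _ → true) true (r ++ p) pad in sh
    ... | true with matches (r ++ p) z in ma
    ...   | just tt = Equivalence.to (pointwise-length (r ++ p) pad) sh , matches-sound (r ++ p) z ma

    completes-complete : ∀ a → Completed a → completes a ≡ just (tt , tt)
    completes-complete (r , p , pad , z) (sh , eq)
      rewrite Equivalence.from (pointwise-length (r ++ p) pad) sh | matches-complete (r ++ p) z eq = refl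

    completed-short : ∀ r g → Completed (r , g) → length r ≤ length (goal g)
    completed-short r (p , pad , z) (le , _) = ≤-trans (≤-trans (m≤m+n (length r) (length p))
      (≤-trans (≤-reflexive (sym (List.length-++ r))) le))
      (≤-trans (enc2-longˡ pad z) (enc2-longʳ p (enc2 pad z)))

    goal-nonempty : ∀ g → goal g ≢ []
    goal-nonempty ([] , _)    ()
    goal-nonempty (_ ∷ _ , _) ()

    open Existential collapse {α = goal} goal-nonempty completes-PTime
      (λ r g eq → completed-short r g (completes-sound (r , g) eq))
      using (asks; asks-PTime) renaming (asks-just to asks-passed; asks-nothing to asks-unpassed)

    asks-just : ∀ g {a} → asks g ≡ just a → Completable g
    asks-just g eq = let r , _ , eq′ = asks-passed g eq in r , completes-sound (r , g) eq′

    asks-nothing : ∀ g → asks g ≡ nothing → ¬ Completable g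
    asks-nothing g eq (r , ok) = asks-unpassed g eq (r , _ , completes-complete (r , g) ok)

    padding : Str → Str
    padding z = replicate (poly k (length z)) true

    begin′ : Str → Goal
    begin′ z = [] , padding z , z

    init : Str → Maybe Goal
    init z = (asks (begin′ z) >>= λ a → just (a , begin′ z)) >>= just ∘ proj₂

    begin-PTime : PTime bits goal (just ∘ begin′)
    begin-PTime = fork (constant []) (fork (unary k) identity)

    init-PTime : PTime bits goal init
    init-PTime = compose (fork (compose begin-PTime asks-PTime) begin-PTime) second

    extend : Bool → Goal → Goal
    extend b (p , g) = b ∷ p , g

    finished : Goal → Maybe ⊤
    finished (p , pad , z) = matches p z

    finished-PTime : PTime goal unit finished
    finished-PTime = compose (fork (compose first τ-PTime) (compose second second)) (comparing agree false)

    next-step advance : Goal → Maybe (Goal ⊎ Str)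
    next-step g = if is-just (asks (extend false g)) then just (inj₁ (extend false g)) else just (inj₁ (extend true g))
    advance g = if is-just (finished g) then just (inj₂ (proj₁ g)) else next-step g

    -- This is where searching for suffixes pays off: a new front bit merely puts `b b` in front of
    -- the doubled code of `p`. The leading `false` is the tag of `inj₁`.
    extend-PTime : ∀ b → PTime goal (goal ⊕ bits) (λ g → just (inj₁ (extend b g)))
    extend-PTime b = prepend (false ∷ b ∷ b ∷ []) (λ _ → refl)

    advance-PTime : PTime goal (goal ⊕ bits) advance
    advance-PTime = ite finished-PTime (compose first (prepend (true ∷ []) (λ _ → refl)))
      (ite (compose (prepend (false ∷ false ∷ []) {h = extend false} (λ _ → refl)) asks-PTime) (extend-PTime false)
        (extend-PTime true))

    advance-finished : ∀ p pad z → finished (p , pad , z) ≡ just tt → advance (p , pad , z) ≡ just (inj₂ p)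
    advance-finished p pad z eq = cong (λ f → if is-just f then just (inj₂ p) else next-step (p , pad , z)) eq

    advance-next : ∀ g → finished g ≡ nothing → advance g ≡ next-step g
    advance-next g eq = cong (λ f → if is-just f then just (inj₂ (proj₁ g)) else next-step g) eq

    next-just : ∀ g {a} → asks (extend false g) ≡ just a → next-step g ≡ just (inj₁ (extend false g))
    next-just g eq = cong (λ f → if is-just f then just (inj₁ (extend false g)) else just (inj₁ (extend true g))) eq

    next-nothing : ∀ g → asks (extend false g) ≡ nothing → next-step g ≡ just (inj₁ (extend true g))
    next-nothing g eq = cong (λ f → if is-just f then just (inj₁ (extend false g)) else just (inj₁ (extend true g))) eq

    goalSize : ℕ → ℕ
    goalSize n = 4 + (poly k n * 4 + n)

    pb-goalSize : PolyBounded goalSize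
    pb-goalSize = pb-+ (pb-const 4) (pb-+ (pb-* (pb-poly k pb-id) (pb-const 4)) pb-id)

    goal-small : ∀ p z → length p ≤ length (padding z) → length (goal (p , padding z , z)) ≤ goalSize (length z)
    goal-small p z le = ≤-trans (≤-reflexive (trans (length-enc2 p (enc2 (padding z) z))
      (cong (λ m → length p * 2 + (2 + m)) (length-enc2 (padding z) z))))
      (≤-trans (+-mono-≤ (*-monoˡ-≤ 2 (≤-trans le (≤-reflexive pad)))
        (+-monoʳ-≤ 2 (+-monoˡ-≤ (2 + length z) (*-monoˡ-≤ 2 (≤-reflexive pad)))))
        (≤-reflexive (arith (poly k (length z)) (length z))))
      where
      pad : length (padding z) ≡ poly k (length z)
      pad = List.length-replicate (poly k (length z))
      arith : ∀ a n → a * 2 + (2 + (a * 2 + (2 + n))) ≡ 4 + (a * 4 + n)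
      arith = solve-∀

    -- The last bit of r is the one by which p can be extended.
    extension : ∀ p pad z → Completable (p , pad , z) → finished (p , pad , z) ≡ nothing →
      (length p < length pad) × Σ Bool λ b → Completable (extend b (p , pad , z))
    extension p pad z (r , le , eq) unfinished with initLast r
    ... | [] with () ← trans (sym (matches-complete p z eq)) unfinished
    ... | r′ ∷ʳ′ b = ≤-trans (≤-trans (m≤n+m (suc (length p)) (length r′)) (≤-reflexive (sym (List.length-++ r′)))) le′
        , b , r′ , le′ , trans (cong τ (sym regroup)) eq
      where
      regroup : (r′ ∷ʳ b) ++ p ≡ r′ ++ b ∷ p
      regroup = List.++-assoc r′ (b ∷ []) p
      le′ : length (r′ ++ b ∷ p) ≤ length pad
      le′ = subst (λ s → length s ≤ length pad) regroup le

    Found : ℕ → Str → Str → Set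
    Found m p z = Σ Str λ w → Σ ℕ λ n → (n ≤ suc m) × (τ w ≡ just z) ×
      Iterates {ι = bits} {σ = goal} {κ = bits} advance (goalSize (length z)) (p , padding z , z) n w

    -- Completability is the invariant: if a zero in front cannot be completed, a one can. The
    -- number `m` bounds how many bits may still be added; when it is used up, `p` is as long as the
    -- padding and must be a preimage itself.
    search : ∀ m p z → length (padding z) ≤ m + length p → Completable (p , padding z , z) → Found m p z
    search m p z room c@(r , le , eq) = by-finished (finished (p , padding z , z)) refl
      where
      p≤ : length p ≤ length (padding z)
      p≤ = ≤-trans (≤-trans (m≤n+m (length p) (length r)) (≤-reflexive (sym (List.length-++ r)))) le
      continue : ∀ m b → length (padding z) ≤ m + length p → length p < length (padding z) →
        advance (p , padding z , z) ≡ just (inj₁ (b ∷ p , padding z , z)) → Completable (b ∷ p , padding z , z) →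
          Found m p z
      continue zero b room lt _ _ = ⊥-elim (<-irrefl refl (≤-trans lt room))
      continue (suc m) b room lt adv c =
        let w , n , n≤ , ok , its = search m (b ∷ p) z (≤-trans room (≤-reflexive (sym (+-suc m (length p))))) c in
        w , suc n , s≤s n≤ , ok , go (goal-small p z p≤) adv its
      by-asks : ∀ a → asks (false ∷ p , padding z , z) ≡ a → finished (p , padding z , z) ≡ nothing → Found m p z
      by-asks (just _) eq₁ eq₂ = continue m false room (proj₁ (extension p (padding z) z c eq₂))
        (trans (advance-next (p , padding z , z) eq₂) (next-just (p , padding z , z) eq₁))
          (asks-just (false ∷ p , padding z , z) eq₁)
      by-asks nothing eq₁ eq₂ = let lt , b , c′ = extension p (padding z) z c eq₂ in other b lt c′
        where
        other : ∀ b → length p < length (padding z) → Completable (b ∷ p , padding z , z) → Found m p z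
        other false lt c′ = ⊥-elim (asks-nothing (false ∷ p , padding z , z) eq₁ c′)
        other true  lt c′ = continue m true room lt (trans (advance-next (p , padding z , z) eq₂)
          (next-nothing (p , padding z , z) eq₁)) c′
      by-finished : ∀ f → finished (p , padding z , z) ≡ f → Found m p z
      by-finished (just tt) eq = p , 1 , s≤s z≤n , matches-sound p z eq ,
        stop (goal-small p z p≤) (advance-finished p (padding z) z eq)
      by-finished nothing   eq = by-asks (asks (false ∷ p , padding z , z)) refl eq

    -- The value of the inverse comes with the trace of the loop that produces it, which is what
    -- `iterate` needs to make it a polynomial-time function.
    Result : Str → Set
    Result z = Σ (Maybe Str) λ r → Outcome {ι = bits} {σ = goal} {κ = bits} advance init goalSize z r ×
      (∀ w → length w ≤ length (padding z) → τ w ≡ just z → Σ Str λ w → (r ≡ just w) × (τ w ≡ just z))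

    result : ∀ z → Result z
    result z = by-asks (asks (begin′ z)) refl
      where
      by-asks : ∀ a → asks (begin′ z) ≡ a → Result z
      by-asks nothing eq = nothing , undefined (cong (λ a → (a >>= λ a → just (a , begin′ z)) >>= just ∘ proj₂) eq)
        , λ w le ok → ⊥-elim (asks-nothing (begin′ z) eq
          (w , subst (λ s → (length s ≤ length (padding z)) × (τ s ≡ just z)) (sym (List.++-identityʳ w)) (le , ok)))
      by-asks (just a) eq =
        let w , n , n≤ , ok , its = search (length (padding z)) [] z (m≤m+n (length (padding z)) 0) (asks-just (begin′ z) eq) in
        just w
        , defined (cong (λ a → (a >>= λ a → just (a , begin′ z)) >>= just ∘ proj₂) eq) (≤-trans n≤ small) its
        , λ _ _ _ → w , refl , ok
        where
        small : suc (length (padding z)) ≤ goalSize (length z)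
        small = s≤s (≤-trans (≤-reflexive (List.length-replicate (poly k (length z))))
          (≤-trans (m≤m*n (poly k (length z)) 4)
          (≤-trans (m≤m+n _ (length z)) (m≤n+m _ 3))))

  inverse : Str → Maybe Str
  inverse z = proj₁ (result z)

  inverse-PTime : PTime bits bits inverse
  inverse-PTime = iterate advance pb-goalSize init-PTime advance-PTime (λ z → proj₁ (proj₂ (result z)))

  inverse-inverts : ∀ z w → length w ≤ poly k (length z) → τ w ≡ just z → Σ Str λ w → (inverse z ≡ just w) ×
    (τ w ≡ just z)
  inverse-inverts z w le = proj₂ (proj₂ (result z)) w (≤-trans le
    (≤-reflexive (sym (List.length-replicate (poly k (length z))))))

module _ (pr : Pairing) where
  open Pairing pr

  -- Honesty bounds the lengths of the two factors, whereas the search needs a bound for their pair.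
  -- The pair is the output of a polynomial-time machine on `enc2 x y`, so it is polynomially short
  -- too.
  oneWay⇒P≢NP : ∀ {σ} → OneWay pr σ → P≢NP
  oneWay⇒P≢NP {σ} (polyTime , (h , honest) , noninvertible) collapse = noninvertible
    (inverse , PTime⇒FP inverse-PTime , λ x y z eq → inverted x y z eq (honest x y z eq))
    where
    M₁ = proj₁ (computes (pair-PTime pr))
    k₁ = proj₁ (proj₂ (computes (pair-PTime pr)))
    dominated : Σ ℕ λ k → ∀ n → cost k₁ (poly h n * 2 + 2) ≤ poly k n
    dominated = poly-dominates (pb-cost k₁ (pb-+ (pb-* (pb-poly h pb-id) (pb-const 2)) (pb-const 2)))
    τ : Str → Maybe Str
    τ w = σ (π₁ w) (π₂ w)
    open Search collapse {τ} (FP⇒PTime polyTime) (proj₁ dominated)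
    short : ∀ x y n → length x + length y ≤ poly h n → length (pair x y) ≤ poly (proj₁ dominated) n
    short x y n le = ≤-trans (short-callTM M₁ k₁ {x = enc2 x y} {res = just (pair x y)}
      (proj₂ (proj₂ (computes (pair-PTime pr))) (x , y)))
      (≤-trans (cost-mono k₁ (≤-trans (≤-reflexive (length-enc2 x y))
        (≤-trans (≤-trans (+-monoʳ-≤ (length x * 2) (+-monoʳ-≤ 2 (m≤m*n (length y) 2)))
          (≤-reflexive (arith (length x) (length y)))) (+-monoˡ-≤ 2 (*-monoˡ-≤ 2 le)))))
        (proj₂ dominated n))
      where
      arith : ∀ a b → a * 2 + (2 + b * 2) ≡ (a + b) * 2 + 2
      arith = solve-∀
    inverted : ∀ x y z → σ x y ≡ just z → (Σ Str λ x′ → Σ Str λ y′ → (σ x′ y′ ≡ just z) ×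
      (length x′ + length y′ ≤ poly h (length z))) →
      Σ Str λ w → (inverse z ≡ just w) × (τ w ≡ just z)
    inverted x y z _ (x′ , y′ , eq , le) = inverse-inverts z (pair x′ y′) (short x′ y′ (length z) le)
      (trans (cong₂ σ (π₁-pair x′ y′) (π₂-pair x′ y′)) eq)

-- The prescribed combination of properties

total-cond : ∀ t c a → cond t (Total (ProductProperties.σ (isTotal t) (operation c a)))
total-cond Y c a u v = total (view u v)
  where
  open ProductProperties true (operation c a)
  total : View u v → Σ Str λ y → σ u v ≡ just y
  total (atoms _ _ _ _ eq) = _ , eq
  total (found _ _ _ _ eq) = _ , eq
  total (absorb eq)        = _ , eq
total-cond N c a total with () ← proj₂ (total [] [])
total-cond ⋆ c a = tt

commutative-cond : ∀ t c a → cond c (Commutative (ProductProperties.σ (isTotal t) (operation c a)))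
commutative-cond t ⋆ a = tt
commutative-cond t Y Y = ProductProperties.commutative (isTotal t) (operation Y Y) λ { false false → refl ; false true → refl ; true false → refl ; true true → refl }
commutative-cond t Y N = ProductProperties.commutative (isTotal t) (operation Y N) λ { false false → refl ; false true → refl ; true false → refl ; true true → refl }
commutative-cond t Y ⋆ = ProductProperties.commutative (isTotal t) (operation Y ⋆) λ { false false → refl ; false true → refl ; true false → refl ; true true → refl }
commutative-cond t N Y = ProductProperties.noncommutative (isTotal t) (operation N Y) false true λ ()
commutative-cond t N N = ProductProperties.noncommutative (isTotal t) (operation N N) false true λ ()
commutative-cond t N ⋆ = ProductProperties.noncommutative (isTotal t) (operation N ⋆) false true λ ()

associative-cond : ∀ t c a → cond a (Associative (ProductProperties.σ (isTotal t) (operation c a)))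
associative-cond t c ⋆ = tt
associative-cond t Y Y = ProductProperties.associative (isTotal t) (operation Y Y) λ { false _ _ → refl ; true _ _ → refl }
associative-cond t N Y = ProductProperties.associative (isTotal t) (operation N Y) λ _ _ _ → refl
associative-cond t ⋆ Y = ProductProperties.associative (isTotal t) (operation ⋆ Y) λ { false _ _ → refl ; true _ _ → refl }
associative-cond t Y N = ProductProperties.nonassociative (isTotal t) (operation Y N) false false true λ ()
associative-cond t N N = ProductProperties.nonassociative (isTotal t) (operation N N) false false false λ ()
associative-cond t ⋆ N = ProductProperties.nonassociative (isTotal t) (operation ⋆ N) false false true λ ()

theorem9 : (pr : Pairing) (t c a : Opt) →
    (Σ Fn2 (OWF pr Y t c a)) ⇔ P≢NP
theorem9 pr t c a = mk⇔ (λ (σ , oneWay , _) → oneWay⇒P≢NP pr oneWay) λ hard →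
  ProductProperties.σ (isTotal t) (operation c a) ,
  Hardness.oneWay pr (isTotal t) (operation c a) hard ,
  Hardness.strong pr (isTotal t) (operation c a) hard ,
  total-cond t c a , commutative-cond t c a , associative-cond t c a
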